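{- Let $n\ge 1$ be an integer and let $G$ be a connected graph which is cospectral with the friendship graph $F_n$. If $G$ does not have the cycle $C_5$ as a (not necessarily induced) subgraph, then $G$ is isomorphic to $F_n$.
   Context: All graphs are finite, simple and undirected. The friendship graph $F_n$ ($n\ge 1$) is the graph with $2n+1$ vertices and $3n$ edges obtained from $n$ copies of the triangle $C_3$ by identifying one vertex of each copy into a single common vertex. Two graphs are cospectral if their $(0,1)$-adjacency matrices have the same multiset of eigenvalues. -}

module Defs where

open import Algebra.Apartness.Bundles using (HeytingField; HeytingCommutativeRing)
open import Algebra.Bundles using (CommutativeRing)
import Algebra.Definitions.RawMonoid as RawMonoidDefs
open import Data.Bool.Base using (if_then_else_)
open import Data.Empty using (⊥)
open import Data.Fin.Base using (Fin; zero; suc; toℕ; punchIn; quotient)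
open import Data.Fin.Properties using (_≟_; all?)
import Data.List.Relation.Binary.Permutation.Setoid as Permutation
open import Data.Nat.Base as ℕ using (ℕ; zero; suc)
open import Data.Nat.DivMod using (_mod_)
open import Data.Product.Base using (Σ-syntax; ∃-syntax; _×_; _,_; map)
open import Data.Sum.Base using (_⊎_; swap; reduce)
open import Data.Unit.Base using (⊤; tt)
open import Data.Vec.Base as Vec using (Vec)
open import Function.Base using (_∘_)
open import Function.Bundles using (_↔_; _⇔_; Inverse)
open import Function.Definitions using (Injective)
open import Level using (Level; 0ℓ; _⊔_)
open import Relation.Binary.Construct.Closure.ReflexiveTransitive using (Star)
open import Relation.Binary.Core using (Rel)
open import Relation.Binary.Definitions using (Decidable; Symmetric)
open import Relation.Binary.PropositionalEquality.Core using (_≡_; _≢_; sym)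
open import Relation.Nullary.Decidable.Core
  using (yes; no; does; ¬?; _×-dec_; _⊎-dec_; from-yes)
open import Relation.Nullary.Negation.Core using (¬_)

------------------------------------------------------------------------
-- Graphs

record Graph (n : ℕ) : Set₁ where
  infix 4 _~_ _~?_
  field
    _~_      : Rel (Fin n) 0ℓ
    _~?_     : Decidable _~_
    ~-sym    : Symmetric _~_
    ~-irrefl : ∀ {i} → ¬ (i ~ i)

Connected : ∀ {n} → Graph n → Set
Connected G = ∀ i j → Star _~_ i j
  where open Graph G

_≅_ : ∀ {m n} → Graph m → Graph n → Set
_≅_ {m} {n} G H =
  Σ[ φ ∈ Fin m ↔ Fin n ]
    (∀ i j → (i G.~ j) ⇔ (Inverse.to φ i H.~ Inverse.to φ j))
  where
  module G = Graph G
  module H = Graph H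

-- H occurs in G as a subgraph, not necessarily induced.
_⊑_ : ∀ {m n} → Graph m → Graph n → Set
_⊑_ {m} {n} H G =
  Σ[ f ∈ (Fin m → Fin n) ]
    (Injective _≡_ _≡_ f × (∀ {i j} → i H.~ j → f i G.~ f j))
  where
  module G = Graph G
  module H = Graph H

C₅ : Graph 5
C₅ = record
  { _~_      = _~_
  ; _~?_     = λ i j → (j ≟ next i) ⊎-dec (i ≟ next j)
  ; ~-sym    = swap
  ; ~-irrefl = λ {i} → next-≢ i ∘ reduce
  }
  where
  next : Fin 5 → Fin 5
  next i = suc (toℕ i) mod 5

  _~_ : Rel (Fin 5) 0ℓ
  i ~ j = j ≡ next i ⊎ i ≡ next j

  next-≢ : ∀ i → i ≢ next i
  next-≢ = from-yes (all? (λ i → ¬? (i ≟ next i)))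

-- Vertex zero is the common vertex; the remaining 2n vertices suc i are
-- grouped into n pairs by quotient 2 i, one pair for each triangle.
friendship : (n : ℕ) → Graph (suc (n ℕ.* 2))
friendship n = record
  { _~_      = _~_
  ; _~?_     = dec
  ; ~-sym    = λ {i} {j} → ~-sym i j
  ; ~-irrefl = λ {i} → ~-irrefl i
  }
  where
  _~_ : Rel (Fin (suc (n ℕ.* 2))) 0ℓ
  zero  ~ zero  = ⊥
  zero  ~ suc _ = ⊤
  suc _ ~ zero  = ⊤
  suc i ~ suc j = i ≢ j × quotient {n} 2 i ≡ quotient {n} 2 j

  dec : Decidable _~_
  dec zero    zero    = no λ ()
  dec zero    (suc _) = yes tt
  dec (suc _) zero    = yes tt
  dec (suc i) (suc j) = ¬? (i ≟ j) ×-dec (quotient {n} 2 i ≟ quotient {n} 2 j)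

  ~-sym : ∀ i j → i ~ j → j ~ i
  ~-sym zero    (suc _) _ = tt
  ~-sym (suc _) zero    _ = tt
  ~-sym (suc _) (suc _)   = map (_∘ sym) sym

  ~-irrefl : ∀ i → ¬ (i ~ i)
  ~-irrefl (suc i) (i≢i , _) = i≢i _≡_.refl

------------------------------------------------------------------------
-- Spectra
--
-- The standard library has no real numbers, so eigenvalues are taken in
-- an arbitrary field K of characteristic zero. The apartness of a
-- Heyting field only serves to make constructive fields such as ℝ
-- instances; a discrete field is one with x # y given by ¬ x ≈ y.

module _ {c ℓ₁ ℓ₂ : Level} (K : HeytingField c ℓ₁ ℓ₂) where

  open HeytingField K hiding (zero; sym)

  private
    R : CommutativeRing c ℓ₁
    R = HeytingCommutativeRing.commutativeRing heytingCommutativeRing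

    module + = RawMonoidDefs (CommutativeRing.+-rawMonoid R)

  open Permutation (CommutativeRing.setoid R) using (_↭_)

  CharacteristicZero : Set ℓ₁
  CharacteristicZero = ∀ k → ¬ (suc k +.× 1# ≈ 0#)

  Matrix : ℕ → Set c
  Matrix n = Fin n → Fin n → Carrier

  sign : ℕ → Carrier
  sign zero    = 1#
  sign (suc k) = - sign k

  -- Laplace expansion along the first row.
  det : ∀ {n} → Matrix n → Carrier
  det {zero}  M = 1#
  det {suc n} M =
    +.sum λ j → sign (toℕ j) * (M zero j * det (λ i k → M (suc i) (punchIn j k)))

  identity : ∀ {n} → Matrix n
  identity i j = if does (i ≟ j) then 1# else 0#

  -- The value at x of the characteristic polynomial det (x I − M).
  charPoly : ∀ {n} → Matrix n → Carrier → Carrier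
  charPoly M x = det (λ i j → x * identity i j - M i j)

  -- λs lists the eigenvalues of M with multiplicity: the characteristic
  -- polynomial is the product of the factors x − λᵢ. Over a field of
  -- characteristic zero, which is infinite, polynomials are determined by
  -- their values, so equality of polynomials is stated pointwise.
  IsSpectrum : ∀ {n} → Matrix n → Vec Carrier n → Set (c ⊔ ℓ₁)
  IsSpectrum M λs =
    ∀ x → charPoly M x ≈ Vec.foldr (λ _ → Carrier) (λ λᵢ p → (x - λᵢ) * p) 1# λs

  adjacency : ∀ {n} → Graph n → Matrix n
  adjacency G i j = if does (i ~? j) then 1# else 0#
    where open Graph G

  -- Both characteristic polynomials are required to split over K, so that
  -- no eigenvalue lies outside K.
  Cospectral : ∀ {m n} → Graph m → Graph n → Set (c ⊔ ℓ₁)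
  Cospectral G H =
    ∃[ λs ] ∃[ μs ]
      ( IsSpectrum (adjacency G) λs
      × IsSpectrum (adjacency H) μs
      × Vec.toList λs ↭ Vec.toList μs
      )

-- Everything is transferred to ℤ. Equality of the characteristic polynomials gives
-- det (1 + t A) = det (1 + t F) for all integers t, where A and F are the adjacency matrices of G
-- and of the friendship graph. Jacobi's formula, read modulo powers of the integer t, then gives
-- tr p(A) = tr p(F) for every integer polynomial p.
--
-- F is a root of (x² − 1)(x² − x − 2n) and all 3×3 minors of F² − 1 vanish. For the symmetric
-- matrix A both properties are equations "a sum of squares is zero" whose left-hand side is a
-- polynomial in traces, so A shares them. Hence C = A² − 1, whose off-diagonal entries count common
-- neighbours and whose diagonal entries are the degrees minus one, satisfies C² = CA + (2n − 1) C
-- and has rank at most two.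
--
-- No vertex has degree below 2, and the average degree is below 3, so some u has degree 2. Let x
-- and y be its neighbours. In a C₅-free graph there is no path x z w y avoiding u, which together
-- with the rank condition forces x and y to be adjacent, to have no common neighbour besides u, and
-- one of them to be adjacent to all other vertices. Counting edges, the remaining vertices have
-- degree 2, so they are matched in pairs.
module Submission where

open import Defs hiding (det)
import Defs
open import Algebra.Apartness.Bundles using (HeytingField; HeytingCommutativeRing)
open import Algebra.Bundles using (CommutativeRing)
import Algebra.Properties.CommutativeSemigroup
import Algebra.Properties.Group
import Algebra.Properties.Ring
import Algebra.Properties.Semiring.Mult
import Algebra.Properties.Semiring.Sum
open import Data.Bool.Base using (if_then_else_)
open import Data.Empty using (⊥; ⊥-elim)
open import Data.Fin.Base
  using (Fin; zero; suc; toℕ; punchIn; punchOut; inject₁; quotient; remainder; combine)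
import Data.Fin.Base as Fin
open import Data.Fin.Patterns using (0F; 1F; 2F; 3F; 4F)
open import Data.Fin.Properties
  using (_≟_; any?; all?; ¬∀⟶∃¬; pigeonhole; injective⇒≤; <-cmp; <⇒≢; toℕ-injective; toℕ-inject₁;
         suc-injective; punchInᵢ≢i; punchIn-injective; punchIn-punchOut; punchOut-injective;
         remQuot-combine; combine-remQuot)
open import Data.Integer.Base using (ℤ; -[1+_]; _⊖_; 0ℤ; 1ℤ; -1ℤ; ∣_∣) renaming (+_ to pos)
import Data.Integer.Base as ℤ
import Data.Integer.Properties as ℤ
open import Data.Integer.Tactic.RingSolver using (solve-∀)
import Data.List.Base as List
import Data.List.Relation.Binary.Permutation.Setoid.Properties as Perm
open import Data.Nat.Base as ℕ using (ℕ; zero; suc; z≤n; s≤s)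
open import Data.Nat.DivMod using (_mod_)
import Data.Nat.Properties as ℕ
open import Data.Product.Base using (∃-syntax; _×_; _,_; proj₁; proj₂)
open import Data.Sum.Base using (_⊎_; inj₁; inj₂; [_,_]′; reduce)
open import Data.Unit.Base using (tt)
open import Data.Vec.Base as Vec using (Vec; []; _∷_)
import Data.Vec.Properties as Vec
open import Function.Base using (_∘_; id)
open import Function.Bundles using (_⇔_; mk⇔; mk↔ₛ′)
open import Function.Definitions using (Injective)
open import Relation.Binary.Construct.Closure.ReflexiveTransitive using (Star; ε; _◅_)
open import Relation.Binary.Definitions using (tri<; tri≈; tri>)
import Relation.Binary.PropositionalEquality as ≡
open ≡ using (_≡_; _≢_)
import Relation.Binary.Reasoning.Setoid
open import Relation.Nullary.Decidable.Core using (Dec; yes; no; does)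
open import Relation.Nullary.Negation.Core using (¬_; contradiction)

-- The choice of `𝕔` comes from the spectrum of the friendship graph: besides the two roots of x² -
-- x - 2n only 1 and -1 occur, and x² - 1 kills these, which leaves rank at most two. With real
-- eigenvalues and an orthonormal eigenbasis this would pass to G at once. But K is an arbitrary
-- field of characteristic zero with an apartness: in general it has no order in which a vanishing
-- sum of squares says anything, and its equality is not decidable. The adjacency matrices are
-- integral, and ℤ has an order, decidable equality and no zero divisors. So K is left as soon as
-- the determinants are compared, and traces replace the eigenbasis: for symmetric X the trace of X²
-- is the sum of the squared entries, and Cauchy-Binet does the same for 3×3 minors. The pencil 1 +
-- t A is preferred to x - A because its determinant is congruent to 1 modulo t and can be cancelled
-- there, so the traces are obtained one power at a time. Limits are replaced by the fact that an
-- integer divisible by every nonzero integer is zero.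

private variable
  m n : ℕ

-- Determinants and traces over ℤ

module IntegerMatrices where

  open import Relation.Binary.PropositionalEquality
    using (refl; sym; trans; cong; cong₂; subst; module ≡-Reasoning)
  open ≡-Reasoning
  open import Data.Integer.Base using (-_; _+_; _-_; _*_)
  open import Data.Integer.Properties
    using (+-*-semiring; +-identityʳ; *-zeroʳ; *-identityˡ; *-identityʳ; *-assoc; *-comm; abs-*;
           ∣i∣≡0⇒i≡0; i*j≡0⇒i≡0∨j≡0; i-j≡0⇒i≡j; i≡j⇒i-j≡0)
  open Algebra.Properties.Semiring.Sum +-*-semiring
    using (sum; sum-cong-≗; sum-remove; sum-replicate-zero; ∑-distrib-+; ∑-comm; *-distribˡ-sum)

  opaque

    ∑ : (Fin n → ℤ) → ℤ
    ∑ = sum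

    ∑-empty : (f : Fin 0 → ℤ) → ∑ f ≡ 0ℤ
    ∑-empty f = refl

    ∑-suc : (f : Fin (suc n) → ℤ) → ∑ f ≡ f zero + ∑ (λ i → f (suc i))
    ∑-suc f = refl

    ∑-cong : {f g : Fin n → ℤ} → (∀ i → f i ≡ g i) → ∑ f ≡ ∑ g
    ∑-cong = sum-cong-≗

    ∑-remove : ∀ i (f : Fin (suc n) → ℤ) → ∑ f ≡ f i + ∑ (λ k → f (punchIn i k))
    ∑-remove i f = sum-remove {i = i} f

    ∑-swap : (f : Fin m → Fin n → ℤ) → (∑ λ i → ∑ λ j → f i j) ≡ (∑ λ j → ∑ λ i → f i j)
    ∑-swap = ∑-comm

    ∑-*ˡ : ∀ p (f : Fin n → ℤ) → p * ∑ f ≡ (∑ λ i → p * f i)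
    ∑-*ˡ = *-distribˡ-sum

    ∑-+ : (f g : Fin n → ℤ) → (∑ λ i → f i + g i) ≡ ∑ f + ∑ g
    ∑-+ = ∑-distrib-+

    ∑-zero : {f : Fin n → ℤ} → (∀ i → f i ≡ 0ℤ) → ∑ f ≡ 0ℤ
    ∑-zero {n} f≡0 = trans (sum-cong-≗ f≡0) (sum-replicate-zero n)

  ∑-single : ∀ (f : Fin n → ℤ) i → (∀ j → j ≢ i → f j ≡ 0ℤ) → ∑ f ≡ f i
  ∑-single {suc n} f i f≡0 = begin
    ∑ f                               ≡⟨ ∑-remove i f ⟩
    f i + ∑ (λ k → f (punchIn i k))   ≡⟨ cong (f i +_) (∑-zero λ k → f≡0 _ (punchInᵢ≢i i k)) ⟩
    f i + 0ℤ                          ≡⟨ +-identityʳ (f i) ⟩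
    f i                               ∎

  ∑-pair : ∀ (f : Fin n → ℤ) a b → a ≢ b → (∀ j → j ≢ a → j ≢ b → f j ≡ 0ℤ) → ∑ f ≡ f a + f b
  ∑-pair {suc n} f a b a≢b f≡0 = begin
    ∑ f                                ≡⟨ ∑-remove a f ⟩
    f a + ∑ (λ k → f (punchIn a k))    ≡⟨ cong (f a +_) (∑-single (λ k → f (punchIn a k)) (punchOut a≢b) other) ⟩
    f a + f (punchIn a (punchOut a≢b)) ≡⟨ cong (λ k → f a + f k) (punchIn-punchOut a≢b) ⟩
    f a + f b                          ∎
    where
    other : ∀ k → k ≢ punchOut a≢b → f (punchIn a k) ≡ 0ℤ
    other k k≢ = f≡0 _ (punchInᵢ≢i a k)
      (λ eq → k≢ (punchIn-injective a _ _ (trans eq (sym (punchIn-punchOut a≢b)))))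

  ∑-linear : ∀ p (f g : Fin n → ℤ) → (∑ λ i → p * f i + g i) ≡ p * ∑ f + ∑ g
  ∑-linear p f g = trans (∑-+ (λ i → p * f i) g) (cong (_+ ∑ g) (sym (∑-*ˡ p f)))

  opaque

    δ : Fin n → Fin n → ℤ
    δ i j = if does (i ≟ j) then 1ℤ else 0ℤ

    δ-refl : (i : Fin n) → δ i i ≡ 1ℤ
    δ-refl i with i ≟ i
    ... | yes _   = refl
    ... | no i≢i = contradiction refl i≢i

    δ-≢ : {i j : Fin n} → i ≢ j → δ i j ≡ 0ℤ
    δ-≢ {i = i} {j} i≢j with i ≟ j
    ... | yes i≡j = contradiction i≡j i≢j
    ... | no _    = refl

    δ-suc : (i j : Fin n) → δ (suc i) (suc j) ≡ δ i j
    δ-suc i j = refl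

  δ-sym : (i j : Fin n) → δ i j ≡ δ j i
  δ-sym i j with i ≟ j
  ... | yes refl = refl
  ... | no i≢j   = trans (δ-≢ i≢j) (sym (δ-≢ (i≢j ∘ sym)))

  δ-*ˡ : ∀ i (f : Fin n → ℤ) → (∑ λ j → δ i j * f j) ≡ f i
  δ-*ˡ i f = begin
    (∑ λ j → δ i j * f j)   ≡⟨ ∑-single (λ j → δ i j * f j) i (λ j j≢i → cong (_* f j) (δ-≢ (j≢i ∘ sym))) ⟩
    δ i i * f i             ≡⟨ cong (_* f i) (δ-refl i) ⟩
    1ℤ * f i                ≡⟨ *-identityˡ (f i) ⟩
    f i                     ∎

  δ-*ʳ : ∀ i (f : Fin n → ℤ) → (∑ λ j → f j * δ j i) ≡ f i
  δ-*ʳ i f = begin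
    (∑ λ j → f j * δ j i)   ≡⟨ ∑-cong (λ j → trans (cong (f j *_) (δ-sym j i)) (*-comm (f j) (δ i j))) ⟩
    (∑ λ j → δ i j * f j)   ≡⟨ δ-*ˡ i f ⟩
    f i                     ∎

  -- The determinant as an alternating multilinear function of the columns

  Mat : ℕ → Set
  Mat n = Fin n → Fin n → ℤ

  sgn : ℕ → ℤ
  sgn zero    = 1ℤ
  sgn (suc k) = - sgn k

  minor : Mat (suc n) → Fin (suc n) → Mat n
  minor M j i k = M (suc i) (punchIn j k)

  opaque

    det : Mat n → ℤ
    det {zero}  M = 1ℤ
    det {suc n} M = ∑ λ j → sgn (toℕ j) * (M zero j * det (minor M j))

    det-empty : (M : Mat 0) → det M ≡ 1ℤ
    det-empty M = refl

    det-laplace : (M : Mat (suc n)) → det M ≡ (∑ λ j → sgn (toℕ j) * (M zero j * det (minor M j)))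
    det-laplace M = refl

    det-cong : {X Y : Mat n} → (∀ i j → X i j ≡ Y i j) → det X ≡ det Y
    det-cong {zero}  X≡Y = refl
    det-cong {suc n} X≡Y = ∑-cong λ j → cong (sgn (toℕ j) *_)
      (cong₂ _*_ (X≡Y zero j) (det-cong λ i k → X≡Y (suc i) (punchIn j k)))

  punchIn-≢ : ∀ {j c : Fin (suc n)} (j≢c : j ≢ c) {k} → k ≢ punchOut j≢c → punchIn j k ≢ c
  punchIn-≢ {j = j} j≢c k≢ eq =
    k≢ (punchIn-injective j _ _ (trans eq (sym (punchIn-punchOut j≢c))))

  -- Laplace expansion along the first row: deleting column `c` leaves equal minors and the entry
  -- carries the linearity; after deleting another column `j`, column `c` survives in the minor as
  -- `punchOut j≢c` and induction applies.
  det-linear : ∀ c p (X Y Z : Mat n) →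
    (∀ i → X i c ≡ p * Y i c + Z i c) →
    (∀ i k → k ≢ c → X i k ≡ Y i k) → (∀ i k → k ≢ c → X i k ≡ Z i k) →
    det X ≡ p * det Y + det Z
  det-linear {suc n} c p X Y Z col X≡Y X≡Z = begin
    det X                             ≡⟨ det-laplace X ⟩
    ∑ (T X)                           ≡⟨ ∑-cong term ⟩
    (∑ λ j → p * T Y j + T Z j)       ≡⟨ ∑-linear p (T Y) (T Z) ⟩
    p * ∑ (T Y) + ∑ (T Z)             ≡⟨ cong₂ (λ y z → p * y + z) (det-laplace Y) (det-laplace Z) ⟨
    p * det Y + det Z                 ∎
    where
    T : Mat (suc n) → Fin (suc n) → ℤ
    T M j = sgn (toℕ j) * (M zero j * det (minor M j))

    term : ∀ j → T X j ≡ p * T Y j + T Z j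
    term j with j ≟ c
    ... | yes refl = begin
      T X j
        ≡⟨ cong (λ x → sgn (toℕ j) * (x * det (minor X j))) (col zero) ⟩
      sgn (toℕ j) * ((p * Y zero j + Z zero j) * det (minor X j))
        ≡⟨ alg (sgn (toℕ j)) p (Y zero j) (Z zero j) _ ⟩
      p * (sgn (toℕ j) * (Y zero j * det (minor X j))) + sgn (toℕ j) * (Z zero j * det (minor X j))
        ≡⟨ cong₂ (λ y z → p * (sgn (toℕ j) * (Y zero j * y)) + sgn (toℕ j) * (Z zero j * z))
             (det-cong λ i k → X≡Y (suc i) _ (punchInᵢ≢i j k))
             (det-cong λ i k → X≡Z (suc i) _ (punchInᵢ≢i j k)) ⟩
      p * T Y j + T Z j ∎
      where
      alg : ∀ s p y z d → s * ((p * y + z) * d) ≡ p * (s * (y * d)) + s * (z * d)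
      alg = solve-∀
    ... | no j≢c = begin
      T X j
        ≡⟨ cong (λ d → sgn (toℕ j) * (X zero j * d))
             (det-linear (punchOut j≢c) p (minor X j) (minor Y j) (minor Z j)
               (λ i → subst (λ k → X (suc i) k ≡ p * Y (suc i) k + Z (suc i) k)
                        (sym (punchIn-punchOut j≢c)) (col (suc i)))
               (λ i k k≢ → X≡Y (suc i) _ (punchIn-≢ j≢c k≢))
               (λ i k k≢ → X≡Z (suc i) _ (punchIn-≢ j≢c k≢))) ⟩
      sgn (toℕ j) * (X zero j * (p * det (minor Y j) + det (minor Z j)))
        ≡⟨ alg (sgn (toℕ j)) p (X zero j) _ _ ⟩
      p * (sgn (toℕ j) * (X zero j * det (minor Y j))) + sgn (toℕ j) * (X zero j * det (minor Z j))
        ≡⟨ cong₂ (λ y z → p * (sgn (toℕ j) * (y * det (minor Y j))) + sgn (toℕ j) * (z * det (minor Z j)))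
             (X≡Y zero j j≢c) (X≡Z zero j j≢c) ⟩
      p * T Y j + T Z j ∎
      where
      alg : ∀ s p x y z → s * (x * (p * y + z)) ≡ p * (s * (x * y)) + s * (x * z)
      alg = solve-∀

  infix 10 _[_≔_]

  opaque

    _[_≔_] : Mat n → Fin n → (Fin n → ℤ) → Mat n
    (M [ c ≔ v ]) i k = if does (k ≟ c) then v i else M i k

    ≔-at : ∀ (M : Mat n) c v i → (M [ c ≔ v ]) i c ≡ v i
    ≔-at M c v i with c ≟ c
    ... | yes _  = refl
    ... | no c≢c = contradiction refl c≢c

    ≔-off : ∀ (M : Mat n) c v i {k} → k ≢ c → (M [ c ≔ v ]) i k ≡ M i k
    ≔-off M c v i {k} k≢c with k ≟ c
    ... | yes k≡c = contradiction k≡c k≢c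
    ... | no _    = refl

  det-≔-cong : ∀ (M : Mat n) c {v w} → (∀ i → v i ≡ w i) → det (M [ c ≔ v ]) ≡ det (M [ c ≔ w ])
  det-≔-cong {n} M c {v} {w} v≡w = det-cong entry
    where
    entry : ∀ i k → (M [ c ≔ v ]) i k ≡ (M [ c ≔ w ]) i k
    entry i k with k ≟ c
    ... | yes refl = trans (≔-at M c v i) (trans (v≡w i) (sym (≔-at M c w i)))
    ... | no k≢c   = trans (≔-off M c v i k≢c) (sym (≔-off M c w i k≢c))

  det-≔-linear : ∀ (M : Mat n) c p v w →
    det (M [ c ≔ (λ i → p * v i + w i) ]) ≡ p * det (M [ c ≔ v ]) + det (M [ c ≔ w ])
  det-≔-linear {n} M c p v w = det-linear c p _ _ _
    (λ i → trans (≔-at M c vw i) (sym (cong₂ (λ x y → p * x + y) (≔-at M c v i) (≔-at M c w i))))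
    (λ i k k≢c → trans (≔-off M c vw i k≢c) (sym (≔-off M c v i k≢c)))
    (λ i k k≢c → trans (≔-off M c vw i k≢c) (sym (≔-off M c w i k≢c)))
    where
    vw : Fin n → ℤ
    vw i = p * v i + w i

  -- Linearity for zero columns with coefficient -1 gives d = -d + d.
  det-≔-zero : ∀ (M : Mat n) c → det (M [ c ≔ (λ _ → 0ℤ) ]) ≡ 0ℤ
  det-≔-zero M c = begin
    d             ≡⟨ det-≔-linear M c (- 1ℤ) (λ _ → 0ℤ) (λ _ → 0ℤ) ⟩
    - 1ℤ * d + d  ≡⟨ alg d ⟩
    0ℤ            ∎
    where
    d = det (M [ c ≔ (λ _ → 0ℤ) ])
    alg : ∀ d → - 1ℤ * d + d ≡ 0ℤ
    alg = solve-∀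

  det-≔-sum : ∀ (M : Mat n) c (a : Fin m → ℤ) (v : Fin m → Fin n → ℤ) →
    det (M [ c ≔ (λ i → ∑ λ l → a l * v l i) ]) ≡ (∑ λ l → a l * det (M [ c ≔ v l ]))
  det-≔-sum {m = zero}  M c a v = begin
    det (M [ c ≔ (λ i → ∑ λ l → a l * v l i) ]) ≡⟨ det-≔-cong M c (λ i → ∑-empty (λ l → a l * v l i)) ⟩
    det (M [ c ≔ (λ _ → 0ℤ) ])                  ≡⟨ det-≔-zero M c ⟩
    0ℤ                                          ≡⟨ ∑-empty (λ l → a l * det (M [ c ≔ v l ])) ⟨
    (∑ λ l → a l * det (M [ c ≔ v l ]))         ∎
  det-≔-sum {m = suc m} M c a v = begin
    det (M [ c ≔ (λ i → ∑ λ l → a l * v l i) ]) ≡⟨ det-≔-cong M c (λ i → ∑-suc (λ l → a l * v l i)) ⟩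
    det (M [ c ≔ (λ i → a zero * v zero i + (∑ λ l → a (suc l) * v (suc l) i)) ])
      ≡⟨ det-≔-linear M c (a zero) (v zero) (λ i → ∑ λ l → a (suc l) * v (suc l) i) ⟩
    a zero * det (M [ c ≔ v zero ]) + det (M [ c ≔ (λ i → ∑ λ l → a (suc l) * v (suc l) i) ])
      ≡⟨ cong (a zero * det (M [ c ≔ v zero ]) +_) (det-≔-sum M c (a ∘ suc) (v ∘ suc)) ⟩
    a zero * det (M [ c ≔ v zero ]) + (∑ λ l → a (suc l) * det (M [ c ≔ v (suc l) ]))
      ≡⟨ ∑-suc (λ l → a l * det (M [ c ≔ v l ])) ⟨
    (∑ λ l → a l * det (M [ c ≔ v l ]))         ∎

  inject₁≢suc : (a : Fin n) → inject₁ a ≢ suc a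
  inject₁≢suc (suc a) eq = inject₁≢suc a (suc-injective eq)

  punchIn-adjacent : ∀ (a : Fin n) (r : Fin (suc n) → ℤ) → r (inject₁ a) ≡ r (suc a) →
    ∀ k → r (punchIn (inject₁ a) k) ≡ r (punchIn (suc a) k)
  punchIn-adjacent zero    r r≡ zero    = sym r≡
  punchIn-adjacent zero    r r≡ (suc k) = refl
  punchIn-adjacent (suc a) r r≡ zero    = refl
  punchIn-adjacent (suc a) r r≡ (suc k) = punchIn-adjacent a (r ∘ suc) r≡ k

  -- The two terms that delete a column of the equal pair have the same minor, by
  -- `punchIn-adjacent`, and opposite signs. Every other minor still contains an adjacent equal pair
  -- and vanishes by induction.
  det-adjacent : ∀ (a : Fin n) (X : Mat (suc n)) → (∀ i → X i (inject₁ a) ≡ X i (suc a)) → det X ≡ 0ℤ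
  det-adjacent {suc n} a X X≡ = begin
    det X                 ≡⟨ det-laplace X ⟩
    ∑ T                   ≡⟨ ∑-pair T (inject₁ a) (suc a) (inject₁≢suc a) others ⟩
    T (inject₁ a) + T (suc a)
      ≡⟨ cong (_+ T (suc a)) (cong₂ _*_ (cong sgn (toℕ-inject₁ a)) (cong₂ _*_ (X≡ zero) (det-cong λ i → punchIn-adjacent a (X (suc i)) (X≡ (suc i))))) ⟩
    sgn (toℕ a) * (X zero (suc a) * D) + - sgn (toℕ a) * (X zero (suc a) * D)
      ≡⟨ alg (sgn (toℕ a)) (X zero (suc a)) D ⟩
    0ℤ ∎
    where
    T : Fin (suc (suc n)) → ℤ
    T j = sgn (toℕ j) * (X zero j * det (minor X j))
    D = det (minor X (suc a))
    alg : ∀ s x d → s * (x * d) + - s * (x * d) ≡ 0ℤ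
    alg = solve-∀

    -- Deleting a column off an adjacent pair leaves an adjacent pair.
    shift : ∀ {n} (j : Fin (suc (suc n))) (a : Fin (suc n)) → j ≢ inject₁ a → j ≢ suc a →
            ∃[ b ] (punchIn j (inject₁ b) ≡ inject₁ a × punchIn j (suc b) ≡ suc a)
    shift zero    zero    j≢ _  = contradiction refl j≢
    shift zero    (suc a) _  _  = a , refl , refl
    shift (suc zero) zero _  j≢ = contradiction refl j≢
    shift {suc _} (suc (suc j)) zero _ _ = zero , refl , refl
    shift {suc _} (suc j) (suc a) j≢ j≢′ with shift j a (j≢ ∘ cong suc) (j≢′ ∘ cong suc)
    ... | b , p , q = suc b , cong suc p , cong suc q

    others : ∀ j → j ≢ inject₁ a → j ≢ suc a → T j ≡ 0ℤ
    others j j≢ j≢′ with shift j a j≢ j≢′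
    ... | b , p , q = trans (cong (λ d → sgn (toℕ j) * (X zero j * d)) minor≡0)
                        (alg′ (sgn (toℕ j)) (X zero j))
      where
      minor≡0 : det (minor X j) ≡ 0ℤ
      minor≡0 = det-adjacent b (minor X j)
        (λ i → trans (cong (X (suc i)) p) (trans (X≡ (suc i)) (sym (cong (X (suc i)) q))))
      alg′ : ∀ s x → s * (x * 0ℤ) ≡ 0ℤ
      alg′ = solve-∀

  ≔-comm : ∀ (M : Mat n) {p q} v w → p ≢ q → ∀ i k →
    ((M [ q ≔ w ]) [ p ≔ v ]) i k ≡ ((M [ p ≔ v ]) [ q ≔ w ]) i k
  ≔-comm M {p} {q} v w p≢q i k with k ≟ p | k ≟ q
  ... | yes refl | yes refl = contradiction refl p≢q
  ... | yes refl | no k≢q   = trans (≔-at (M [ q ≔ w ]) p v i)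
    (sym (trans (≔-off (M [ p ≔ v ]) q w i k≢q) (≔-at M p v i)))
  ... | no k≢p   | yes refl = trans (≔-off (M [ q ≔ w ]) p v i k≢p)
    (trans (≔-at M q w i) (sym (≔-at (M [ p ≔ v ]) q w i)))
  ... | no k≢p   | no k≢q   = trans (trans (≔-off (M [ q ≔ w ]) p v i k≢p) (≔-off M q w i k≢q))
    (sym (trans (≔-off (M [ p ≔ v ]) q w i k≢q) (≔-off M p v i k≢p)))

  ≔-self : ∀ (M : Mat n) c i k → (M [ c ≔ (λ l → M l c) ]) i k ≡ M i k
  ≔-self M c i k with k ≟ c
  ... | yes refl = ≔-at M c (λ l → M l c) i
  ... | no k≢c   = ≔-off M c (λ l → M l c) i k≢c

  module _ (X : Mat (suc n)) (b : Fin n) where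

    private
      p q : Fin (suc n)
      p = inject₁ b
      q = suc b

      p≢q : p ≢ q
      p≢q = inject₁≢suc b

      x y s : Fin (suc n) → ℤ
      x i = X i p
      y i = X i q
      s i = 1ℤ * x i + y i

      F : (v w : Fin (suc n) → ℤ) → ℤ
      F v w = det ((X [ q ≔ w ]) [ p ≔ v ])

      F-diagonal : ∀ v → F v v ≡ 0ℤ
      F-diagonal v = det-adjacent b _ λ i → begin
        ((X [ q ≔ v ]) [ p ≔ v ]) i p ≡⟨ ≔-at _ p v i ⟩
        v i                           ≡⟨ ≔-at X q v i ⟨
        (X [ q ≔ v ]) i q             ≡⟨ ≔-off _ p v i (p≢q ∘ sym) ⟨
        ((X [ q ≔ v ]) [ p ≔ v ]) i q ∎

      F-comm : ∀ v w → F v w ≡ det ((X [ p ≔ v ]) [ q ≔ w ])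
      F-comm v w = det-cong (≔-comm X v w p≢q)

      F-linearʳ : ∀ v → F v s ≡ 1ℤ * F v x + F v y
      F-linearʳ v = begin
        F v s                                        ≡⟨ F-comm v s ⟩
        det ((X [ p ≔ v ]) [ q ≔ s ])                ≡⟨ det-≔-linear (X [ p ≔ v ]) q 1ℤ x y ⟩
        1ℤ * det ((X [ p ≔ v ]) [ q ≔ x ]) + det ((X [ p ≔ v ]) [ q ≔ y ])
          ≡⟨ cong₂ (λ f g → 1ℤ * f + g) (F-comm v x) (F-comm v y) ⟨
        1ℤ * F v x + F v y                           ∎

    swapped : Mat (suc n)
    swapped = (X [ q ≔ x ]) [ p ≔ y ]

    -- Polarisation: as a function `F` of the columns `p` and `q` the determinant is bilinear and
    -- vanishes on the diagonal, so expanding it at the sum `s` in both places leaves F x y + F y x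
    -- = 0.
    det-swapped : det swapped ≡ - det X
    det-swapped = begin
      F y x             ≡⟨ alg (F y x) (F x y) ⟩
      (1ℤ * (1ℤ * 0ℤ + F x y) + (1ℤ * F y x + 0ℤ)) - F x y
        ≡⟨ cong₂ (λ f g → (1ℤ * (1ℤ * f + F x y) + (1ℤ * F y x + g)) - F x y) (F-diagonal x) (F-diagonal y) ⟨
      (1ℤ * (1ℤ * F x x + F x y) + (1ℤ * F y x + F y y)) - F x y
        ≡⟨ cong₂ (λ f g → 1ℤ * f + g - F x y) (F-linearʳ x) (F-linearʳ y) ⟨
      (1ℤ * F x s + F y s) - F x y
        ≡⟨ cong (_- F x y) (det-≔-linear (X [ q ≔ s ]) p 1ℤ x y) ⟨
      F s s - F x y     ≡⟨ cong (_- F x y) (F-diagonal s) ⟩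
      0ℤ - F x y        ≡⟨ alg′ (F x y) ⟩
      - F x y           ≡⟨ cong -_ (trans (F-comm x y) (det-cong λ i k →
                             trans (cong-≔ i k) (≔-self X q i k))) ⟩
      - det X           ∎
      where
      alg : ∀ f g → f ≡ (1ℤ * (1ℤ * 0ℤ + g) + (1ℤ * f + 0ℤ)) - g
      alg = solve-∀
      alg′ : ∀ f → 0ℤ - f ≡ - f
      alg′ = solve-∀
      cong-≔ : ∀ i k → ((X [ p ≔ x ]) [ q ≔ y ]) i k ≡ (X [ q ≔ y ]) i k
      cong-≔ i k with k ≟ q
      ... | yes refl = trans (≔-at (X [ p ≔ x ]) q y i) (sym (≔-at X q y i))
      ... | no k≢q   = trans (≔-off (X [ p ≔ x ]) q y i k≢q)
        (trans (≔-self X p i k) (sym (≔-off X q y i k≢q)))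

  -- Swapping the later column with its left neighbour only changes the sign and brings it closer to
  -- `a`, until the pair is adjacent. The recursion runs on `d` because `inject₁ b` is not
  -- structurally smaller than `suc b`.
  det-equal-columns-< : ∀ d (X : Mat n) (a b : Fin n) → toℕ b ≡ d → a Fin.< b →
    (∀ i → X i a ≡ X i b) → det X ≡ 0ℤ
  det-equal-columns-< (suc d) X a (suc b) b≡d a<b X≡ with a ≟ inject₁ b
  ... | yes refl = det-adjacent b X X≡
  ... | no a≢b = begin
    det X                   ≡⟨ alg (det X) ⟩
    - (- det X)             ≡⟨ cong -_ (det-swapped X b) ⟨
    - det (swapped X b)     ≡⟨ cong -_ (det-equal-columns-< d (swapped X b) a (inject₁ b)
                                 (trans (toℕ-inject₁ b) (ℕ.suc-injective b≡d))
                                 (ℕ.≤∧≢⇒< (subst (toℕ a ℕ.≤_) (sym (toℕ-inject₁ b)) (ℕ.s≤s⁻¹ a<b)) (a≢b ∘ toℕ-injective))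
                                 columns) ⟩
    0ℤ                      ∎
    where
    alg : ∀ x → x ≡ - (- x)
    alg = solve-∀
    columns : ∀ i → swapped X b i a ≡ swapped X b i (inject₁ b)
    columns i = begin
      swapped X b i a                                ≡⟨ ≔-off _ (inject₁ b) (λ i → X i (suc b)) i a≢b ⟩
      (X [ suc b ≔ (λ i → X i (inject₁ b)) ]) i a    ≡⟨ ≔-off X (suc b) (λ i → X i (inject₁ b)) i (λ { refl → ℕ.<-irrefl refl a<b }) ⟩
      X i a                                          ≡⟨ X≡ i ⟩
      X i (suc b)                                    ≡⟨ ≔-at (X [ suc b ≔ (λ i → X i (inject₁ b)) ]) (inject₁ b) (λ i → X i (suc b)) i ⟨
      swapped X b i (inject₁ b)                      ∎

  det-equal-columns : ∀ (X : Mat n) a b → a ≢ b → (∀ i → X i a ≡ X i b) → det X ≡ 0ℤ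
  det-equal-columns X a b a≢b X≡ with <-cmp a b
  ... | tri< a<b _ _ = det-equal-columns-< _ X a b refl a<b X≡
  ... | tri≈ _ a≡b _ = contradiction a≡b a≢b
  ... | tri> _ _ b<a = det-equal-columns-< _ X b a refl b<a (sym ∘ X≡)

  -- Adjugate and Cramer's rule

  adj : Mat n → Mat n
  adj M i j = det (M [ i ≔ (λ l → δ l j) ])

  -- The reason for defining the adjugate by replaced columns instead of signed minors: `v` is a
  -- combination of unit vectors, and linearity in column `i` is all that is used.
  adj-* : ∀ (M : Mat n) i (v : Fin n → ℤ) → (∑ λ j → (adj M i j * v j)) ≡ det (M [ i ≔ v ])
  adj-* {n} M i v = begin
    ∑ (λ j → adj M i j * v j) ≡⟨ ∑-cong (λ j → *-comm (adj M i j) (v j)) ⟩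
    ∑ (λ j → v j * adj M i j) ≡⟨ det-≔-sum M i v (λ j l → δ l j) ⟨
    det (M [ i ≔ (λ l → ∑ λ j → (v j * δ l j)) ])
      ≡⟨ det-≔-cong M i (λ l → trans (∑-cong λ j → *-comm (v j) (δ l j)) (δ-*ˡ l v)) ⟩
    det (M [ i ≔ v ])           ∎

  -- By `adj-*` the sum is the determinant of `M` with column `i` overwritten by column `k`. This is
  -- `M` itself when the two agree, and has a repeated column otherwise.
  cramer : ∀ (M : Mat n) i k → (∑ λ j → adj M i j * M j k) ≡ det M * δ i k
  cramer M i k with i ≟ k
  ... | yes refl = begin
    ∑ (λ j → adj M i j * M j i)   ≡⟨ adj-* M i (λ j → M j i) ⟩
    det (M [ i ≔ (λ j → M j i) ]) ≡⟨ det-cong (≔-self M i) ⟩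
    det M                         ≡⟨ *-identityʳ (det M) ⟨
    det M * 1ℤ                    ≡⟨ cong (det M *_) (δ-refl i) ⟨
    det M * δ i i                 ∎
  ... | no i≢k = begin
    ∑ (λ j → adj M i j * M j k)   ≡⟨ adj-* M i (λ j → M j k) ⟩
    det (M [ i ≔ (λ j → M j k) ]) ≡⟨ det-equal-columns _ i k i≢k (λ l →
                                       trans (≔-at M i (λ j → M j k) l) (sym (≔-off M i (λ j → M j k) l (i≢k ∘ sym)))) ⟩
    0ℤ                            ≡⟨ *-zeroʳ (det M) ⟨
    det M * 0ℤ                    ≡⟨ cong (det M *_) (δ-≢ i≢k) ⟨
    det M * δ i k                 ∎

  -- Jacobi's formula with an explicit remainder

  det-derivative : Mat n → Mat n → ℤ
  det-derivative {n} M X = ∑ λ c → det (M [ c ≔ (λ i → X i c) ])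

  -- Product rule under the Laplace expansion: for fixed `j` the replaced column is either `j`
  -- itself, which changes the entry, or some `punchIn j c`, which changes the minor.
  det-derivative-laplace : ∀ (M X : Mat (suc n)) → det-derivative M X ≡
    ∑ λ j → (sgn (toℕ j) * (X zero j * det (minor M j) + M zero j * det-derivative (minor M j) (minor X j)))
  det-derivative-laplace {n} M X = begin
    det-derivative M X
      ≡⟨ ∑-cong (λ c → det-laplace (R c)) ⟩
    (∑ λ c → ∑ λ j → sgn (toℕ j) * (R c zero j * det (minor (R c) j)))
      ≡⟨ ∑-swap (λ c j → sgn (toℕ j) * (R c zero j * det (minor (R c) j))) ⟩
    (∑ λ j → ∑ λ c → (sgn (toℕ j) * (R c zero j * det (minor (R c) j))))
      ≡⟨ ∑-cong column ⟩
    (∑ λ j → (sgn (toℕ j) * (X zero j * det (minor M j) + M zero j * det-derivative (minor M j) (minor X j)))) ∎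
    where
    R : Fin (suc n) → Mat (suc n)
    R c = M [ c ≔ (λ i → X i c) ]

    minor-R : ∀ j c i k → minor (R (punchIn j c)) j i k ≡ (minor M j [ c ≔ (λ i → minor X j i c) ]) i k
    minor-R j c i k with k ≟ c
    ... | yes refl = trans (≔-at M (punchIn j c) (λ i → X i (punchIn j c)) (suc i))
      (sym (≔-at (minor M j) c (λ i → minor X j i c) i))
    ... | no k≢c   = trans (≔-off M (punchIn j c) (λ i → X i (punchIn j c)) (suc i) (k≢c ∘ punchIn-injective j k c))
      (sym (≔-off (minor M j) c (λ i → minor X j i c) i k≢c))

    column : ∀ j → (∑ λ c → (sgn (toℕ j) * (R c zero j * det (minor (R c) j)))) ≡
      sgn (toℕ j) * (X zero j * det (minor M j) + M zero j * det-derivative (minor M j) (minor X j))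
    column j = begin
      ∑ (λ c → sgn (toℕ j) * T c)
        ≡⟨ ∑-*ˡ (sgn (toℕ j)) T ⟨
      sgn (toℕ j) * ∑ T
        ≡⟨ cong (sgn (toℕ j) *_) (∑-remove j T) ⟩
      sgn (toℕ j) * (T j + ∑ (λ c → T (punchIn j c)))
        ≡⟨ cong (sgn (toℕ j) *_) (cong₂ _+_ own others) ⟩
      sgn (toℕ j) * (X zero j * det (minor M j) + M zero j * det-derivative (minor M j) (minor X j)) ∎
      where
      T : Fin (suc n) → ℤ
      T c = R c zero j * det (minor (R c) j)
      own : T j ≡ X zero j * det (minor M j)
      own = cong₂ _*_ (≔-at M j (λ i → X i j) zero)
        (det-cong λ i k → ≔-off M j (λ i → X i j) (suc i) (punchInᵢ≢i j k))
      D : Fin n → ℤ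
      D c = det (minor M j [ c ≔ (λ i → minor X j i c) ])
      others : ∑ (λ c → T (punchIn j c)) ≡ M zero j * det-derivative (minor M j) (minor X j)
      others = trans
        (∑-cong λ c → cong₂ _*_ (≔-off M (punchIn j c) (λ i → X i (punchIn j c)) zero (punchInᵢ≢i j c ∘ sym)) (det-cong (minor-R j c)))
        (sym (∑-*ˡ (M zero j) D))

  -- The remainder is an integer multiple of h², so that linear terms can be compared modulo h
  -- without limits.
  jacobi : ∀ (M X : Mat n) h →
    ∃[ e ] det (λ i k → M i k + h * X i k) ≡ det M + h * det-derivative M X + h * h * e
  jacobi {zero}  M X h = 0ℤ , (begin
    det (λ i k → M i k + h * X i k) ≡⟨ det-empty _ ⟩
    1ℤ                              ≡⟨ alg h ⟩
    1ℤ + h * 0ℤ + h * h * 0ℤ        ≡⟨ cong₂ (λ d d′ → d + h * d′ + h * h * 0ℤ) (det-empty M) (∑-empty _) ⟨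
    det M + h * det-derivative M X + h * h * 0ℤ ∎)
    where
    alg : ∀ h → 1ℤ ≡ 1ℤ + h * 0ℤ + h * h * 0ℤ
    alg = solve-∀
  jacobi {suc n} M X h = ∑ E , (begin
    det (λ i k → M i k + h * X i k)
      ≡⟨ det-laplace _ ⟩
    ∑ (λ j → s j * ((M zero j + h * X zero j) * det (λ i k → minor M j i k + h * minor X j i k)))
      ≡⟨ ∑-cong (λ j → trans
           (cong (λ d → s j * ((M zero j + h * X zero j) * d)) (proj₂ (IH j)))
           (alg (s j) (M zero j) h (X zero j) (d j) (D j) (e j))) ⟩
    ∑ (λ j → h * h * E j + (h * F j + T j))
      ≡⟨ ∑-linear (h * h) E (λ j → h * F j + T j) ⟩
    h * h * ∑ E + ∑ (λ j → h * F j + T j)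
      ≡⟨ cong (h * h * ∑ E +_) (∑-linear h F T) ⟩
    h * h * ∑ E + (h * ∑ F + ∑ T)
      ≡⟨ cong₂ (λ x y → h * h * ∑ E + (h * x + y)) (det-derivative-laplace M X) (det-laplace M) ⟨
    h * h * ∑ E + (h * det-derivative M X + det M)
      ≡⟨ comm (h * h * ∑ E) (h * det-derivative M X) (det M) ⟩
    det M + h * det-derivative M X + h * h * ∑ E ∎)
    where
    s d D e T F E : Fin (suc n) → ℤ
    IH : ∀ j → ∃[ e ] det (λ i k → minor M j i k + h * minor X j i k) ≡ d j + h * D j + h * h * e
    s j = sgn (toℕ j)
    d j = det (minor M j)
    D j = det-derivative (minor M j) (minor X j)
    IH j = jacobi (minor M j) (minor X j) h
    e j = proj₁ (IH j)
    T j = s j * (M zero j * d j)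
    F j = s j * (X zero j * d j + M zero j * D j)
    -- Everything beyond the linear term in (m + h x)(d + h D + h² e), divided by h²; the cubic part
    -- keeps a factor h.
    E j = s j * (M zero j * e j + X zero j * D j + h * X zero j * e j)
    alg : ∀ s m h x d D e → s * ((m + h * x) * (d + h * D + h * h * e)) ≡
      h * h * (s * (m * e + x * D + h * x * e)) + (h * (s * (x * d + m * D)) + s * (m * d))
    alg = solve-∀
    comm : ∀ a b c → a + (b + c) ≡ c + b + a
    comm = solve-∀

  det-identity : det {n} δ ≡ 1ℤ
  det-identity {zero}  = det-empty δ
  det-identity {suc n} = begin
    det {suc n} δ                ≡⟨ det-laplace δ ⟩
    ∑ T                          ≡⟨ ∑-single T zero (λ j j≢0 → trans
                                      (cong (λ x → sgn (toℕ j) * (x * det (minor δ j))) (δ-≢ (j≢0 ∘ sym)))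
                                      (*-zeroʳ (sgn (toℕ j)))) ⟩
    1ℤ * (δ {suc n} zero zero * det (minor δ zero))
      ≡⟨ cong₂ (λ x y → 1ℤ * (x * y)) (δ-refl {suc n} zero) (det-cong δ-suc) ⟩
    1ℤ * (1ℤ * det {n} δ)        ≡⟨ cong (λ x → 1ℤ * (1ℤ * x)) (det-identity {n}) ⟩
    1ℤ                           ∎
    where
    T : Fin (suc n) → ℤ
    T j = sgn (toℕ j) * (δ zero j * det (minor δ j))

  *-cancel : ∀ h {a b : ℤ} → h ≢ 0ℤ → h * a ≡ h * b → a ≡ b
  *-cancel h {a} {b} h≢0 eq with i*j≡0⇒i≡0∨j≡0 h {a - b} (trans (alg h a b) (i≡j⇒i-j≡0 eq))
    where
    alg : ∀ h a b → h * (a - b) ≡ h * a - h * b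
    alg = solve-∀
  ... | inj₁ h≡0   = contradiction h≡0 h≢0
  ... | inj₂ a-b≡0 = i-j≡0⇒i≡j a b a-b≡0

  -- Take h = |d| + 1: a nonzero multiple of it exceeds d in absolute value, so the quotient is 0.
  divisible-by-all⇒≡0 : ∀ d → (∀ h → h ≢ 0ℤ → ∃[ e ] d ≡ h * e) → d ≡ 0ℤ
  divisible-by-all⇒≡0 d div = go ∣ e ∣ refl
    where
    h = pos (suc ∣ d ∣)
    e = proj₁ (div h λ ())
    d≡h*e = proj₂ (div h λ ())

    go : ∀ k → ∣ e ∣ ≡ k → d ≡ 0ℤ
    go zero    ∣e∣≡ = trans d≡h*e (trans (cong (h *_) (∣i∣≡0⇒i≡0 ∣e∣≡)) (*-zeroʳ h))
    go (suc k) ∣e∣≡ = contradiction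
      (trans (cong ∣_∣ d≡h*e) (trans (abs-* h e) (cong (suc ∣ d ∣ ℕ.*_) ∣e∣≡)))
      (ℕ.<⇒≢ (ℕ.≤-trans (ℕ.n<1+n ∣ d ∣) (ℕ.m≤m*n (suc ∣ d ∣) (suc k))))

  ∑-*ʳ : ∀ (f : Fin n → ℤ) p → ∑ f * p ≡ (∑ λ i → f i * p)
  ∑-*ʳ f p = begin
    ∑ f * p             ≡⟨ *-comm (∑ f) p ⟩
    p * ∑ f             ≡⟨ ∑-*ˡ p f ⟩
    (∑ λ i → p * f i)   ≡⟨ ∑-cong (λ i → *-comm p (f i)) ⟩
    (∑ λ i → f i * p)   ∎

  infixl 7 _⊗_

  _⊗_ : Mat n → Mat n → Mat n
  (X ⊗ Y) i j = ∑ λ k → X i k * Y k j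

  ∑-assoc : ∀ (u : Fin n → ℤ) (Y : Fin n → Fin m → ℤ) (v : Fin m → ℤ) →
    (∑ λ k → (∑ λ l → u l * Y l k) * v k) ≡ (∑ λ l → u l * (∑ λ k → Y l k * v k))
  ∑-assoc u Y v = begin
    (∑ λ k → (∑ λ l → u l * Y l k) * v k)   ≡⟨ ∑-cong (λ k → ∑-*ʳ (λ l → u l * Y l k) (v k)) ⟩
    (∑ λ k → ∑ λ l → u l * Y l k * v k)     ≡⟨ ∑-swap (λ k l → u l * Y l k * v k) ⟩
    (∑ λ l → ∑ λ k → u l * Y l k * v k)     ≡⟨ ∑-cong (λ l → ∑-cong λ k → *-assoc (u l) (Y l k) (v k)) ⟩
    (∑ λ l → ∑ λ k → u l * (Y l k * v k))   ≡⟨ ∑-cong (λ l → ∑-*ˡ (u l) (λ k → Y l k * v k)) ⟨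
    (∑ λ l → u l * (∑ λ k → Y l k * v k))   ∎

  ⊗-assoc : ∀ (X Y Z : Mat n) i j → (X ⊗ Y ⊗ Z) i j ≡ (X ⊗ (Y ⊗ Z)) i j
  ⊗-assoc X Y Z i j = ∑-assoc (X i) Y (λ k → Z k j)

  ⊗-congˡ : ∀ {X X′ : Mat n} (Y : Mat n) → (∀ i j → X i j ≡ X′ i j) → ∀ i j → (X ⊗ Y) i j ≡ (X′ ⊗ Y) i j
  ⊗-congˡ Y X≡ i j = ∑-cong λ k → cong (_* Y k j) (X≡ i k)

  ⊗-congʳ : ∀ (X : Mat n) {Y Y′ : Mat n} → (∀ i j → Y i j ≡ Y′ i j) → ∀ i j → (X ⊗ Y) i j ≡ (X ⊗ Y′) i j
  ⊗-congʳ X Y≡ i j = ∑-cong λ k → cong (X i k *_) (Y≡ k j)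

  ⊗-δ : ∀ (X : Mat n) i j → (X ⊗ δ) i j ≡ X i j
  ⊗-δ X i j = δ-*ʳ j (X i)

  -- Traces of powers from determinants

  tr : Mat n → ℤ
  tr X = ∑ λ i → X i i

  tr-cong : {X Y : Mat n} → (∀ i j → X i j ≡ Y i j) → tr X ≡ tr Y
  tr-cong X≡Y = ∑-cong λ i → X≡Y i i

  infixr 8 _^^_

  _^^_ : Mat n → ℕ → Mat n
  X ^^ zero  = δ
  X ^^ suc k = X ⊗ X ^^ k

  1+_·_ : ℤ → Mat n → Mat n
  (1+ t · X) i j = δ i j + t * X i j

  det-derivative≡tr-adj : ∀ (M X : Mat n) → det-derivative M X ≡ tr (adj M ⊗ X)
  det-derivative≡tr-adj M X = ∑-cong λ c → sym (adj-* M c (λ j → X j c))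

  -- With M = 1 + t X the left side is the trace of adj M · (Y + t X Y) = adj M · M · Y, and
  -- Cramer's rule applies. For `Y` a power of `X` it links two consecutive values of `x` below.
  adj-⊗ : ∀ (X Y : Mat n) t → tr (adj (1+ t · X) ⊗ Y) + t * tr (adj (1+ t · X) ⊗ (X ⊗ Y)) ≡ det (1+ t · X) * tr Y
  adj-⊗ X Y t = begin
    tr (B ⊗ Y) + t * tr (B ⊗ (X ⊗ Y))                 ≡⟨ swap (tr (B ⊗ Y)) (t * tr (B ⊗ (X ⊗ Y))) ⟩
    t * tr (B ⊗ (X ⊗ Y)) + tr (B ⊗ Y)                 ≡⟨ ∑-linear t (λ i → (B ⊗ (X ⊗ Y)) i i) (λ i → (B ⊗ Y) i i) ⟨
    (∑ λ i → t * (B ⊗ (X ⊗ Y)) i i + (B ⊗ Y) i i)     ≡⟨ ∑-cong entry ⟩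
    (∑ λ i → det M * Y i i)                           ≡⟨ ∑-*ˡ (det M) (λ i → Y i i) ⟨
    det M * tr Y                                      ∎
    where
    M = 1+ t · X
    B = adj M

    swap : ∀ a b → a + b ≡ b + a
    swap = solve-∀

    distrib : ∀ b t x y → t * (b * x) + b * y ≡ b * (t * x + y)
    distrib = solve-∀

    expand : ∀ d t x y → d * y + t * x * y ≡ t * (x * y) + d * y
    expand = solve-∀

    M⊗Y : ∀ j i → t * (X ⊗ Y) j i + Y j i ≡ (M ⊗ Y) j i
    M⊗Y j i = begin
      t * (X ⊗ Y) j i + Y j i
        ≡⟨ cong (t * (X ⊗ Y) j i +_) (δ-*ˡ j (λ k → Y k i)) ⟨
      t * (X ⊗ Y) j i + (∑ λ k → δ j k * Y k i)
        ≡⟨ ∑-linear t (λ k → X j k * Y k i) (λ k → δ j k * Y k i) ⟨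
      (∑ λ k → t * (X j k * Y k i) + δ j k * Y k i)
        ≡⟨ ∑-cong (λ k → sym (alg (δ j k) t (X j k) (Y k i))) ⟩
      (M ⊗ Y) j i ∎
      where
      alg : ∀ d t x y → (d + t * x) * y ≡ t * (x * y) + d * y
      alg = solve-∀

    entry : ∀ i → t * (B ⊗ (X ⊗ Y)) i i + (B ⊗ Y) i i ≡ det M * Y i i
    entry i = begin
      t * (B ⊗ (X ⊗ Y)) i i + (B ⊗ Y) i i
        ≡⟨ ∑-linear t (λ j → B i j * (X ⊗ Y) j i) (λ j → B i j * Y j i) ⟨
      (∑ λ j → t * (B i j * (X ⊗ Y) j i) + B i j * Y j i)
        ≡⟨ ∑-cong (λ j → trans (distrib (B i j) t ((X ⊗ Y) j i) (Y j i)) (cong (B i j *_) (M⊗Y j i))) ⟩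
      (B ⊗ (M ⊗ Y)) i i
        ≡⟨ ⊗-assoc B M Y i i ⟨
      (B ⊗ M ⊗ Y) i i
        ≡⟨ ∑-cong (λ k → trans (cong (_* Y k i) (cramer M i k)) (*-assoc (det M) (δ i k) (Y k i))) ⟩
      (∑ λ k → det M * (δ i k * Y k i))
        ≡⟨ ∑-*ˡ (det M) (λ k → δ i k * Y k i) ⟨
      det M * (∑ λ k → δ i k * Y k i)
        ≡⟨ cong (det M *_) (δ-*ˡ i (λ k → Y k i)) ⟩
      det M * Y i i ∎

  module Traces {X Y : Mat n} (det≡ : ∀ t → det (1+ t · X) ≡ det (1+ t · Y)) where

    -- Both Jacobi expansions around t hold for every step h, so comparing them modulo h² for all h
    -- identifies the linear terms.
    det-derivative≡ : ∀ t → det-derivative (1+ t · X) X ≡ det-derivative (1+ t · Y) Y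
    det-derivative≡ t = i-j≡0⇒i≡j _ _ (divisible-by-all⇒≡0 _ λ h h≢0 → divides h h≢0)
      where
      shift : ∀ (Z : Mat n) h → det (λ i k → (1+ t · Z) i k + h * Z i k) ≡ det (1+ (t + h) · Z)
      shift Z h = det-cong λ i k → alg (δ i k) t h (Z i k)
        where
        alg : ∀ d t h z → d + t * z + h * z ≡ d + (t + h) * z
        alg = solve-∀

      divides : ∀ h → h ≢ 0ℤ → ∃[ e ] det-derivative (1+ t · X) X - det-derivative (1+ t · Y) Y ≡ h * e
      divides h h≢0 = e′ - e , *-cancel h h≢0 (begin
        h * (r - r′)                                   ≡⟨ alg P h r r′ e ⟩
        (P + h * r + h * h * e) - (P + h * r′ + h * h * e)
          ≡⟨ cong (_- (P + h * r′ + h * h * e)) (trans (sym p) (trans (shift X h) (trans (det≡ (t + h)) (trans (sym (shift Y h)) q)))) ⟩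
        (det (1+ t · Y) + h * r′ + h * h * e′) - (P + h * r′ + h * h * e)
          ≡⟨ cong (λ x → (x + h * r′ + h * h * e′) - (P + h * r′ + h * h * e)) (det≡ t) ⟨
        (P + h * r′ + h * h * e′) - (P + h * r′ + h * h * e)
          ≡⟨ alg′ P h r′ e e′ ⟩
        h * (h * (e′ - e))                             ∎)
        where
        P = det (1+ t · X)
        r = det-derivative (1+ t · X) X
        r′ = det-derivative (1+ t · Y) Y
        e = proj₁ (jacobi (1+ t · X) X h)
        p = proj₂ (jacobi (1+ t · X) X h)
        e′ = proj₁ (jacobi (1+ t · Y) Y h)
        q = proj₂ (jacobi (1+ t · Y) Y h)
        alg : ∀ P h r r′ e → h * (r - r′) ≡ (P + h * r + h * h * e) - (P + h * r′ + h * h * e)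
        alg = solve-∀
        alg′ : ∀ P h r′ e e′ → (P + h * r′ + h * h * e′) - (P + h * r′ + h * h * e) ≡ h * (h * (e′ - e))
        alg′ = solve-∀

    -- Up to the factor det (1 + t Z) this is the trace of (1 + t Z)⁻¹ Zᵏ, formally the trace of Zᵏ
    -- - t Zᵏ⁺¹ + ...; the adjugate keeps it integral.
    x : Mat n → ℤ → ℕ → ℤ
    x Z t k = tr (adj (1+ t · Z) ⊗ Z ^^ k)

    x-one : ∀ t → x X t 1 ≡ x Y t 1
    x-one t = begin
      x X t 1                   ≡⟨ tr-cong (⊗-congʳ (adj (1+ t · X)) (⊗-δ X)) ⟩
      tr (adj (1+ t · X) ⊗ X)   ≡⟨ det-derivative≡tr-adj (1+ t · X) X ⟨
      det-derivative (1+ t · X) X         ≡⟨ det-derivative≡ t ⟩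
      det-derivative (1+ t · Y) Y         ≡⟨ det-derivative≡tr-adj (1+ t · Y) Y ⟩
      tr (adj (1+ t · Y) ⊗ Y)   ≡⟨ tr-cong (⊗-congʳ (adj (1+ t · Y)) (⊗-δ Y)) ⟨
      x Y t 1                   ∎

    -- Jacobi's expansion around the identity. It allows the determinant to be cancelled modulo t.
    P≡1+ : ∀ t → ∃[ c ] det (1+ t · X) ≡ 1ℤ + t * c
    P≡1+ t with jacobi δ X t
    ... | e , eq = det-derivative δ X + t * e , trans eq (trans (cong (λ d → d + t * det-derivative δ X + t * t * e) det-identity)
                                       (alg t (det-derivative δ X) e))
      where
      alg : ∀ t c e → 1ℤ + t * c + t * t * e ≡ 1ℤ + t * (c + t * e)
      alg = solve-∀

    module _ (k : ℕ) (xₖ≡ : ∀ t → t ≢ 0ℤ → x X t k ≡ x Y t k) where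

      private
        difference : ∀ t → t ≢ 0ℤ →
          det (1+ t · X) * (tr (X ^^ k) - tr (Y ^^ k)) ≡ t * (x X t (suc k) - x Y t (suc k))
        difference t t≢0 = begin
          P * (tr (X ^^ k) - tr (Y ^^ k))
            ≡⟨ distrib P (tr (X ^^ k)) (tr (Y ^^ k)) ⟩
          P * tr (X ^^ k) - P * tr (Y ^^ k)
            ≡⟨ cong (λ p → P * tr (X ^^ k) - p * tr (Y ^^ k)) (det≡ t) ⟩
          P * tr (X ^^ k) - det (1+ t · Y) * tr (Y ^^ k)
            ≡⟨ cong₂ _-_ (adj-⊗ X (X ^^ k) t) (adj-⊗ Y (Y ^^ k) t) ⟨
          (x X t k + t * x X t (suc k)) - (x Y t k + t * x Y t (suc k))
            ≡⟨ cong (λ z → (z + t * x X t (suc k)) - (x Y t k + t * x Y t (suc k))) (xₖ≡ t t≢0) ⟩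
          (x Y t k + t * x X t (suc k)) - (x Y t k + t * x Y t (suc k))
            ≡⟨ alg (x Y t k) t (x X t (suc k)) (x Y t (suc k)) ⟩
          t * (x X t (suc k) - x Y t (suc k)) ∎
          where
          P = det (1+ t · X)
          distrib : ∀ p a b → p * (a - b) ≡ p * a - p * b
          distrib = solve-∀
          alg : ∀ z t a b → (z + t * a) - (z + t * b) ≡ t * (a - b)
          alg = solve-∀

      -- By `difference` the product of det (1 + t X) with the difference of the traces is divisible
      -- by t; by `P≡1+` so is the difference itself, for every nonzero t.
      tr-^^≡ : tr (X ^^ k) ≡ tr (Y ^^ k)
      tr-^^≡ = i-j≡0⇒i≡j _ _ (divisible-by-all⇒≡0 D λ t t≢0 →
        y t - proj₁ (P≡1+ t) * D , (begin
        D                                    ≡⟨ alg D t (proj₁ (P≡1+ t)) ⟩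
        (1ℤ + t * proj₁ (P≡1+ t)) * D - t * (proj₁ (P≡1+ t) * D)
          ≡⟨ cong (λ p → p * D - t * (proj₁ (P≡1+ t) * D)) (proj₂ (P≡1+ t)) ⟨
        det (1+ t · X) * D - t * (proj₁ (P≡1+ t) * D)
          ≡⟨ cong (_- t * (proj₁ (P≡1+ t) * D)) (difference t t≢0) ⟩
        t * y t - t * (proj₁ (P≡1+ t) * D)   ≡⟨ alg′ t (y t) (proj₁ (P≡1+ t) * D) ⟩
        t * (y t - proj₁ (P≡1+ t) * D)       ∎))
        where
        D = tr (X ^^ k) - tr (Y ^^ k)
        y : ℤ → ℤ
        y t = x X t (suc k) - x Y t (suc k)
        alg : ∀ d t c → d ≡ (1ℤ + t * c) * d - t * (c * d)
        alg = solve-∀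
        alg′ : ∀ t a b → t * a - t * b ≡ t * (a - b)
        alg′ = solve-∀

      -- Once the traces agree, the left side of `difference` vanishes and t cancels on the right;
      -- this is where t ≠ 0 enters.
      x-step : ∀ t → t ≢ 0ℤ → x X t (suc k) ≡ x Y t (suc k)
      x-step t t≢0 = i-j≡0⇒i≡j _ _ (*-cancel t t≢0 (begin
        t * (x X t (suc k) - x Y t (suc k))             ≡⟨ difference t t≢0 ⟨
        det (1+ t · X) * (tr (X ^^ k) - tr (Y ^^ k))    ≡⟨ cong (det (1+ t · X) *_) (i≡j⇒i-j≡0 tr-^^≡) ⟩
        det (1+ t · X) * 0ℤ                             ≡⟨ *-zeroʳ (det (1+ t · X)) ⟩
        0ℤ                                              ≡⟨ *-zeroʳ t ⟨
        t * 0ℤ                                          ∎))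

    x-suc : ∀ k t → t ≢ 0ℤ → x X t (suc k) ≡ x Y t (suc k)
    -- The recursion starts at exponent 1, where Jacobi's formula identifies both sides as
    -- derivatives of equal determinants.
    x-suc zero    t _   = x-one t
    x-suc (suc k) t t≢0 = x-step (suc k) (x-suc k) t t≢0

    power-traces : ∀ k → tr (X ^^ k) ≡ tr (Y ^^ k)
    power-traces zero    = refl
    power-traces (suc k) = tr-^^≡ (suc k) (x-suc k)

  -- Traces of polynomial expressions in a matrix

  infixl 6 _⊕_
  infixl 7 _⊛_
  infixr 8 _⊙_

  -- Expressions with products kept in order and unsimplified, so that evaluation unfolds to exactly
  -- the matrix products whose traces occur below.
  data Poly : Set where
    𝟙 𝕩     : Poly
    _⊙_     : ℤ → Poly → Poly
    _⊕_ _⊛_ : Poly → Poly → Poly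

  ⟦_⟧ : Poly → Mat n → Mat n
  ⟦ 𝟙 ⟧     X = δ
  ⟦ 𝕩 ⟧     X = X
  ⟦ c ⊙ p ⟧ X = λ i j → c * ⟦ p ⟧ X i j
  ⟦ p ⊕ q ⟧ X = λ i j → ⟦ p ⟧ X i j + ⟦ q ⟧ X i j
  ⟦ p ⊛ q ⟧ X = ⟦ p ⟧ X ⊗ ⟦ q ⟧ X

  module _ {X Y : Mat n} (power-traces : ∀ k → tr (X ^^ k) ≡ tr (Y ^^ k)) where

    -- Equality of the traces is not inductive in the polynomial, equality of all moments is.
    private
      Moments : Mat n → Mat n → Set
      Moments W Z = ∀ k → tr (W ⊗ X ^^ k) ≡ tr (Z ⊗ Y ^^ k)

      -- `p` is appended to arbitrary left factors, so a product is two appends in succession, and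
      -- appending the variable raises the exponent `k` by one.
      moments : ∀ p W Z → Moments W Z → Moments (W ⊗ ⟦ p ⟧ X) (Z ⊗ ⟦ p ⟧ Y)
      moments 𝟙 W Z mom k = begin
        tr (W ⊗ δ ⊗ X ^^ k)    ≡⟨ tr-cong (⊗-congˡ (X ^^ k) (⊗-δ W)) ⟩
        tr (W ⊗ X ^^ k)        ≡⟨ mom k ⟩
        tr (Z ⊗ Y ^^ k)        ≡⟨ tr-cong (⊗-congˡ (Y ^^ k) (⊗-δ Z)) ⟨
        tr (Z ⊗ δ ⊗ Y ^^ k)    ∎
      moments 𝕩 W Z mom k = begin
        tr (W ⊗ X ⊗ X ^^ k)    ≡⟨ tr-cong (⊗-assoc W X (X ^^ k)) ⟩
        tr (W ⊗ X ^^ suc k)    ≡⟨ mom (suc k) ⟩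
        tr (Z ⊗ Y ^^ suc k)    ≡⟨ tr-cong (⊗-assoc Z Y (Y ^^ k)) ⟨
        tr (Z ⊗ Y ⊗ Y ^^ k)    ∎
      moments (c ⊙ p) W Z mom k = begin
        tr (W ⊗ ⟦ c ⊙ p ⟧ X ⊗ X ^^ k)     ≡⟨ scale W (⟦ p ⟧ X) (X ^^ k) ⟩
        c * tr (W ⊗ ⟦ p ⟧ X ⊗ X ^^ k)     ≡⟨ cong (c *_) (moments p W Z mom k) ⟩
        c * tr (Z ⊗ ⟦ p ⟧ Y ⊗ Y ^^ k)     ≡⟨ scale Z (⟦ p ⟧ Y) (Y ^^ k) ⟨
        tr (Z ⊗ ⟦ c ⊙ p ⟧ Y ⊗ Y ^^ k)     ∎
        where
        alg : ∀ c w d → w * (c * d) ≡ c * (w * d)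
        alg = solve-∀
        scaled : ∀ (U A : Mat n) i j → (U ⊗ (λ i j → c * A i j)) i j ≡ c * (U ⊗ A) i j
        scaled U A i j = begin
          (∑ λ l → U i l * (c * A l j))   ≡⟨ ∑-cong (λ l → alg c (U i l) (A l j)) ⟩
          (∑ λ l → c * (U i l * A l j))   ≡⟨ ∑-*ˡ c (λ l → U i l * A l j) ⟨
          c * (U ⊗ A) i j                 ∎
        scale : ∀ (U A V : Mat n) → tr (U ⊗ (λ i j → c * A i j) ⊗ V) ≡ c * tr (U ⊗ A ⊗ V)
        scale U A V = begin
          tr (U ⊗ (λ i j → c * A i j) ⊗ V)                ≡⟨ tr-cong (⊗-congˡ V (scaled U A)) ⟩
          tr ((λ i j → c * (U ⊗ A) i j) ⊗ V)
            ≡⟨ ∑-cong (λ i → trans (∑-cong λ k → *-assoc c ((U ⊗ A) i k) (V k i)) (sym (∑-*ˡ c (λ k → (U ⊗ A) i k * V k i)))) ⟩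
          (∑ λ i → c * (U ⊗ A ⊗ V) i i)                   ≡⟨ ∑-*ˡ c (λ i → (U ⊗ A ⊗ V) i i) ⟨
          c * tr (U ⊗ A ⊗ V)                              ∎
      moments (p ⊕ q) W Z mom k = begin
        tr (W ⊗ ⟦ p ⊕ q ⟧ X ⊗ X ^^ k)                              ≡⟨ split W (⟦ p ⟧ X) (⟦ q ⟧ X) (X ^^ k) ⟩
        tr (W ⊗ ⟦ p ⟧ X ⊗ X ^^ k) + tr (W ⊗ ⟦ q ⟧ X ⊗ X ^^ k)      ≡⟨ cong₂ _+_ (moments p W Z mom k) (moments q W Z mom k) ⟩
        tr (Z ⊗ ⟦ p ⟧ Y ⊗ Y ^^ k) + tr (Z ⊗ ⟦ q ⟧ Y ⊗ Y ^^ k)      ≡⟨ split Z (⟦ p ⟧ Y) (⟦ q ⟧ Y) (Y ^^ k) ⟨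
        tr (Z ⊗ ⟦ p ⊕ q ⟧ Y ⊗ Y ^^ k)                              ∎
        where
        distribˡ : ∀ w a b → w * (a + b) ≡ w * a + w * b
        distribˡ = solve-∀
        distribʳ : ∀ w a b → (a + b) * w ≡ a * w + b * w
        distribʳ = solve-∀
        split : ∀ (U A B V : Mat n) →
          tr (U ⊗ (λ i j → A i j + B i j) ⊗ V) ≡ tr (U ⊗ A ⊗ V) + tr (U ⊗ B ⊗ V)
        split U A B V = trans (∑-cong λ i → trans
          (∑-cong λ k → trans
            (cong (_* V k i) (trans (∑-cong λ l → distribˡ (U i l) (A l k) (B l k))
                                    (∑-+ (λ l → U i l * A l k) (λ l → U i l * B l k))))
            (distribʳ (V k i) ((U ⊗ A) i k) ((U ⊗ B) i k)))
          (∑-+ (λ k → (U ⊗ A) i k * V k i) (λ k → (U ⊗ B) i k * V k i)))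
          (∑-+ (λ i → (U ⊗ A ⊗ V) i i) (λ i → (U ⊗ B ⊗ V) i i))
      moments (p ⊛ q) W Z mom k = begin
        tr (W ⊗ (⟦ p ⟧ X ⊗ ⟦ q ⟧ X) ⊗ X ^^ k)   ≡⟨ tr-cong (⊗-congˡ (X ^^ k) (⊗-assoc W (⟦ p ⟧ X) (⟦ q ⟧ X))) ⟨
        tr (W ⊗ ⟦ p ⟧ X ⊗ ⟦ q ⟧ X ⊗ X ^^ k)     ≡⟨ moments q (W ⊗ ⟦ p ⟧ X) (Z ⊗ ⟦ p ⟧ Y) (moments p W Z mom) k ⟩
        tr (Z ⊗ ⟦ p ⟧ Y ⊗ ⟦ q ⟧ Y ⊗ Y ^^ k)     ≡⟨ tr-cong (⊗-congˡ (Y ^^ k) (⊗-assoc Z (⟦ p ⟧ Y) (⟦ q ⟧ Y))) ⟩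
        tr (Z ⊗ (⟦ p ⟧ Y ⊗ ⟦ q ⟧ Y) ⊗ Y ^^ k)   ∎

    poly-traces : ∀ p → tr (⟦ p ⟧ X) ≡ tr (⟦ p ⟧ Y)
    poly-traces p = begin
      tr (⟦ p ⟧ X)            ≡⟨ drop (⟦ p ⟧ X) ⟨
      tr (δ ⊗ ⟦ p ⟧ X ⊗ δ)    ≡⟨ moments p δ δ δ-moments 0 ⟩
      tr (δ ⊗ ⟦ p ⟧ Y ⊗ δ)    ≡⟨ drop (⟦ p ⟧ Y) ⟩
      tr (⟦ p ⟧ Y)            ∎
      where
      drop : ∀ (Z : Mat n) → tr (δ ⊗ Z ⊗ δ) ≡ tr Z
      drop Z = tr-cong λ i j → trans (δ-*ʳ j ((δ ⊗ Z) i)) (δ-*ˡ i (λ k → Z k j))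
      δ-moments : Moments δ δ
      δ-moments k = begin
        tr (δ ⊗ X ^^ k)   ≡⟨ tr-cong (λ i j → δ-*ˡ i (λ l → (X ^^ k) l j)) ⟩
        tr (X ^^ k)       ≡⟨ power-traces k ⟩
        tr (Y ^^ k)       ≡⟨ tr-cong (λ i j → δ-*ˡ i (λ l → (Y ^^ k) l j)) ⟨
        tr (δ ⊗ Y ^^ k)   ∎

open IntegerMatrices

-- Eigenvalues in a field of characteristic zero

opaque

  adjacencyℤ : Graph n → Mat n
  adjacencyℤ G i j = if does (i ~? j) then 1ℤ else 0ℤ
    where open Graph G

  adjacencyℤ-yes : ∀ (G : Graph n) {i j} → Graph._~_ G i j → adjacencyℤ G i j ≡ 1ℤ
  adjacencyℤ-yes G {i} {j} i~j with Graph._~?_ G i j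
  ... | yes _  = ≡.refl
  ... | no i≁j = contradiction i~j i≁j

  adjacencyℤ-no : ∀ (G : Graph n) {i j} → ¬ Graph._~_ G i j → adjacencyℤ G i j ≡ 0ℤ
  adjacencyℤ-no G {i} {j} i≁j with Graph._~?_ G i j
  ... | yes i~j = contradiction i~j i≁j
  ... | no _    = ≡.refl

module OverField {c ℓ₁ ℓ₂} (K : HeytingField c ℓ₁ ℓ₂) (char0 : CharacteristicZero K) where

  private
    module K = HeytingField K
    R : CommutativeRing c ℓ₁
    R = HeytingCommutativeRing.commutativeRing K.heytingCommutativeRing

  open CommutativeRing R hiding (zero)
  open Algebra.Properties.Group +-group using (ε⁻¹≈ε; ⁻¹-involutive)
  open Algebra.Properties.Ring ring using (-‿distribˡ-*; -‿distribʳ-*; -‿+-comm)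
  module Mult = Algebra.Properties.Semiring.Mult semiring
  module Sum = Algebra.Properties.Semiring.Sum semiring
  open Relation.Binary.Reasoning.Setoid setoid

  -- The canonical ring homomorphism; characteristic zero makes it injective, so equalities of
  -- determinants descend from K to ℤ.
  φ : ℤ → Carrier
  φ (pos m)  = m Mult.× 1#
  φ -[1+ m ] = - (suc m Mult.× 1#)

  φ-1 : φ 1ℤ ≈ 1#
  φ-1 = +-identityʳ 1#

  φ-neg : ∀ a → φ (ℤ.- a) ≈ - φ a
  φ-neg (pos zero)    = sym ε⁻¹≈ε
  φ-neg (pos (suc m)) = refl
  φ-neg -[1+ m ]      = sym (⁻¹-involutive _)

  φ-⊖ : ∀ m k → φ (m ⊖ k) ≈ m Mult.× 1# - k Mult.× 1#
  φ-⊖ zero    zero    = sym (-‿inverseʳ 0#)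
  φ-⊖ zero    (suc k) = sym (+-identityˡ _)
  φ-⊖ (suc m) zero    = trans (sym (+-identityʳ _)) (+-congˡ (sym ε⁻¹≈ε))
  φ-⊖ (suc m) (suc k) = begin
    φ (suc m ⊖ suc k)              ≡⟨ ≡.cong φ (ℤ.[1+m]⊖[1+n]≡m⊖n m k) ⟩
    φ (m ⊖ k)                      ≈⟨ φ-⊖ m k ⟩
    a - b                          ≈⟨ +-congˡ (trans (sym (+-identityˡ (- b))) (+-congʳ (sym (-‿inverseʳ 1#)))) ⟩
    a + ((1# - 1#) - b)            ≈⟨ +-congˡ (+-assoc 1# (- 1#) (- b)) ⟩
    a + (1# + (- 1# - b))          ≈⟨ sym (+-assoc a 1# (- 1# - b)) ⟩
    (a + 1#) + (- 1# - b)          ≈⟨ +-cong (+-comm a 1#) (-‿+-comm 1# b) ⟩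
    (1# + a) - (1# + b)            ∎
    where
    a = m Mult.× 1#
    b = k Mult.× 1#

  φ-+ : ∀ a b → φ (a ℤ.+ b) ≈ φ a + φ b
  φ-+ (pos m)  (pos k)  = Mult.×-homo-+ 1# m k
  φ-+ (pos m)  -[1+ k ] = φ-⊖ m (suc k)
  φ-+ -[1+ m ] (pos k)  = trans (φ-⊖ k (suc m)) (+-comm _ _)
  φ-+ -[1+ m ] -[1+ k ] = begin
    - (suc (suc (m ℕ.+ k)) Mult.× 1#)             ≡⟨ ≡.cong (λ l → - (l Mult.× 1#)) (≡.sym (≡.cong suc (ℕ.+-suc m k))) ⟩
    - ((suc m ℕ.+ suc k) Mult.× 1#)               ≈⟨ -‿cong (Mult.×-homo-+ 1# (suc m) (suc k)) ⟩
    - (suc m Mult.× 1# + suc k Mult.× 1#)         ≈⟨ sym (-‿+-comm _ _) ⟩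
    - (suc m Mult.× 1#) - suc k Mult.× 1#         ∎

  φ-pos-* : ∀ m b → φ (pos m ℤ.* b) ≈ φ (pos m) * φ b
  φ-pos-* m (pos k)  = trans (reflexive (≡.cong φ (≡.sym (ℤ.pos-* m k)))) (Mult.×1-homo-* m k)
  φ-pos-* m -[1+ k ] = begin
    φ (pos m ℤ.* -[1+ k ])              ≡⟨ ≡.cong φ (ℤ.neg-distribʳ-* (pos m) (pos (suc k))) ⟨
    φ (ℤ.- (pos m ℤ.* pos (suc k)))     ≈⟨ φ-neg (pos m ℤ.* pos (suc k)) ⟩
    - φ (pos m ℤ.* pos (suc k))         ≈⟨ -‿cong (φ-pos-* m (pos (suc k))) ⟩
    - (φ (pos m) * φ (pos (suc k)))     ≈⟨ -‿distribʳ-* _ _ ⟩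
    φ (pos m) * φ -[1+ k ]              ∎

  φ-* : ∀ a b → φ (a ℤ.* b) ≈ φ a * φ b
  φ-* (pos m)  b = φ-pos-* m b
  φ-* -[1+ m ] b = begin
    φ (-[1+ m ] ℤ.* b)                  ≡⟨ ≡.cong φ (ℤ.neg-distribˡ-* (pos (suc m)) b) ⟨
    φ (ℤ.- (pos (suc m) ℤ.* b))         ≈⟨ φ-neg (pos (suc m) ℤ.* b) ⟩
    - φ (pos (suc m) ℤ.* b)             ≈⟨ -‿cong (φ-pos-* (suc m) b) ⟩
    - (φ (pos (suc m)) * φ b)           ≈⟨ -‿distribˡ-* _ _ ⟩
    φ -[1+ m ] * φ b                    ∎

  φ-kernel : ∀ a → φ a ≈ 0# → a ≡ 0ℤ
  φ-kernel (pos zero)    _    = ≡.refl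
  φ-kernel (pos (suc m)) φ≈0  = contradiction φ≈0 (char0 m)
  φ-kernel -[1+ m ]      -φ≈0 = contradiction
    (trans (sym (⁻¹-involutive _)) (trans (-‿cong -φ≈0) ε⁻¹≈ε)) (char0 m)

  φ-injective : ∀ {a b} → φ a ≈ φ b → a ≡ b
  φ-injective {a} {b} φa≈φb = ℤ.i-j≡0⇒i≡j a b (φ-kernel (a ℤ.- b) (begin
    φ (a ℤ.- b)        ≈⟨ φ-+ a (ℤ.- b) ⟩
    φ a + φ (ℤ.- b)    ≈⟨ +-cong φa≈φb (φ-neg b) ⟩
    φ b - φ b          ≈⟨ -‿inverseʳ (φ b) ⟩
    0#                 ∎))

  φ-∑ : ∀ {f : Fin n → Carrier} {g : Fin n → ℤ} → (∀ i → f i ≈ φ (g i)) → Sum.sum f ≈ φ (∑ g)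
  φ-∑ {zero}  {f} {g} f≈φg = reflexive (≡.cong φ (≡.sym (∑-empty g)))
  φ-∑ {suc n} {f} {g} f≈φg = begin
    f zero + Sum.sum (λ i → f (suc i))   ≈⟨ +-cong (f≈φg zero) (φ-∑ (f≈φg ∘ suc)) ⟩
    φ (g zero) + φ (∑ (λ i → g (suc i))) ≈⟨ φ-+ (g zero) _ ⟨
    φ (g zero ℤ.+ ∑ (λ i → g (suc i)))   ≡⟨ ≡.cong φ (∑-suc g) ⟨
    φ (∑ g)                              ∎

  φ-sign : ∀ k → sign K k ≈ φ (sgn k)
  φ-sign zero    = sym φ-1
  φ-sign (suc k) = trans (-‿cong (φ-sign k)) (sym (φ-neg (sgn k)))

  φ-det : ∀ {X : Matrix K n} {Y : Mat n} → (∀ i j → X i j ≈ φ (Y i j)) → Defs.det K X ≈ φ (det Y)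
  φ-det {zero}  {X} {Y} X≈φY = trans (sym φ-1) (reflexive (≡.cong φ (≡.sym (det-empty Y))))
  φ-det {suc n} {X} {Y} X≈φY = trans
    (φ-∑ λ j → begin
      sign K (toℕ j) * (X zero j * Defs.det K (λ i k → X (suc i) (punchIn j k)))
        ≈⟨ *-cong (φ-sign (toℕ j)) (*-cong (X≈φY zero j) (φ-det λ i k → X≈φY (suc i) (punchIn j k))) ⟩
      φ (sgn (toℕ j)) * (φ (Y zero j) * φ (det (minor Y j)))
        ≈⟨ *-congˡ (φ-* (Y zero j) (det (minor Y j))) ⟨
      φ (sgn (toℕ j)) * φ (Y zero j ℤ.* det (minor Y j))
        ≈⟨ φ-* (sgn (toℕ j)) _ ⟨
      φ (sgn (toℕ j) ℤ.* (Y zero j ℤ.* det (minor Y j))) ∎)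
    (reflexive (≡.cong φ (≡.sym (det-laplace Y))))

  -- From characteristic polynomials to the pencils 1 + t A

  power : ℕ → Carrier → Carrier
  power zero    a = 1#
  power (suc k) a = a * power k a

  det-scale : ∀ a (X : Matrix K n) → Defs.det K (λ i j → a * X i j) ≈ power n a * Defs.det K X
  det-scale {zero}  a X = sym (*-identityˡ 1#)
  det-scale {suc n} a X = trans
    (Sum.sum-cong-≋ λ j → begin
      s j * (a * X zero j * Defs.det K (λ i k → a * X (suc i) (punchIn j k)))
        ≈⟨ *-congˡ (*-congˡ (det-scale a (λ i k → X (suc i) (punchIn j k)))) ⟩
      s j * (a * X zero j * (power n a * d j))
        ≈⟨ *-congˡ (interchange a (X zero j) (power n a) (d j)) ⟩
      s j * (a * power n a * (X zero j * d j))
        ≈⟨ x∙yz≈y∙xz (s j) (a * power n a) (X zero j * d j) ⟩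
      a * power n a * (s j * (X zero j * d j)) ∎)
    (sym (Sum.*-distribˡ-sum (a * power n a) (λ j → s j * (X zero j * d j))))
    where
    open Algebra.Properties.CommutativeSemigroup *-commutativeSemigroup
      using (interchange; x∙yz≈y∙xz)
    s d : Fin (suc n) → Carrier
    s j = sign K (toℕ j)
    d j = Defs.det K (λ i k → X (suc i) (punchIn j k))

  -- Here `y` is -1/t, so scaling y - A by -t gives 1 + t A.
  pencil-entry : ∀ (G : Graph n) t y → φ (ℤ.- t) * y ≈ 1# → ∀ i j →
    φ (ℤ.- t) * (y * identity K i j - adjacency K G i j) ≈ φ ((1+ t · adjacencyℤ G) i j)
  pencil-entry G t y inv i j = begin
    s * (y * e - a)                           ≈⟨ distribˡ s (y * e) (- a) ⟩
    s * (y * e) + s * - a                     ≈⟨ +-cong left right ⟩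
    φ (δ i j) + φ (t ℤ.* adjacencyℤ G i j)    ≈⟨ φ-+ (δ i j) (t ℤ.* adjacencyℤ G i j) ⟨
    φ ((1+ t · adjacencyℤ G) i j)             ∎
    where
    s = φ (ℤ.- t)
    e = identity K i j
    a = adjacency K G i j

    φ-δ : e ≈ φ (δ i j)
    φ-δ with i ≟ j
    ... | yes ≡.refl = trans (sym φ-1) (reflexive (≡.cong φ (≡.sym (δ-refl i))))
    ... | no i≢j     = reflexive (≡.cong φ (≡.sym (δ-≢ i≢j)))

    φ-adjacency : a ≈ φ (adjacencyℤ G i j)
    φ-adjacency with Graph._~?_ G i j
    ... | yes i~j = trans (sym φ-1) (reflexive (≡.cong φ (≡.sym (adjacencyℤ-yes G i~j))))
    ... | no i≁j  = reflexive (≡.cong φ (≡.sym (adjacencyℤ-no G i≁j)))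

    left : s * (y * e) ≈ φ (δ i j)
    left = begin
      s * (y * e)   ≈⟨ *-assoc s y e ⟨
      s * y * e     ≈⟨ *-congʳ inv ⟩
      1# * e        ≈⟨ *-identityˡ e ⟩
      e             ≈⟨ φ-δ ⟩
      φ (δ i j)     ∎

    right : s * - a ≈ φ (t ℤ.* adjacencyℤ G i j)
    right = begin
      s * - a                                    ≈⟨ *-congˡ (trans (-‿cong φ-adjacency) (sym (φ-neg (adjacencyℤ G i j)))) ⟩
      φ (ℤ.- t) * φ (ℤ.- adjacencyℤ G i j)       ≈⟨ φ-* (ℤ.- t) (ℤ.- adjacencyℤ G i j) ⟨
      φ (ℤ.- t ℤ.* ℤ.- adjacencyℤ G i j)         ≡⟨ ≡.cong φ (alg t (adjacencyℤ G i j)) ⟩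
      φ (t ℤ.* adjacencyℤ G i j)                 ∎
      where
      alg : ∀ t a → ℤ.- t ℤ.* ℤ.- a ≡ t ℤ.* a
      alg = solve-∀

  det-pencil : ∀ (G : Graph n) t y → φ (ℤ.- t) * y ≈ 1# →
    φ (det (1+ t · adjacencyℤ G)) ≈ power n (φ (ℤ.- t)) * charPoly K (adjacency K G) y
  det-pencil G t y inv = trans (sym (φ-det (pencil-entry G t y inv)))
    (det-scale (φ (ℤ.- t)) (λ i j → y * identity K i j - adjacency K G i j))

  -- Invertibility of φ (- t) is only available up to double negation, but equality in K is
  -- stable by tightness.
  equal-pencils : ∀ (G H : Graph n) →
    (∀ y → charPoly K (adjacency K G) y ≈ charPoly K (adjacency K H) y) →
    ∀ t → det (1+ t · adjacencyℤ G) ≡ det (1+ t · adjacencyℤ H)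
  equal-pencils {n} G H char≈ t with t ℤ.≟ 0ℤ
  -- There is no reciprocal at t = 0, but there both pencils are the identity.
  ... | yes ≡.refl = det-cong λ i j → ≡.refl
  ... | no t≢0 = φ-injective (proj₁ (K.tight _ _) λ apart →
          φ-t≉0 (proj₁ (K.tight _ _) λ φ-t#0 → proj₂ (K.tight _ _) (equal φ-t#0) apart))
    where
    φ-t≉0 : ¬ (φ (ℤ.- t) ≈ 0#)
    φ-t≉0 φ-t≈0 = t≢0 (≡.trans (≡.sym (ℤ.neg-involutive t)) (≡.cong ℤ.-_ (φ-kernel (ℤ.- t) φ-t≈0)))

    equal : φ (ℤ.- t) K.# 0# → φ (det (1+ t · adjacencyℤ G)) ≈ φ (det (1+ t · adjacencyℤ H))
    equal φ-t#0 with K.#⇒invertible φ-t#0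
    ... | y , _ , inv = begin
      φ (det (1+ t · adjacencyℤ G))                                  ≈⟨ det-pencil G t y inv′ ⟩
      power n (φ (ℤ.- t)) * charPoly K (adjacency K G) y             ≈⟨ *-congˡ (char≈ y) ⟩
      power n (φ (ℤ.- t)) * charPoly K (adjacency K H) y             ≈⟨ det-pencil H t y inv′ ⟨
      φ (det (1+ t · adjacencyℤ H))                                  ∎
      where
      inv′ : φ (ℤ.- t) * y ≈ 1#
      inv′ = trans (*-congʳ (sym (trans (+-congˡ ε⁻¹≈ε) (+-identityʳ _)))) inv

  module P = Perm setoid

  foldr-toList : ∀ x (λs : Vec Carrier n) →
    Vec.foldr (λ _ → Carrier) (λ λᵢ p → (x - λᵢ) * p) 1# λs ≡
    List.foldr _*_ 1# (List.map (λ λᵢ → x - λᵢ) (Vec.toList λs))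
  foldr-toList x []       = ≡.refl
  foldr-toList x (λᵢ ∷ λs) = ≡.cong ((x - λᵢ) *_) (foldr-toList x λs)

  cospectral⇒charPoly : ∀ (G H : Graph n) → Cospectral K G H →
    ∀ x → charPoly K (adjacency K G) x ≈ charPoly K (adjacency K H) x
  cospectral⇒charPoly G H (λs , μs , specG , specH , λs↭μs) x = begin
    charPoly K (adjacency K G) x                              ≈⟨ specG x ⟩
    Vec.foldr (λ _ → Carrier) (λ λᵢ p → (x - λᵢ) * p) 1# λs   ≡⟨ foldr-toList x λs ⟩
    List.foldr _*_ 1# (List.map (λ λᵢ → x - λᵢ) (Vec.toList λs))
      ≈⟨ P.foldr-commMonoid *-isCommutativeMonoid (P.map⁺ setoid (λ eq → +-congˡ (-‿cong eq)) λs↭μs) ⟩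
    List.foldr _*_ 1# (List.map (λ λᵢ → x - λᵢ) (Vec.toList μs))       ≡⟨ foldr-toList x μs ⟨
    Vec.foldr (λ _ → Carrier) (λ λᵢ p → (x - λᵢ) * p) 1# μs   ≈⟨ specH x ⟨
    charPoly K (adjacency K H) x                              ∎

  cospectral⇒pencils : ∀ (G H : Graph n) → Cospectral K G H →
    ∀ t → det (1+ t · adjacencyℤ G) ≡ det (1+ t · adjacencyℤ H)
  cospectral⇒pencils G H cosp = equal-pencils G H (cospectral⇒charPoly G H cosp)

  cospectral⇒size : ∀ {m n} (G : Graph m) (H : Graph n) → Cospectral K G H → m ≡ n
  cospectral⇒size G H (λs , μs , _ , _ , λs↭μs) = ≡.trans (≡.sym (Vec.length-toList λs))
    (≡.trans (P.xs↭ys⇒|xs|≡|ys| λs↭μs) (Vec.length-toList μs))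

open import Relation.Binary.PropositionalEquality
  using (refl; sym; trans; cong; cong₂; subst; subst₂; module ≡-Reasoning)
open ≡-Reasoning
open import Data.Integer.Base using (-_; _+_; _-_; _*_; _≤_; +≤+)
open import Data.Integer.Properties
  using (+-identityʳ; *-identityˡ; *-identityʳ; *-zeroʳ; *-comm; pos-*; abs-*; ≤-reflexive; ≤-trans;
         ≤-antisym; +-mono-≤; +-monoʳ-≤; i-j≡0⇒i≡j; i*j≡0⇒i≡0∨j≡0)

-- Sums of squares and 3×3 minors

∑-mono-≤ : ∀ {f g : Fin n → ℤ} → (∀ i → f i ≤ g i) → ∑ f ≤ ∑ g
∑-mono-≤ {zero}  {f} {g} f≤g = ≤-reflexive (trans (∑-empty f) (sym (∑-empty g)))
∑-mono-≤ {suc n} {f} {g} f≤g = ≤-trans (≤-reflexive (∑-suc f))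
  (≤-trans (+-mono-≤ (f≤g zero) (∑-mono-≤ λ i → f≤g (suc i))) (≤-reflexive (sym (∑-suc g))))

∑-nonneg : ∀ {f : Fin n → ℤ} → (∀ i → 0ℤ ≤ f i) → 0ℤ ≤ ∑ f
∑-nonneg {n} 0≤f = ≤-trans (≤-reflexive (sym (∑-zero {f = λ (_ : Fin n) → 0ℤ} λ _ → refl))) (∑-mono-≤ 0≤f)

+-nonneg-zeroˡ : ∀ {a b} → 0ℤ ≤ a → 0ℤ ≤ b → a + b ≡ 0ℤ → a ≡ 0ℤ
+-nonneg-zeroˡ {a} {b} 0≤a 0≤b a+b≡0 = ≤-antisym
  (≤-trans (≤-reflexive (sym (+-identityʳ a))) (≤-trans (+-monoʳ-≤ a 0≤b) (≤-reflexive a+b≡0))) 0≤a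

∑≡0⇒≡0 : ∀ {f : Fin n → ℤ} → (∀ i → 0ℤ ≤ f i) → ∑ f ≡ 0ℤ → ∀ i → f i ≡ 0ℤ
∑≡0⇒≡0 {suc n} {f} 0≤f ∑≡0 i =
  +-nonneg-zeroˡ (0≤f i) (∑-nonneg λ k → 0≤f _) (trans (sym (∑-remove i f)) ∑≡0)

0≤i*i : ∀ i → 0ℤ ≤ i * i
0≤i*i (pos zero)    = +≤+ z≤n
0≤i*i (pos (suc m)) = +≤+ z≤n
0≤i*i -[1+ m ]      = +≤+ z≤n

i*i≡0⇒i≡0 : ∀ i → i * i ≡ 0ℤ → i ≡ 0ℤ
i*i≡0⇒i≡0 i i*i≡0 = reduce (i*j≡0⇒i≡0∨j≡0 i i*i≡0)

∑-squares≡0⇒≡0 : ∀ (f : Fin m → Fin n → ℤ) → (∑ λ i → ∑ λ j → f i j * f i j) ≡ 0ℤ → ∀ i j → f i j ≡ 0ℤ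
∑-squares≡0⇒≡0 f ∑≡0 i j = i*i≡0⇒i≡0 (f i j)
  (∑≡0⇒≡0 (λ j → 0≤i*i (f i j)) (∑≡0⇒≡0 (λ i → ∑-nonneg λ j → 0≤i*i (f i j)) ∑≡0 i) j)

-- Sums of squared 3×3 minors as trace expressions

det₃ : (a₁ a₂ a₃ b₁ b₂ b₃ c₁ c₂ c₃ : ℤ) → ℤ
det₃ a₁ a₂ a₃ b₁ b₂ b₃ c₁ c₂ c₃ =
  a₁ * (b₂ * c₃ - b₃ * c₂) - a₂ * (b₁ * c₃ - b₃ * c₁) + a₃ * (b₁ * c₂ - b₂ * c₁)

det₃-rows : (a b c : Fin n → ℤ) → Fin n → Fin n → Fin n → ℤ
det₃-rows a b c p q r = det₃ (a p) (a q) (a r) (b p) (b q) (b r) (c p) (c q) (c r)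

minor₃ : Mat n → (i j k p q r : Fin n) → ℤ
minor₃ X i j k = det₃-rows (X i) (X j) (X k)

infix 8 ⟨_,_⟩

⟨_,_⟩ : (a b : Fin n → ℤ) → ℤ
⟨ a , b ⟩ = ∑ λ p → a p * b p

-- A squared minor is a quadratic form in the entries of each of its columns; summing over that
-- column replaces the six monomials by scalar products of rows.
∑-quadratic : ∀ (a b c : Fin n → ℤ) A₁ A₂ A₃ A₄ A₅ A₆ →
  (∑ λ r → A₁ * (a r * a r) + (A₂ * (b r * b r) + (A₃ * (c r * c r) +
    (A₄ * (a r * b r) + (A₅ * (a r * c r) + A₆ * (b r * c r)))))) ≡
  A₁ * ⟨ a , a ⟩ + (A₂ * ⟨ b , b ⟩ + (A₃ * ⟨ c , c ⟩ + (A₄ * ⟨ a , b ⟩ + (A₅ * ⟨ a , c ⟩ + A₆ * ⟨ b , c ⟩))))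
∑-quadratic a b c A₁ A₂ A₃ A₄ A₅ A₆ =
  trans (∑-linear A₁ _ _) (cong (A₁ * ⟨ a , a ⟩ +_) (
  trans (∑-linear A₂ _ _) (cong (A₂ * ⟨ b , b ⟩ +_) (
  trans (∑-linear A₃ _ _) (cong (A₃ * ⟨ c , c ⟩ +_) (
  trans (∑-linear A₄ _ _) (cong (A₄ * ⟨ a , b ⟩ +_) (
  trans (∑-linear A₅ _ _) (cong (A₅ * ⟨ a , c ⟩ +_) (
  sym (∑-*ˡ A₆ (λ r → b r * c r))))))))))))

gram₃ : (a b c : Fin n → ℤ) → ℤ
gram₃ a b c = det₃ ⟨ a , a ⟩ ⟨ a , b ⟩ ⟨ a , c ⟩ ⟨ a , b ⟩ ⟨ b , b ⟩ ⟨ b , c ⟩ ⟨ a , c ⟩ ⟨ b , c ⟩ ⟨ c , c ⟩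

module _ (a b c : Fin n → ℤ) where
  private
    aa = ⟨ a , a ⟩
    bb = ⟨ b , b ⟩
    cc = ⟨ c , c ⟩
    ab = ⟨ a , b ⟩
    ac = ⟨ a , c ⟩
    bc = ⟨ b , c ⟩

    -- The minor is the scalar product of its last column (u, v, w) with the cross product of the
    -- first two; the coefficients are products of the entries of this cross product.
    expandᵣ : ∀ x y z α β γ u v w →
      (x * (β * w - v * γ) - α * (y * w - v * z) + u * (y * γ - β * z)) *
      (x * (β * w - v * γ) - α * (y * w - v * z) + u * (y * γ - β * z)) ≡
      ((y * γ - z * β) * (y * γ - z * β)) * (u * u) +
      (((z * α - x * γ) * (z * α - x * γ)) * (v * v) +
      (((x * β - y * α) * (x * β - y * α)) * (w * w) +
      ((pos 2 * (y * γ - z * β) * (z * α - x * γ)) * (u * v) +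
      ((pos 2 * (y * γ - z * β) * (x * β - y * α)) * (u * w) +
       (pos 2 * (z * α - x * γ) * (x * β - y * α)) * (v * w)))))
    expandᵣ = solve-∀

    expandq : ∀ aa bb cc ab ac bc x y z α β γ →
      ((y * γ - z * β) * (y * γ - z * β)) * aa +
      (((z * α - x * γ) * (z * α - x * γ)) * bb +
      (((x * β - y * α) * (x * β - y * α)) * cc +
      ((pos 2 * (y * γ - z * β) * (z * α - x * γ)) * ab +
      ((pos 2 * (y * γ - z * β) * (x * β - y * α)) * ac +
       (pos 2 * (z * α - x * γ) * (x * β - y * α)) * bc)))) ≡
      (z * z * bb + y * y * cc - pos 2 * y * z * bc) * (α * α) +
      ((z * z * aa + x * x * cc - pos 2 * x * z * ac) * (β * β) +
      ((y * y * aa + x * x * bb - pos 2 * x * y * ab) * (γ * γ) +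
      ((pos 2 * (y * z * ac + x * z * bc - x * y * cc - z * z * ab)) * (α * β) +
      ((pos 2 * (y * z * ab + x * y * bc - x * z * bb - y * y * ac)) * (α * γ) +
       (pos 2 * (x * z * ab + x * y * ac - y * z * aa - x * x * bc)) * (β * γ)))))
    expandq = solve-∀

    expandₚ : ∀ aa bb cc ab ac bc x y z →
      (z * z * bb + y * y * cc - pos 2 * y * z * bc) * aa +
      ((z * z * aa + x * x * cc - pos 2 * x * z * ac) * bb +
      ((y * y * aa + x * x * bb - pos 2 * x * y * ab) * cc +
      ((pos 2 * (y * z * ac + x * z * bc - x * y * cc - z * z * ab)) * ab +
      ((pos 2 * (y * z * ab + x * y * bc - x * z * bb - y * y * ac)) * ac +
       (pos 2 * (x * z * ab + x * y * ac - y * z * aa - x * x * bc)) * bc)))) ≡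
      (pos 2 * (bb * cc - bc * bc)) * (x * x) +
      ((pos 2 * (aa * cc - ac * ac)) * (y * y) +
      ((pos 2 * (aa * bb - ab * ab)) * (z * z) +
      ((pos 4 * (ac * bc - ab * cc)) * (x * y) +
      ((pos 4 * (ab * bc - ac * bb)) * (x * z) +
       (pos 4 * (ab * ac - bc * aa)) * (y * z)))))
    expandₚ = solve-∀

    collect : ∀ aa bb cc ab ac bc →
      (pos 2 * (bb * cc - bc * bc)) * aa +
      ((pos 2 * (aa * cc - ac * ac)) * bb +
      ((pos 2 * (aa * bb - ab * ab)) * cc +
      ((pos 4 * (ac * bc - ab * cc)) * ab +
      ((pos 4 * (ab * bc - ac * bb)) * ac +
       (pos 4 * (ab * ac - bc * aa)) * bc)))) ≡
      pos 6 * (aa * (bb * cc - bc * bc) - ab * (ab * cc - bc * ac) + ac * (ab * bc - bb * ac))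
    collect = solve-∀

  -- Cauchy-Binet; the factor 6 counts the orderings of a column triple. Columns are summed out one
  -- at a time, and after each summation the result is regrouped as a quadratic form in the entries
  -- of the next column.
  cauchy-binet₃ : (∑ λ p → ∑ λ q → ∑ λ r → det₃-rows a b c p q r * det₃-rows a b c p q r) ≡ pos 6 * gram₃ a b c
  cauchy-binet₃ = trans
    (∑-cong λ p → trans
      (∑-cong λ q → trans
        (∑-cong λ r → expandᵣ (a p) (b p) (c p) (a q) (b q) (c q) (a r) (b r) (c r))
        (trans (∑-quadratic a b c
                 ((b p * c q - c p * b q) * (b p * c q - c p * b q))
                 ((c p * a q - a p * c q) * (c p * a q - a p * c q))
                 ((a p * b q - b p * a q) * (a p * b q - b p * a q))
                 (pos 2 * (b p * c q - c p * b q) * (c p * a q - a p * c q))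
                 (pos 2 * (b p * c q - c p * b q) * (a p * b q - b p * a q))
                 (pos 2 * (c p * a q - a p * c q) * (a p * b q - b p * a q)))
               (expandq aa bb cc ab ac bc (a p) (b p) (c p) (a q) (b q) (c q))))
      (trans (∑-quadratic a b c
                   (c p * c p * bb + b p * b p * cc - pos 2 * b p * c p * bc)
                   (c p * c p * aa + a p * a p * cc - pos 2 * a p * c p * ac)
                   (b p * b p * aa + a p * a p * bb - pos 2 * a p * b p * ab)
                   (pos 2 * (b p * c p * ac + a p * c p * bc - a p * b p * cc - c p * c p * ab))
                   (pos 2 * (b p * c p * ab + a p * b p * bc - a p * c p * bb - b p * b p * ac))
                   (pos 2 * (a p * c p * ab + a p * b p * ac - b p * c p * aa - a p * a p * bc)))
             (expandₚ aa bb cc ab ac bc (a p) (b p) (c p))))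
    (trans (∑-quadratic a b c
               (pos 2 * (bb * cc - bc * bc))
               (pos 2 * (aa * cc - ac * ac))
               (pos 2 * (aa * bb - ab * ab))
               (pos 4 * (ac * bc - ab * cc))
               (pos 4 * (ab * bc - ac * bb))
               (pos 4 * (ab * ac - bc * aa)))
           (collect aa bb cc ab ac bc))

squared-minors : Mat n → ℤ
squared-minors X = ∑ λ i → ∑ λ j → ∑ λ k → ∑ λ p → ∑ λ q → ∑ λ r → minor₃ X i j k p q r * minor₃ X i j k p q r

squared-minors≡0⇒minor₃≡0 : ∀ (X : Mat n) → squared-minors X ≡ 0ℤ → ∀ i j k p q r → minor₃ X i j k p q r ≡ 0ℤ
squared-minors≡0⇒minor₃≡0 X ≡0 i j k p q r = i*i≡0⇒i≡0 (minor₃ X i j k p q r)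
  (∑≡0⇒≡0 (λ r → 0≤ i j k p q r)
  (∑≡0⇒≡0 (λ q → ∑-nonneg λ r → 0≤ i j k p q r)
  (∑≡0⇒≡0 (λ p → ∑-nonneg λ q → ∑-nonneg λ r → 0≤ i j k p q r)
  (∑≡0⇒≡0 (λ k → ∑-nonneg λ p → ∑-nonneg λ q → ∑-nonneg λ r → 0≤ i j k p q r)
  (∑≡0⇒≡0 (λ j → ∑-nonneg λ k → ∑-nonneg λ p → ∑-nonneg λ q → ∑-nonneg λ r → 0≤ i j k p q r)
  (∑≡0⇒≡0 (λ i → ∑-nonneg λ j → ∑-nonneg λ k → ∑-nonneg λ p → ∑-nonneg λ q → ∑-nonneg λ r → 0≤ i j k p q r)
  ≡0 i) j) k) p) q) r)
  where
  0≤ : ∀ i j k p q r → 0ℤ ≤ minor₃ X i j k p q r * minor₃ X i j k p q r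
  0≤ i j k p q r = 0≤i*i (minor₃ X i j k p q r)

-- Newton's identity 6 e₃ = p₁³ - 3 p₁ p₂ + 2 p₃ for the eigenvalues of `Y`, proved without
-- eigenvalues by summing out the three indices in turn.
principal-minors₃ : ∀ (Y : Mat n) → (∑ λ i → ∑ λ j → ∑ λ k → minor₃ Y i j k i j k) ≡
  tr Y * tr Y * tr Y - pos 3 * (tr Y * tr (Y ⊗ Y)) + pos 2 * tr (Y ⊗ Y ⊗ Y)
principal-minors₃ Y = begin
  (∑ λ i → ∑ λ j → ∑ λ k → minor₃ Y i j k i j k)
    ≡⟨ ∑-cong (λ i → ∑-cong (sumₖ i)) ⟩
  (∑ λ i → ∑ λ j → (Y i i * Y j j - Y i j * Y j i) * T + (- 1ℤ * (Y i i * Z j j) + (- 1ℤ * (Y j j * Z i i) + (Y i j * Z j i + Z i j * Y j i))))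
    ≡⟨ ∑-cong sumⱼ ⟩
  (∑ λ i → (T * T - S) * Y i i + (- pos 2 * T * Z i i + pos 2 * (Z ⊗ Y) i i))
    ≡⟨ sumᵢ ⟩
  T * T * T - pos 3 * (T * S) + pos 2 * tr (Z ⊗ Y) ∎
  where
  Z = Y ⊗ Y
  T = tr Y
  S = tr Z

  sumₖ : ∀ i j → (∑ λ k → minor₃ Y i j k i j k) ≡
    (Y i i * Y j j - Y i j * Y j i) * T + (- 1ℤ * (Y i i * Z j j) + (- 1ℤ * (Y j j * Z i i) + (Y i j * Z j i + Z i j * Y j i)))
  sumₖ i j = begin
    (∑ λ k → minor₃ Y i j k i j k)
      ≡⟨ ∑-cong (λ k → alg (Y i i) (Y i j) (Y i k) (Y j i) (Y j j) (Y j k) (Y k i) (Y k j) (Y k k)) ⟩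
    (∑ λ k → (Y i i * Y j j - Y i j * Y j i) * Y k k + (- Y i i * (Y j k * Y k j) + (- Y j j * (Y i k * Y k i)
      + (Y i j * (Y j k * Y k i) + Y j i * (Y i k * Y k j)))))
      ≡⟨ trans (∑-linear (Y i i * Y j j - Y i j * Y j i) (λ k → Y k k) _) (cong ((Y i i * Y j j - Y i j * Y j i) * T +_)
        (trans (∑-linear (- Y i i) (λ k → Y j k * Y k j) _) (cong (- Y i i * Z j j +_)
        (trans (∑-linear (- Y j j) (λ k → Y i k * Y k i) _) (cong (- Y j j * Z i i +_)
        (trans (∑-linear (Y i j) (λ k → Y j k * Y k i) _) (cong (Y i j * Z j i +_)
        (sym (∑-*ˡ (Y j i) (λ k → Y i k * Y k j)))))))))) ⟩
    (Y i i * Y j j - Y i j * Y j i) * T + (- Y i i * Z j j + (- Y j j * Z i i + (Y i j * Z j i + Y j i * Z i j)))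
      ≡⟨ alg′ ((Y i i * Y j j - Y i j * Y j i) * T) (Y i i) (Z j j) (Y j j) (Z i i) (Y i j * Z j i) (Y j i) (Z i j) ⟩
    (Y i i * Y j j - Y i j * Y j i) * T + (- 1ℤ * (Y i i * Z j j) + (- 1ℤ * (Y j j * Z i i) + (Y i j * Z j i + Z i j * Y j i))) ∎
    where
    alg : ∀ a b c d e f g h k → a * (e * k - f * h) - b * (d * k - f * g) + c * (d * h - e * g) ≡
      (a * e - b * d) * k + (- a * (f * h) + (- e * (c * g) + (b * (f * g) + d * (c * h))))
    alg = solve-∀
    alg′ : ∀ m a b c d e f g → m + (- a * b + (- c * d + (e + f * g))) ≡
      m + (- 1ℤ * (a * b) + (- 1ℤ * (c * d) + (e + g * f)))
    alg′ = solve-∀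

  sumⱼ : ∀ i → (∑ λ j → (Y i i * Y j j - Y i j * Y j i) * T + (- 1ℤ * (Y i i * Z j j) + (- 1ℤ * (Y j j * Z i i) + (Y i j * Z j i + Z i j * Y j i)))) ≡
    (T * T - S) * Y i i + (- pos 2 * T * Z i i + pos 2 * (Z ⊗ Y) i i)
  sumⱼ i = begin
    _ ≡⟨ ∑-cong (λ j → alg (Y i i) (Y j j) (Y i j) (Y j i) T (Z j j) (Z i i) (Z j i) (Z i j)) ⟩
    (∑ λ j → (Y i i * T - Z i i) * Y j j + (- T * (Y i j * Y j i) + (- Y i i * Z j j + (Y i j * Z j i + Z i j * Y j i))))
      ≡⟨ trans (∑-linear (Y i i * T - Z i i) (λ j → Y j j) _) (cong ((Y i i * T - Z i i) * T +_)
        (trans (∑-linear (- T) (λ j → Y i j * Y j i) _) (cong (- T * Z i i +_)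
        (trans (∑-linear (- Y i i) (λ j → Z j j) _) (cong (- Y i i * S +_)
        (trans (∑-+ (λ j → Y i j * Z j i) (λ j → Z i j * Y j i)) (cong (_+ (Z ⊗ Y) i i) (sym (⊗-assoc Y Y Y i i))))))))) ⟩
    (Y i i * T - Z i i) * T + (- T * Z i i + (- Y i i * S + ((Z ⊗ Y) i i + (Z ⊗ Y) i i)))
      ≡⟨ alg′ (Y i i) T (Z i i) S ((Z ⊗ Y) i i) ⟩
    (T * T - S) * Y i i + (- pos 2 * T * Z i i + pos 2 * (Z ⊗ Y) i i) ∎
    where
    alg : ∀ a b c d t zj zi u v → (a * b - c * d) * t + (- 1ℤ * (a * zj) + (- 1ℤ * (b * zi) + (c * u + v * d))) ≡
      (a * t - zi) * b + (- t * (c * d) + (- a * zj + (c * u + v * d)))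
    alg = solve-∀
    alg′ : ∀ a t z s w → (a * t - z) * t + (- t * z + (- a * s + (w + w))) ≡ (t * t - s) * a + (- pos 2 * t * z + pos 2 * w)
    alg′ = solve-∀

  sumᵢ : (∑ λ i → (T * T - S) * Y i i + (- pos 2 * T * Z i i + pos 2 * (Z ⊗ Y) i i)) ≡
    T * T * T - pos 3 * (T * S) + pos 2 * tr (Z ⊗ Y)
  sumᵢ = begin
    _ ≡⟨ trans (∑-linear (T * T - S) (λ i → Y i i) _) (cong ((T * T - S) * T +_)
        (trans (∑-linear (- pos 2 * T) (λ i → Z i i) _) (cong (- pos 2 * T * S +_)
        (sym (∑-*ˡ (pos 2) (λ i → (Z ⊗ Y) i i)))))) ⟩
    (T * T - S) * T + (- pos 2 * T * S + pos 2 * tr (Z ⊗ Y))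
      ≡⟨ alg T S (tr (Z ⊗ Y)) ⟩
    T * T * T - pos 3 * (T * S) + pos 2 * tr (Z ⊗ Y) ∎
    where
    alg : ∀ t s w → (t * t - s) * t + (- pos 2 * t * s + pos 2 * w) ≡ t * t * t - pos 3 * (t * s) + pos 2 * w
    alg = solve-∀

-- Cauchy-Binet turns the squared minors on three rows into a Gram determinant. As `X` is symmetric,
-- the scalar products of its rows are the entries of X², so the Gram determinant is a principal
-- minor of X².
squared-minors-traces : ∀ (X : Mat n) → (∀ i j → X i j ≡ X j i) → let Y = X ⊗ X in
  squared-minors X ≡ pos 6 * (tr Y * tr Y * tr Y - pos 3 * (tr Y * tr (Y ⊗ Y)) + pos 2 * tr (Y ⊗ Y ⊗ Y))
squared-minors-traces X X-sym = begin
  squared-minors X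
    ≡⟨ ∑-cong (λ i → ∑-cong λ j → ∑-cong λ k → trans (cauchy-binet₃ (X i) (X j) (X k)) (cong (pos 6 *_) (gram i j k))) ⟩
  (∑ λ i → ∑ λ j → ∑ λ k → pos 6 * minor₃ Y i j k i j k)
    ≡⟨ ∑-cong (λ i → ∑-cong λ j → ∑-*ˡ (pos 6) (λ k → minor₃ Y i j k i j k)) ⟨
  (∑ λ i → ∑ λ j → pos 6 * (∑ λ k → minor₃ Y i j k i j k))
    ≡⟨ ∑-cong (λ i → ∑-*ˡ (pos 6) (λ j → ∑ λ k → minor₃ Y i j k i j k)) ⟨
  (∑ λ i → pos 6 * (∑ λ j → ∑ λ k → minor₃ Y i j k i j k))
    ≡⟨ ∑-*ˡ (pos 6) (λ i → ∑ λ j → ∑ λ k → minor₃ Y i j k i j k) ⟨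
  pos 6 * (∑ λ i → ∑ λ j → ∑ λ k → minor₃ Y i j k i j k)
    ≡⟨ cong (pos 6 *_) (principal-minors₃ Y) ⟩
  pos 6 * (tr Y * tr Y * tr Y - pos 3 * (tr Y * tr (Y ⊗ Y)) + pos 2 * tr (Y ⊗ Y ⊗ Y)) ∎
  where
  Y = X ⊗ X

  entry : ∀ i j → ⟨ X i , X j ⟩ ≡ Y i j
  entry i j = ∑-cong λ p → cong (X i p *_) (X-sym j p)

  entry′ : ∀ i j → ⟨ X i , X j ⟩ ≡ Y j i
  entry′ i j = trans (∑-cong λ p → *-comm (X i p) (X j p)) (entry j i)

  gram : ∀ i j k → gram₃ (X i) (X j) (X k) ≡ minor₃ Y i j k i j k
  gram i j k = cong₃ (λ (a₁ , a₂ , a₃) (b₁ , b₂ , b₃) (c₁ , c₂ , c₃) → det₃ a₁ a₂ a₃ b₁ b₂ b₃ c₁ c₂ c₃)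
    (triple (entry i i) (entry i j) (entry i k))
    (triple (entry′ i j) (entry j j) (entry j k))
    (triple (entry′ i k) (entry′ j k) (entry k k))
    where
    triple : ∀ {a b c a′ b′ c′ : ℤ} → a ≡ a′ → b ≡ b′ → c ≡ c′ → (a , b , c) ≡ (a′ , b′ , c′)
    triple refl refl refl = refl
    cong₃ : ∀ {A : Set} (f : A → A → A → ℤ) {u v w u′ v′ w′} → u ≡ u′ → v ≡ v′ → w ≡ w′ → f u v w ≡ f u′ v′ w′
    cong₃ f refl refl refl = refl

-- The friendship graph

∑-one : ∀ n → ∑ {n} (λ _ → 1ℤ) ≡ pos n
∑-one zero    = ∑-empty (λ _ → 1ℤ)
∑-one (suc n) = trans (∑-suc (λ _ → 1ℤ)) (cong (1ℤ +_) (∑-one n))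

adjacencyℤ-sym : ∀ (G : Graph n) i j → adjacencyℤ G i j ≡ adjacencyℤ G j i
adjacencyℤ-sym G i j with Graph._~?_ G i j
... | yes i~j = trans (adjacencyℤ-yes G i~j) (sym (adjacencyℤ-yes G (Graph.~-sym G i~j)))
... | no i≁j  = trans (adjacencyℤ-no G i≁j) (sym (adjacencyℤ-no G (i≁j ∘ Graph.~-sym G)))

flip₂ : Fin 2 → Fin 2
flip₂ zero       = suc zero
flip₂ (suc zero) = zero

flip₂-involutive : ∀ b → flip₂ (flip₂ b) ≡ b
flip₂-involutive zero       = refl
flip₂-involutive (suc zero) = refl

flip₂-≢ : ∀ b → b ≢ flip₂ b
flip₂-≢ zero       ()
flip₂-≢ (suc zero) ()

≢⇒flip₂ : ∀ {b c} → b ≢ c → c ≡ flip₂ b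
≢⇒flip₂ {zero}     {zero}     b≢c = contradiction refl b≢c
≢⇒flip₂ {zero}     {suc zero} b≢c = refl
≢⇒flip₂ {suc zero} {zero}     b≢c = refl
≢⇒flip₂ {suc zero} {suc zero} b≢c = contradiction refl b≢c

module Mate (n : ℕ) where

  mate : Fin (n ℕ.* 2) → Fin (n ℕ.* 2)
  mate i = combine (quotient {n} 2 i) (flip₂ (remainder {n} 2 i))

  quotient-mate : ∀ i → quotient {n} 2 (mate i) ≡ quotient {n} 2 i
  quotient-mate i = cong proj₁ (remQuot-combine (quotient {n} 2 i) (flip₂ (remainder {n} 2 i)))

  remainder-mate : ∀ i → remainder {n} 2 (mate i) ≡ flip₂ (remainder {n} 2 i)
  remainder-mate i = cong proj₂ (remQuot-combine (quotient {n} 2 i) (flip₂ (remainder {n} 2 i)))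

  mate-involutive : ∀ i → mate (mate i) ≡ i
  mate-involutive i = begin
    mate (mate i)
      ≡⟨ cong₂ (λ q r → combine q (flip₂ r)) (quotient-mate i) (remainder-mate i) ⟩
    combine (quotient {n} 2 i) (flip₂ (flip₂ (remainder {n} 2 i)))
      ≡⟨ cong (combine (quotient {n} 2 i)) (flip₂-involutive (remainder {n} 2 i)) ⟩
    combine (quotient {n} 2 i) (remainder {n} 2 i)
      ≡⟨ combine-remQuot {n} 2 i ⟩
    i ∎

  mate-≢ : ∀ i → i ≢ mate i
  mate-≢ i i≡ = flip₂-≢ (remainder {n} 2 i) (trans (cong (remainder {n} 2) i≡) (remainder-mate i))

  same-quotient : ∀ {i j} → i ≢ j → quotient {n} 2 i ≡ quotient {n} 2 j → j ≡ mate i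
  same-quotient {i} {j} i≢j q≡ = begin
    j                                              ≡⟨ combine-remQuot {n} 2 j ⟨
    combine (quotient {n} 2 j) (remainder {n} 2 j)
      ≡⟨ cong₂ combine (sym q≡) (≢⇒flip₂ λ r≡ → i≢j (trans (sym (combine-remQuot {n} 2 i))
           (trans (cong₂ combine q≡ r≡) (combine-remQuot {n} 2 j)))) ⟩
    mate i ∎

  δ-mate : ∀ i j → δ (mate i) j ≡ δ i (mate j)
  δ-mate i j with mate i ≟ j
  ... | yes refl = trans (δ-refl j) (sym (trans (cong (δ i) (mate-involutive i)) (δ-refl i)))
  ... | no m≢j   = trans (δ-≢ m≢j) (sym (δ-≢ λ i≡ → m≢j (trans (cong mate i≡) (mate-involutive j))))

module FriendshipMatrix (n : ℕ) where

  open Mate n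

  ν : ℤ
  ν = pos n

  F : Mat (suc (n ℕ.* 2))
  F = adjacencyℤ (friendship n)

  F₀₀ : F zero zero ≡ 0ℤ
  F₀₀ = adjacencyℤ-no (friendship n) id

  F₀ₛ : ∀ j → F zero (suc j) ≡ 1ℤ
  F₀ₛ j = adjacencyℤ-yes (friendship n) tt

  Fₛ₀ : ∀ i → F (suc i) zero ≡ 1ℤ
  Fₛ₀ i = adjacencyℤ-yes (friendship n) tt

  Fₛₛ : ∀ i j → F (suc i) (suc j) ≡ δ (mate i) j
  Fₛₛ i j with mate i ≟ j
  ... | yes refl = trans (adjacencyℤ-yes (friendship n) (mate-≢ i , sym (quotient-mate i))) (sym (δ-refl (mate i)))
  ... | no m≢j   = trans (adjacencyℤ-no (friendship n) λ (i≢j , q≡) → m≢j (sym (same-quotient i≢j q≡)))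
                         (sym (δ-≢ m≢j))

  ∑-size : ∑ {n ℕ.* 2} (λ _ → 1ℤ) ≡ ν * pos 2
  ∑-size = trans (∑-one (n ℕ.* 2)) (pos-* n 2)

  e : Fin (suc (n ℕ.* 2)) → ℤ
  e = δ zero

  e₀ : e zero ≡ 1ℤ
  e₀ = δ-refl zero

  eₛ : ∀ i → e (suc i) ≡ 0ℤ
  eₛ i = δ-≢ {i = zero} {j = suc i} λ ()

  -- The excess of the hub's diagonal entry 2n - 1 of F² - 1 over the value 1 of all other entries.
  s : ℤ
  s = pos 2 * ν - pos 2

  -- Two distinct vertices have exactly one common neighbour and rim vertices have degree 2, which
  -- gives the all-ones matrix with a correction at the hub.
  F²-1 : ∀ i j → (F ⊗ F) i j - δ i j ≡ 1ℤ + s * (e i * e j)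
  F²-1 zero zero = begin
    (F ⊗ F) zero zero - δ {suc (n ℕ.* 2)} zero zero
      ≡⟨ cong₂ _-_ (trans (∑-suc (λ k → F zero k * F k zero)) (cong₂ _+_ (cong₂ _*_ F₀₀ F₀₀)
           (trans (∑-cong λ k → cong₂ _*_ (F₀ₛ k) (Fₛ₀ k)) ∑-size))) (δ-refl zero) ⟩
    0ℤ * 0ℤ + ν * pos 2 - 1ℤ
      ≡⟨ alg ν ⟩
    1ℤ + s * (1ℤ * 1ℤ)
      ≡⟨ cong (λ x → 1ℤ + s * (x * x)) e₀ ⟨
    1ℤ + s * (e zero * e zero) ∎
    where
    alg : ∀ v → 0ℤ * 0ℤ + v * pos 2 - 1ℤ ≡ 1ℤ + (pos 2 * v - pos 2) * (1ℤ * 1ℤ)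
    alg = solve-∀
  F²-1 zero (suc j) = begin
    (F ⊗ F) zero (suc j) - δ zero (suc j)
      ≡⟨ cong₂ _-_ (trans (∑-suc (λ k → F zero k * F k (suc j))) (cong₂ _+_ (cong (_* F zero (suc j)) F₀₀)
           (trans (∑-cong λ k → cong₂ _*_ (F₀ₛ k) (trans (Fₛₛ k j) (δ-mate k j))) (δ-*ʳ (mate j) (λ _ → 1ℤ))))) (eₛ j) ⟩
    0ℤ * F zero (suc j) + 1ℤ - 0ℤ
      ≡⟨ alg (F zero (suc j)) s (e zero) ⟩
    1ℤ + s * (e zero * 0ℤ)
      ≡⟨ cong (λ x → 1ℤ + s * (e zero * x)) (eₛ j) ⟨
    1ℤ + s * (e zero * e (suc j)) ∎
    where
    alg : ∀ f s e → 0ℤ * f + 1ℤ - 0ℤ ≡ 1ℤ + s * (e * 0ℤ)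
    alg = solve-∀
  F²-1 (suc i) zero = begin
    (F ⊗ F) (suc i) zero - δ (suc i) zero
      ≡⟨ cong₂ _-_ (trans (∑-suc (λ k → F (suc i) k * F k zero)) (cong₂ _+_ (cong (F (suc i) zero *_) F₀₀)
           (trans (∑-cong λ k → cong₂ _*_ (Fₛₛ i k) (Fₛ₀ k)) (δ-*ˡ (mate i) (λ _ → 1ℤ))))) (δ-≢ {i = suc i} {j = zero} λ ()) ⟩
    F (suc i) zero * 0ℤ + 1ℤ - 0ℤ
      ≡⟨ alg (F (suc i) zero) s (e zero) ⟩
    1ℤ + s * (0ℤ * e zero)
      ≡⟨ cong (λ x → 1ℤ + s * (x * e zero)) (eₛ i) ⟨
    1ℤ + s * (e (suc i) * e zero) ∎
    where
    alg : ∀ f s e → f * 0ℤ + 1ℤ - 0ℤ ≡ 1ℤ + s * (0ℤ * e)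
    alg = solve-∀
  F²-1 (suc i) (suc j) = begin
    (F ⊗ F) (suc i) (suc j) - δ (suc i) (suc j)
      ≡⟨ cong₂ _-_ (trans (∑-suc (λ k → F (suc i) k * F k (suc j))) (cong₂ _+_ (cong₂ _*_ (Fₛ₀ i) (F₀ₛ j))
           (trans (∑-cong λ k → cong₂ _*_ (Fₛₛ i k) (Fₛₛ k j)) (trans (δ-*ˡ (mate i) (λ k → δ (mate k) j))
             (cong (λ k → δ k j) (mate-involutive i)))))) (δ-suc i j) ⟩
    1ℤ * 1ℤ + δ i j - δ i j
      ≡⟨ alg (δ i j) s (e (suc j)) ⟩
    1ℤ + s * (0ℤ * e (suc j))
      ≡⟨ cong (λ x → 1ℤ + s * (x * e (suc j))) (eₛ i) ⟨
    1ℤ + s * (e (suc i) * e (suc j)) ∎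
    where
    alg : ∀ d s e → 1ℤ * 1ℤ + d - d ≡ 1ℤ + s * (0ℤ * e)
    alg = solve-∀

  column-sum : ∀ j → (∑ λ k → F k j) ≡ pos 2 + s * e j
  column-sum zero = begin
    (∑ λ k → F k zero)     ≡⟨ trans (∑-suc (λ k → F k zero)) (cong₂ _+_ F₀₀ (trans (∑-cong Fₛ₀) ∑-size)) ⟩
    0ℤ + ν * pos 2         ≡⟨ alg ν ⟩
    pos 2 + s * 1ℤ         ≡⟨ cong (λ x → pos 2 + s * x) e₀ ⟨
    pos 2 + s * e zero     ∎
    where
    alg : ∀ v → 0ℤ + v * pos 2 ≡ pos 2 + (pos 2 * v - pos 2) * 1ℤ
    alg = solve-∀
  column-sum (suc j) = begin
    (∑ λ k → F k (suc j))  ≡⟨ trans (∑-suc (λ k → F k (suc j))) (cong₂ _+_ (F₀ₛ j)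
                                (trans (∑-cong λ k → trans (trans (Fₛₛ k j) (δ-mate k j)) (sym (*-identityˡ (δ k (mate j)))))
                                       (δ-*ʳ (mate j) (λ _ → 1ℤ)))) ⟩
    1ℤ + 1ℤ                ≡⟨ alg s ⟩
    pos 2 + s * 0ℤ         ≡⟨ cong (λ x → pos 2 + s * x) (eₛ j) ⟨
    pos 2 + s * e (suc j)  ∎
    where
    alg : ∀ s → 1ℤ + 1ℤ ≡ pos 2 + s * 0ℤ
    alg = solve-∀

  row₀ : ∀ j → F zero j ≡ 1ℤ - e j
  row₀ zero    = trans F₀₀ (sym (cong (λ x → 1ℤ - x) e₀))
  row₀ (suc j) = trans (F₀ₛ j) (sym (cong (λ x → 1ℤ - x) (eₛ j)))

  ∑-δˡ : ∀ (j : Fin (suc (n ℕ.* 2))) → (∑ λ k → δ k j) ≡ 1ℤ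
  ∑-δˡ j = trans (∑-cong λ k → sym (*-identityˡ (δ k j))) (δ-*ʳ j (λ _ → 1ℤ))

  -- Twice the number 3n of edges.
  F-tr : tr (F ⊗ F) ≡ pos 6 * ν
  F-tr = begin
    (∑ λ i → (F ⊗ F) i i)
      ≡⟨ ∑-cong (λ i → trans (alg ((F ⊗ F) i i) (δ i i)) (cong₂ _+_ (F²-1 i i) (δ-refl i))) ⟩
    (∑ λ i → (1ℤ + s * (e i * e i)) + 1ℤ)
      ≡⟨ ∑-cong (λ i → alg′ s (e i)) ⟩
    (∑ λ i → s * (e i * e i) + pos 2 * 1ℤ)
      ≡⟨ trans (∑-linear s (λ i → e i * e i) (λ _ → pos 2 * 1ℤ)) (cong₂ (λ x y → s * x + y)
           (trans (δ-*ˡ zero e) e₀)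
           (trans (sym (∑-*ˡ (pos 2) (λ _ → 1ℤ))) (cong (pos 2 *_) (trans (∑-suc (λ _ → 1ℤ)) (cong (1ℤ +_) ∑-size))))) ⟩
    s * 1ℤ + pos 2 * (1ℤ + ν * pos 2)
      ≡⟨ alg″ ν ⟩
    pos 6 * ν ∎
    where
    alg : ∀ x d → x ≡ (x - d) + d
    alg = solve-∀
    alg′ : ∀ s e → (1ℤ + s * (e * e)) + 1ℤ ≡ s * (e * e) + pos 2 * 1ℤ
    alg′ = solve-∀
    alg″ : ∀ v → (pos 2 * v - pos 2) * 1ℤ + pos 2 * (1ℤ + v * pos 2) ≡ pos 6 * v
    alg″ = solve-∀

-- The adjacency matrix of the friendship graph is a root of (x² − 1)(x² − x − 2n), which in terms
-- of c = x² − 1 is c (c − x − (2n − 1)).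
𝕔 : Poly
𝕔 = 𝕩 ⊛ 𝕩 ⊕ -1ℤ ⊙ 𝟙

𝕕 : ℕ → Poly
𝕕 n = 𝕔 ⊕ (-1ℤ ⊙ 𝕩 ⊕ (1ℤ - pos 2 * pos n) ⊙ 𝟙)

module _ (n : ℕ) where
  open FriendshipMatrix n

  C-friendship : ∀ i j → ⟦ 𝕔 ⟧ F i j ≡ 1ℤ + s * (e i * e j)
  C-friendship i j = trans (alg ((F ⊗ F) i j) (δ i j)) (F²-1 i j)
    where
    alg : ∀ a b → a + -1ℤ * b ≡ a - b
    alg = solve-∀

  -- By `C-friendship` an entry of the product is a column sum of D plus a multiple of the hub's
  -- entry in that column, and both are zero.
  CD-friendship : ∀ i j → ⟦ 𝕔 ⊛ 𝕕 n ⟧ F i j ≡ 0ℤ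
  CD-friendship i j = begin
    (∑ λ k → ⟦ 𝕔 ⟧ F i k * D k)
      ≡⟨ ∑-cong (λ k → trans (cong (_* D k) (C-friendship i k)) (alg s (e i) (e k) (D k))) ⟩
    (∑ λ k → s * e i * (e k * D k) + D k)
      ≡⟨ ∑-linear (s * e i) (λ k → e k * D k) D ⟩
    s * e i * (∑ λ k → e k * D k) + ∑ D
      ≡⟨ cong₂ (λ x y → s * e i * x + y) (trans (δ-*ˡ zero D) D₀) ∑D ⟩
    s * e i * 0ℤ + 0ℤ
      ≡⟨ alg′ (s * e i) ⟩
    0ℤ ∎
    where
    D : Fin (suc (n ℕ.* 2)) → ℤ
    D k = ⟦ 𝕕 n ⟧ F k j

    c : ℤ
    c = 1ℤ - pos 2 * ν

    alg : ∀ s e f d → (1ℤ + s * (e * f)) * d ≡ s * e * (f * d) + d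
    alg = solve-∀
    alg′ : ∀ x → x * 0ℤ + 0ℤ ≡ 0ℤ
    alg′ = solve-∀

    D₀ : D zero ≡ 0ℤ
    D₀ = begin
      ⟦ 𝕔 ⟧ F zero j + (-1ℤ * F zero j + c * e j)
        ≡⟨ cong₂ (λ x y → x + (-1ℤ * y + c * e j)) (C-friendship zero j) (row₀ j) ⟩
      (1ℤ + s * (e zero * e j)) + (-1ℤ * (1ℤ - e j) + c * e j)
        ≡⟨ cong (λ x → (1ℤ + s * (x * e j)) + (-1ℤ * (1ℤ - e j) + c * e j)) e₀ ⟩
      (1ℤ + s * (1ℤ * e j)) + (-1ℤ * (1ℤ - e j) + c * e j)
        ≡⟨ alg″ ν (e j) ⟩
      0ℤ ∎
      where
      alg″ : ∀ v x → (1ℤ + (pos 2 * v - pos 2) * (1ℤ * x)) + (-1ℤ * (1ℤ - x) + (1ℤ - pos 2 * v) * x) ≡ 0ℤ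
      alg″ = solve-∀

    ∑D : ∑ D ≡ 0ℤ
    ∑D = begin
      (∑ λ k → ⟦ 𝕔 ⟧ F k j + (-1ℤ * F k j + c * δ k j))
        ≡⟨ ∑-cong (λ k → trans (cong (_+ (-1ℤ * F k j + c * δ k j)) (C-friendship k j)) (alg″ s (e k) (e j) (F k j) c (δ k j))) ⟩
      (∑ λ k → s * e j * (e k * 1ℤ) + (-1ℤ * F k j + (c * δ k j + 1ℤ)))
        ≡⟨ trans (∑-linear (s * e j) (λ k → e k * 1ℤ) _) (cong₂ (λ x y → s * e j * x + y) (δ-*ˡ zero (λ _ → 1ℤ))
             (trans (∑-linear -1ℤ (λ k → F k j) _) (cong₂ (λ x y → -1ℤ * x + y) (column-sum j)
               (trans (∑-linear c (λ k → δ k j) (λ _ → 1ℤ)) (cong₂ (λ x y → c * x + y) (∑-δˡ j)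
                 (trans (∑-suc (λ _ → 1ℤ)) (cong (1ℤ +_) ∑-size))))))) ⟩
      s * e j * 1ℤ + (-1ℤ * (pos 2 + s * e j) + (c * 1ℤ + (1ℤ + ν * pos 2)))
        ≡⟨ alg‴ s (e j) ν ⟩
      0ℤ ∎
      where
      alg″ : ∀ s e f a c d → (1ℤ + s * (e * f)) + (-1ℤ * a + c * d) ≡ s * f * (e * 1ℤ) + (-1ℤ * a + (c * d + 1ℤ))
      alg″ = solve-∀
      alg‴ : ∀ s f v → s * f * 1ℤ + (-1ℤ * (pos 2 + s * f) + ((1ℤ - pos 2 * v) * 1ℤ + (1ℤ + v * pos 2))) ≡ 0ℤ
      alg‴ = solve-∀

  -- The matrix is a sum of two matrices of rank at most one, the all-ones matrix and the correction
  -- at the hub; after substitution this is a polynomial identity.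
  minors-friendship : ∀ i j k p q r → minor₃ (⟦ 𝕔 ⟧ F) i j k p q r ≡ 0ℤ
  minors-friendship i j k p q r
    rewrite C-friendship i p | C-friendship i q | C-friendship i r
          | C-friendship j p | C-friendship j q | C-friendship j r
          | C-friendship k p | C-friendship k q | C-friendship k r
    = alg s (e i) (e j) (e k) (e p) (e q) (e r)
    where
    alg : ∀ s i j k p q r →
      (1ℤ + s * (i * p)) * ((1ℤ + s * (j * q)) * (1ℤ + s * (k * r)) - (1ℤ + s * (j * r)) * (1ℤ + s * (k * q))) -
      (1ℤ + s * (i * q)) * ((1ℤ + s * (j * p)) * (1ℤ + s * (k * r)) - (1ℤ + s * (j * r)) * (1ℤ + s * (k * p))) +
      (1ℤ + s * (i * r)) * ((1ℤ + s * (j * p)) * (1ℤ + s * (k * q)) - (1ℤ + s * (j * q)) * (1ℤ + s * (k * p))) ≡ 0ℤ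
    alg = solve-∀

-- Transfer of the relations to G

⊗-transpose : ∀ (X Y : Mat n) → (∀ i j → X i j ≡ X j i) → (∀ i j → Y i j ≡ Y j i) → ∀ i j → (X ⊗ Y) i j ≡ (Y ⊗ X) j i
⊗-transpose X Y X-sym Y-sym i j = ∑-cong λ k → trans (cong₂ _*_ (X-sym i k) (Y-sym k j)) (*-comm (X k i) (Y j k))

module SpectralFacts (n : ℕ) (G : Graph (suc (n ℕ.* 2)))
  (pencils : ∀ t → det (1+ t · adjacencyℤ G) ≡ det (1+ t · adjacencyℤ (friendship n))) where

  A : Mat (suc (n ℕ.* 2))
  A = adjacencyℤ G

  C : Mat (suc (n ℕ.* 2))
  C = ⟦ 𝕔 ⟧ A

  D : Mat (suc (n ℕ.* 2))
  D = ⟦ 𝕕 n ⟧ A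

  open FriendshipMatrix n using (F; F-tr; ν)

  traces : ∀ p → tr (⟦ p ⟧ A) ≡ tr (⟦ p ⟧ F)
  traces = poly-traces (Traces.power-traces pencils)

  C-sym′ : ∀ (H : Graph (suc (n ℕ.* 2))) i j → ⟦ 𝕔 ⟧ (adjacencyℤ H) i j ≡ ⟦ 𝕔 ⟧ (adjacencyℤ H) j i
  C-sym′ H i j = cong₂ (λ x y → x + -1ℤ * y)
    (⊗-transpose (adjacencyℤ H) (adjacencyℤ H) (adjacencyℤ-sym H) (adjacencyℤ-sym H) i j) (δ-sym i j)

  C-sym : ∀ i j → C i j ≡ C j i
  C-sym = C-sym′ G

  D-sym : ∀ i j → D i j ≡ D j i
  D-sym i j = cong₂ _+_ (C-sym i j)
    (cong₂ (λ x y → -1ℤ * x + (1ℤ - pos 2 * ν) * y) (adjacencyℤ-sym G i j) (δ-sym i j))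

  edges : tr (A ⊗ A) ≡ pos 6 * ν
  edges = trans (traces (𝕩 ⊛ 𝕩)) F-tr

  -- Both factors are symmetric, so D C is the transpose of C D, and the sum of the squared entries
  -- of C D is the trace of a polynomial in A, evaluated on the friendship graph.
  CD≡0 : ∀ i j → (C ⊗ D) i j ≡ 0ℤ
  CD≡0 = ∑-squares≡0⇒≡0 (C ⊗ D) (begin
    (∑ λ i → ∑ λ j → (C ⊗ D) i j * (C ⊗ D) i j)
      ≡⟨ ∑-cong (λ i → ∑-cong λ j → cong ((C ⊗ D) i j *_) (⊗-transpose C D C-sym D-sym i j)) ⟩
    tr (⟦ (𝕔 ⊛ 𝕕 n) ⊛ (𝕕 n ⊛ 𝕔) ⟧ A)
      ≡⟨ traces ((𝕔 ⊛ 𝕕 n) ⊛ (𝕕 n ⊛ 𝕔)) ⟩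
    tr (⟦ (𝕔 ⊛ 𝕕 n) ⊛ (𝕕 n ⊛ 𝕔) ⟧ F)
      ≡⟨ ∑-zero (λ i → ∑-zero λ k → cong (_* ⟦ 𝕕 n ⊛ 𝕔 ⟧ F k i) (CD-friendship n i k)) ⟩
    0ℤ ∎)

  -- `squared-minors-traces` serves twice: it leads from G to traces, and from the same traces back
  -- to the minors of the friendship graph.
  minors≡0 : ∀ i j k p q r → minor₃ C i j k p q r ≡ 0ℤ
  minors≡0 = squared-minors≡0⇒minor₃≡0 C (begin
    squared-minors C
      ≡⟨ squared-minors-traces C C-sym ⟩
    f (tr (⟦ 𝕪 ⟧ A)) (tr (⟦ 𝕪 ⊛ 𝕪 ⟧ A)) (tr (⟦ 𝕪 ⊛ 𝕪 ⊛ 𝕪 ⟧ A))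
      ≡⟨ cong₂ (λ a (b , c) → f a b c) (traces 𝕪) (cong₂ _,_ (traces (𝕪 ⊛ 𝕪)) (traces (𝕪 ⊛ 𝕪 ⊛ 𝕪))) ⟩
    f (tr (⟦ 𝕪 ⟧ F)) (tr (⟦ 𝕪 ⊛ 𝕪 ⟧ F)) (tr (⟦ 𝕪 ⊛ 𝕪 ⊛ 𝕪 ⟧ F))
      ≡⟨ squared-minors-traces (⟦ 𝕔 ⟧ F) (C-sym′ (friendship n)) ⟨
    squared-minors (⟦ 𝕔 ⟧ F)
      ≡⟨ ∑-zero (λ i → ∑-zero λ j → ∑-zero λ k → ∑-zero λ p → ∑-zero λ q → ∑-zero λ r →
           cong (λ x → x * x) (minors-friendship n i j k p q r)) ⟩
    0ℤ ∎)
    where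
    𝕪 = 𝕔 ⊛ 𝕔
    f : ℤ → ℤ → ℤ → ℤ
    f a b c = pos 6 * (a * a * a - pos 3 * (a * b) + pos 2 * c)

  -- C D = 0 solved for C². As C is symmetric, the diagonal entries express the squared norms of its
  -- rows by local counts.
  C²≡CA+ : ∀ i j → (C ⊗ C) i j ≡ (C ⊗ A) i j + (pos 2 * ν - 1ℤ) * C i j
  C²≡CA+ i j = begin
    (C ⊗ C) i j
      ≡⟨ ∑-cong (λ k → alg (C i k) (C k j) (A k j) ν (δ k j)) ⟩
    (∑ λ k → 1ℤ * (C i k * D k j) + (1ℤ * (C i k * A k j) + (pos 2 * ν - 1ℤ) * (C i k * δ k j)))
      ≡⟨ trans (∑-linear 1ℤ (λ k → C i k * D k j) _) (cong₂ (λ x y → 1ℤ * x + y) (CD≡0 i j)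
           (trans (∑-linear 1ℤ (λ k → C i k * A k j) _) (cong (1ℤ * (C ⊗ A) i j +_)
             (trans (sym (∑-*ˡ (pos 2 * ν - 1ℤ) (λ k → C i k * δ k j))) (cong ((pos 2 * ν - 1ℤ) *_) (δ-*ʳ j (C i))))))) ⟩
    1ℤ * 0ℤ + (1ℤ * (C ⊗ A) i j + (pos 2 * ν - 1ℤ) * C i j)
      ≡⟨ alg′ ((C ⊗ A) i j) ((pos 2 * ν - 1ℤ) * C i j) ⟩
    (C ⊗ A) i j + (pos 2 * ν - 1ℤ) * C i j ∎
    where
    alg : ∀ x c a v d → x * c ≡ 1ℤ * (x * (c + (-1ℤ * a + (1ℤ - pos 2 * v) * d))) + (1ℤ * (x * a) + (pos 2 * v - 1ℤ) * (x * d))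
    alg = solve-∀
    alg′ : ∀ a b → 1ℤ * 0ℤ + (1ℤ * a + b) ≡ a + b
    alg′ = solve-∀

  AC≡CA : ∀ i j → (A ⊗ C) i j ≡ (C ⊗ A) i j
  AC≡CA i j = begin
    (∑ λ k → A i k * ((A ⊗ A) k j + -1ℤ * δ k j))
      ≡⟨ ∑-cong (λ k → alg (A i k) ((A ⊗ A) k j) (δ k j)) ⟩
    (∑ λ k → -1ℤ * (A i k * δ k j) + A i k * (A ⊗ A) k j)
      ≡⟨ trans (∑-linear -1ℤ (λ k → A i k * δ k j) _) (cong₂ (λ x y → -1ℤ * x + y)
           (trans (δ-*ʳ j (A i)) (sym (δ-*ˡ i (λ k → A k j)))) (sym (⊗-assoc A A A i j))) ⟩
    -1ℤ * (∑ λ k → δ i k * A k j) + (A ⊗ A ⊗ A) i j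
      ≡⟨ ∑-linear -1ℤ (λ k → δ i k * A k j) (λ k → (A ⊗ A) i k * A k j) ⟨
    (∑ λ k → -1ℤ * (δ i k * A k j) + (A ⊗ A) i k * A k j)
      ≡⟨ ∑-cong (λ k → alg′ (A k j) ((A ⊗ A) i k) (δ i k)) ⟩
    (C ⊗ A) i j ∎
    where
    alg : ∀ a q d → a * (q + -1ℤ * d) ≡ -1ℤ * (a * d) + a * q
    alg = solve-∀
    alg′ : ∀ a q d → -1ℤ * (d * a) + q * a ≡ (q + -1ℤ * d) * a
    alg′ = solve-∀

-- The structure of a C₅-free cospectral mate

ZeroOne : (Fin n → ℤ) → Set
ZeroOne g = ∀ k → g k ≡ 0ℤ ⊎ g k ≡ 1ℤ

ZeroOne-nonneg : ∀ {a} → a ≡ 0ℤ ⊎ a ≡ 1ℤ → 0ℤ ≤ a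
ZeroOne-nonneg (inj₁ refl) = +≤+ z≤n
ZeroOne-nonneg (inj₂ refl) = +≤+ z≤n

ZeroOne-remove : ∀ {g : Fin n → ℤ} {x} → ZeroOne g → g x ≡ 1ℤ → ZeroOne (λ k → g k - δ x k)
ZeroOne-remove {g = g} {x} g01 gx≡1 k with x ≟ k
... | yes refl = inj₁ (cong₂ _-_ gx≡1 (δ-refl x))
... | no x≢k with g01 k
...   | inj₁ gk≡0 = inj₁ (cong₂ _-_ gk≡0 (δ-≢ x≢k))
...   | inj₂ gk≡1 = inj₂ (cong₂ _-_ gk≡1 (δ-≢ x≢k))

∑-remove-δ : ∀ (g : Fin n → ℤ) x → (∑ λ k → g k - δ x k) ≡ ∑ g - 1ℤ
∑-remove-δ g x = begin
  (∑ λ k → g k - δ x k)              ≡⟨ ∑-cong (λ k → alg (g k) (δ x k)) ⟩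
  (∑ λ k → -1ℤ * (δ x k * 1ℤ) + g k) ≡⟨ ∑-linear -1ℤ (λ k → δ x k * 1ℤ) g ⟩
  -1ℤ * (∑ λ k → δ x k * 1ℤ) + ∑ g   ≡⟨ cong (λ z → -1ℤ * z + ∑ g) (δ-*ˡ x (λ _ → 1ℤ)) ⟩
  -1ℤ * 1ℤ + ∑ g                     ≡⟨ alg′ (∑ g) ⟩
  ∑ g - 1ℤ                           ∎
  where
  alg : ∀ g d → g - d ≡ -1ℤ * (d * 1ℤ) + g
  alg = solve-∀
  alg′ : ∀ s → -1ℤ * 1ℤ + s ≡ s - 1ℤ
  alg′ = solve-∀

∑≢0⇒∃one : ∀ {g : Fin n → ℤ} → ZeroOne g → ∑ g ≢ 0ℤ → ∃[ x ] g x ≡ 1ℤ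
∑≢0⇒∃one {g = g} g01 ∑≢0 with any? (λ x → g x ℤ.≟ 1ℤ)
... | yes found = found
... | no none   = contradiction (∑-zero λ k → [ id , (λ gk≡1 → contradiction (k , gk≡1) none) ]′ (g01 k)) ∑≢0

1≢0 : 1ℤ ≢ 0ℤ
1≢0 ()

2≢0 : pos 2 ≢ 0ℤ
2≢0 ()

-- Subtracting `δ` at a position of value 1 leaves a nonnegative function with sum zero.
∑≡1⇒δ : ∀ {g : Fin n → ℤ} → ZeroOne g → ∑ g ≡ 1ℤ → ∃[ x ] (∀ k → g k ≡ δ x k)
∑≡1⇒δ {n} {g} g01 ∑≡1 = x , λ k → i-j≡0⇒i≡j (g k) (δ x k) (∑≡0⇒≡0 nonneg ∑≡0 k)
  where
  found : ∃[ x ] g x ≡ 1ℤ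
  found = ∑≢0⇒∃one g01 (λ ∑≡0 → 1≢0 (trans (sym ∑≡1) ∑≡0))
  x = proj₁ found
  nonneg : ∀ k → 0ℤ ≤ g k - δ x k
  nonneg k = ZeroOne-nonneg (ZeroOne-remove {g = g} g01 (proj₂ found) k)
  ∑≡0 : (∑ λ k → g k - δ x k) ≡ 0ℤ
  ∑≡0 = trans (∑-remove-δ g x) (cong (_- 1ℤ) ∑≡1)

∑≡2⇒δ+δ : ∀ {g : Fin n → ℤ} → ZeroOne g → ∑ g ≡ pos 2 → ∃[ x ] ∃[ y ] (x ≢ y × (∀ k → g k ≡ δ x k + δ y k))
∑≡2⇒δ+δ {n} {g} g01 ∑≡2 = x , y , x≢y , λ k → trans (alg (g k) (δ x k)) (cong (δ x k +_) (proj₂ rest k))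
  where
  found : ∃[ x ] g x ≡ 1ℤ
  found = ∑≢0⇒∃one g01 (λ ∑≡0 → 2≢0 (trans (sym ∑≡2) ∑≡0))
  x = proj₁ found
  rest : ∃[ y ] (∀ k → g k - δ x k ≡ δ y k)
  rest = ∑≡1⇒δ (ZeroOne-remove {g = g} g01 (proj₂ found)) (trans (∑-remove-δ g x) (cong (_- 1ℤ) ∑≡2))
  y = proj₁ rest
  alg : ∀ g d → g ≡ d + (g - d)
  alg = solve-∀
  x≢y : x ≢ y
  x≢y x≡y = 1≢0 (trans (sym (δ-refl y)) (trans (cong (δ y) (sym x≡y))
    (trans (sym (proj₂ rest x)) (cong₂ _-_ (proj₂ found) (δ-refl x)))))

∑-δ+δ : ∀ (x y : Fin n) {g : Fin n → ℤ} (f : Fin n → ℤ) → (∀ k → g k ≡ δ x k + δ y k) → (∑ λ k → g k * f k) ≡ f x + f y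
∑-δ+δ x y {g} f g≡ = begin
  (∑ λ k → g k * f k)                             ≡⟨ ∑-cong (λ k → trans (cong (_* f k) (g≡ k)) (alg (δ x k) (δ y k) (f k))) ⟩
  (∑ λ k → δ x k * f k + δ y k * f k)             ≡⟨ ∑-+ (λ k → δ x k * f k) (λ k → δ y k * f k) ⟩
  (∑ λ k → δ x k * f k) + (∑ λ k → δ y k * f k)   ≡⟨ cong₂ _+_ (δ-*ˡ x f) (δ-*ˡ y f) ⟩
  f x + f y                                       ∎
  where
  alg : ∀ a b f → (a + b) * f ≡ a * f + b * f
  alg = solve-∀

0≰negative : ∀ {a} m → 0ℤ ≤ a → a ≢ -[1+ m ]
0≰negative m 0≤a refl with 0≤a
... | ()

module Adjacency (G : Graph n) where

  open Graph G using (_~_; _~?_; ~-sym; ~-irrefl)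

  A : Mat n
  A = adjacencyℤ G

  -- Common-neighbour counts off the diagonal and, by `degree`, degrees on it.
  Q : Mat n
  Q = A ⊗ A

  A-sym : ∀ i j → A i j ≡ A j i
  A-sym = adjacencyℤ-sym G

  A01 : ∀ i j → A i j ≡ 0ℤ ⊎ A i j ≡ 1ℤ
  A01 i j with i ~? j
  ... | yes i~j = inj₂ (adjacencyℤ-yes G i~j)
  ... | no i≁j  = inj₁ (adjacencyℤ-no G i≁j)

  A-diag : ∀ i → A i i ≡ 0ℤ
  A-diag i = adjacencyℤ-no G ~-irrefl

  A≡1⇒~ : ∀ {i j} → A i j ≡ 1ℤ → i ~ j
  A≡1⇒~ {i} {j} A≡1 with i ~? j
  ... | yes i~j = i~j
  ... | no i≁j  = contradiction (trans (sym A≡1) (adjacencyℤ-no G i≁j)) λ ()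

  ~⇒A≡1 : ∀ {i j} → i ~ j → A i j ≡ 1ℤ
  ~⇒A≡1 = adjacencyℤ-yes G

  A≡1⇒≢ : ∀ {i j} → A i j ≡ 1ℤ → i ≢ j
  A≡1⇒≢ {i} A≡1 refl = contradiction (trans (sym A≡1) (A-diag i)) λ ()

  A≢1⇒≡0 : ∀ {i j} → A i j ≢ 1ℤ → A i j ≡ 0ℤ
  A≢1⇒≡0 {i} {j} A≢1 = [ id , (λ A≡1 → contradiction A≡1 A≢1) ]′ (A01 i j)

  A≡1⇒≢0 : ∀ {i j} → A i j ≡ 1ℤ → A i j ≢ 0ℤ
  A≡1⇒≢0 A≡1 A≡0 = contradiction (trans (sym A≡1) A≡0) λ ()

  A-nonneg : ∀ i j → 0ℤ ≤ A i j
  A-nonneg i j = ZeroOne-nonneg (A01 i j)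

  A*A-nonneg : ∀ i j k l → 0ℤ ≤ A i j * A k l
  A*A-nonneg i j k l with A01 i j | A01 k l
  ... | inj₁ p | _      = ≤-reflexive (sym (cong (_* A k l) p))
  ... | inj₂ p | inj₁ q = ≤-reflexive (sym (cong₂ _*_ p q))
  ... | inj₂ p | inj₂ q = ≤-trans (+≤+ (z≤n {1})) (≤-reflexive (sym (cong₂ _*_ p q)))

  Q-nonneg : ∀ i j → 0ℤ ≤ Q i j
  Q-nonneg i j = ∑-nonneg λ k → A*A-nonneg i k k j

  degree : ∀ i → ∑ (A i) ≡ Q i i
  degree i = ∑-cong λ k → trans (square (A01 i k)) (cong (A i k *_) (A-sym i k))
    where
    square : ∀ {a} → a ≡ 0ℤ ⊎ a ≡ 1ℤ → a ≡ a * a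
    square (inj₁ refl) = refl
    square (inj₂ refl) = refl

  1≤Q : ∀ {i k j} → A i k ≡ 1ℤ → A k j ≡ 1ℤ → 0ℤ ≤ Q i j - 1ℤ
  1≤Q {i} {k} {j} ik kj = ≤-trans (∑-nonneg nonneg) (≤-reflexive (∑-remove-δ (λ l → A i l * A l j) k))
    where
    nonneg : ∀ l → 0ℤ ≤ A i l * A l j - δ k l
    nonneg l with k ≟ l
    ... | yes refl = ≤-reflexive (sym (cong₂ _-_ (cong₂ _*_ ik kj) (δ-refl k)))
    ... | no k≢l   = ≤-trans (A*A-nonneg i l l j)
      (≤-reflexive (sym (trans (cong (λ d → A i l * A l j - d) (δ-≢ k≢l)) (+-identityʳ (A i l * A l j)))))

  C₅-free⇒no-5-cycle : ¬ (C₅ ⊑ G) → ∀ {a b c d e} →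
    A a b ≡ 1ℤ → A b c ≡ 1ℤ → A c d ≡ 1ℤ → A d e ≡ 1ℤ → A e a ≡ 1ℤ →
    a ≢ c → a ≢ d → b ≢ d → b ≢ e → c ≢ e → ⊥
  C₅-free⇒no-5-cycle C₅-free {a} {b} {c} {d} {e} ab bc cd de ea a≢c a≢d b≢d b≢e c≢e =
    C₅-free (f , (λ {i} {j} → injective i j) , λ {i} {j} → edge i j)
    where
    f : Fin 5 → Fin n
    f 0F = a
    f 1F = b
    f 2F = c
    f 3F = d
    f 4F = e

    injective : ∀ i j → f i ≡ f j → i ≡ j
    injective 0F 0F _  = refl
    injective 0F 1F eq = contradiction eq (A≡1⇒≢ ab)
    injective 0F 2F eq = contradiction eq a≢c
    injective 0F 3F eq = contradiction eq a≢d
    injective 0F 4F eq = contradiction (sym eq) (A≡1⇒≢ ea)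
    injective 1F 0F eq = contradiction (sym eq) (A≡1⇒≢ ab)
    injective 1F 1F _  = refl
    injective 1F 2F eq = contradiction eq (A≡1⇒≢ bc)
    injective 1F 3F eq = contradiction eq b≢d
    injective 1F 4F eq = contradiction eq b≢e
    injective 2F 0F eq = contradiction (sym eq) a≢c
    injective 2F 1F eq = contradiction (sym eq) (A≡1⇒≢ bc)
    injective 2F 2F _  = refl
    injective 2F 3F eq = contradiction eq (A≡1⇒≢ cd)
    injective 2F 4F eq = contradiction eq c≢e
    injective 3F 0F eq = contradiction (sym eq) a≢d
    injective 3F 1F eq = contradiction (sym eq) b≢d
    injective 3F 2F eq = contradiction (sym eq) (A≡1⇒≢ cd)
    injective 3F 3F _  = refl
    injective 3F 4F eq = contradiction eq (A≡1⇒≢ de)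
    injective 4F 0F eq = contradiction eq (A≡1⇒≢ ea)
    injective 4F 1F eq = contradiction (sym eq) b≢e
    injective 4F 2F eq = contradiction (sym eq) c≢e
    injective 4F 3F eq = contradiction (sym eq) (A≡1⇒≢ de)
    injective 4F 4F _  = refl

    next : ∀ i j → j ≡ suc (toℕ i) mod 5 → f i ~ f j
    next 0F _ refl = A≡1⇒~ ab
    next 1F _ refl = A≡1⇒~ bc
    next 2F _ refl = A≡1⇒~ cd
    next 3F _ refl = A≡1⇒~ de
    next 4F _ refl = A≡1⇒~ ea

    edge : ∀ i j → Graph._~_ C₅ i j → f i ~ f j
    edge i j (inj₁ j≡) = next i j j≡
    edge i j (inj₂ i≡) = ~-sym (next j i i≡)

  module _ (connected : Connected G) where

    closed⇒everything : ∀ (S : Fin n → Set) → (∀ {j k} → S j → j ~ k → S k) → ∀ {i} → S i → ∀ j → S j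
    closed⇒everything S step {i} Si j = go Si (connected i j)
      where
      go : ∀ {i} → S i → Star _~_ i j → S j
      go Si ε        = Si
      go Si (e ◅ es) = go (step Si e) es

-- Degrees and neighbourhoods in G

module LocalStructure (n : ℕ) (1≤n : 1 ℕ.≤ n) (G : Graph (suc (n ℕ.* 2))) (connected : Connected G) (C₅-free : ¬ (C₅ ⊑ G))
  (pencils : ∀ t → det (1+ t · adjacencyℤ G) ≡ det (1+ t · adjacencyℤ (friendship n))) where

  open Graph G using (_~_)
  open Adjacency G
  open SpectralFacts n G pencils using (C; C-sym; edges; minors≡0; C²≡CA+; AC≡CA)

  N : ℕ
  N = suc (n ℕ.* 2)

  ν : ℤ
  ν = pos n

  C-≢ : ∀ {i j} → i ≢ j → C i j ≡ Q i j
  C-≢ {i} {j} i≢j = trans (cong (λ d → Q i j + -1ℤ * d) (δ-≢ i≢j)) (+-identityʳ (Q i j))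

  C-diag : ∀ i → C i i ≡ Q i i - 1ℤ
  C-diag i = cong (λ d → Q i i + -1ℤ * d) (δ-refl i)

  3≤N : 3 ℕ.≤ N
  3≤N = s≤s (ℕ.*-monoˡ-≤ 2 1≤n)

  -- As n ≥ 1 there are at least three vertices; this refutes components consisting of one vertex or
  -- one edge.
  two-values-≢ : ∀ (p q : Fin N) → ¬ (∀ j → j ≡ p ⊎ j ≡ q)
  two-values-≢ p q all = collide (pigeonhole 3≤N colour)
    where
    colour : Fin N → Fin 2
    colour j = [ (λ _ → 0F) , (λ _ → 1F) ]′ (all j)
    colour-injective : ∀ i j → colour i ≡ colour j → i ≡ j
    colour-injective i j eq with all i | all j
    ... | inj₁ i≡p | inj₁ j≡p = trans i≡p (sym j≡p)
    ... | inj₂ i≡q | inj₂ j≡q = trans i≡q (sym j≡q)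
    ... | inj₁ _   | inj₂ _   = contradiction eq λ ()
    ... | inj₂ _   | inj₁ _   = contradiction eq λ ()
    collide : ¬ (∃[ i ] ∃[ j ] (i Fin.< j × colour i ≡ colour j))
    collide (i , j , i<j , eq) = <⇒≢ i<j (colour-injective i j eq)

  degree≢0 : ∀ i → Q i i ≢ 0ℤ
  degree≢0 i Q≡0 = two-values-≢ i i λ j → inj₁ (closed⇒everything connected (_≡ i)
    (λ { refl i~k → contradiction (∑≡0⇒≡0 (A-nonneg i) (trans (degree i) Q≡0) _) (A≡1⇒≢0 (~⇒A≡1 i~k)) }) refl j)

  -- For a vertex i with sole neighbour p, C i i = 0, so the relation for C² makes the squared norm
  -- of row i of C equal to C p i, which is A p p = 0. The vanishing row leaves p with no neighbour
  -- but i, and the edge i p would be the whole graph.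
  degree≢1 : ∀ i → Q i i ≢ 1ℤ
  degree≢1 i Q≡1 = two-values-≢ i p (closed⇒everything connected (λ j → j ≡ i ⊎ j ≡ p) step (inj₁ refl))
    where
    neighbour : ∃[ p ] (∀ k → A i k ≡ δ p k)
    neighbour = ∑≡1⇒δ (A01 i) (trans (degree i) Q≡1)
    p = proj₁ neighbour
    row : ∀ k → A i k ≡ δ p k
    row = proj₂ neighbour

    ip : A i p ≡ 1ℤ
    ip = trans (row p) (δ-refl p)

    ∑-row : ∀ f → (∑ λ k → A i k * f k) ≡ f p
    ∑-row f = trans (∑-cong λ k → cong (_* f k) (row k)) (δ-*ˡ p f)

    C-row : ∀ k → C i k ≡ 0ℤ
    C-row k = i*i≡0⇒i≡0 (C i k) (∑≡0⇒≡0 (λ k → 0≤i*i (C i k)) (begin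
      (∑ λ k → C i k * C i k)                        ≡⟨ ∑-cong (λ k → cong (C i k *_) (C-sym i k)) ⟩
      (∑ λ k → C i k * C k i)                        ≡⟨ C²≡CA+ i i ⟩
      (∑ λ k → C i k * A k i) + (pos 2 * ν - 1ℤ) * C i i
        ≡⟨ cong₂ _+_ (sym (AC≡CA i i)) (trans (cong ((pos 2 * ν - 1ℤ) *_) (trans (C-diag i) (cong (_- 1ℤ) Q≡1))) (*-zeroʳ (pos 2 * ν - 1ℤ))) ⟩
      (∑ λ k → A i k * C k i) + 0ℤ                   ≡⟨ +-identityʳ (∑ λ k → A i k * C k i) ⟩
      (∑ λ k → A i k * C k i)                        ≡⟨ ∑-row (λ k → C k i) ⟩
      C p i                                          ≡⟨ trans (C-sym p i) (C-≢ (A≡1⇒≢ ip)) ⟩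
      (∑ λ k → A i k * A k p)                        ≡⟨ ∑-row (λ k → A k p) ⟩
      A p p                                          ≡⟨ A-diag p ⟩
      0ℤ                                             ∎) k)

    p-row : ∀ {k} → i ≢ k → A p k ≡ 0ℤ
    p-row {k} i≢k = trans (sym (∑-row (λ l → A l k))) (trans (sym (C-≢ i≢k)) (C-row k))

    step : ∀ {j k} → j ≡ i ⊎ j ≡ p → j ~ k → k ≡ i ⊎ k ≡ p
    step {j} {k} (inj₁ refl) i~k with p ≟ k
    ... | yes refl = inj₂ refl
    ... | no p≢k   = contradiction (trans (row k) (δ-≢ p≢k)) (A≡1⇒≢0 (~⇒A≡1 i~k))
    step {j} {k} (inj₂ refl) p~k with i ≟ k
    ... | yes refl = inj₁ refl
    ... | no i≢k   = contradiction (p-row i≢k) (A≡1⇒≢0 (~⇒A≡1 p~k))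

  2≤degree : ∀ i → 0ℤ ≤ Q i i - pos 2
  2≤degree i = bound (Q i i) (Q-nonneg i i) (degree≢0 i) (degree≢1 i)
    where
    bound : ∀ q → 0ℤ ≤ q → q ≢ 0ℤ → q ≢ 1ℤ → 0ℤ ≤ q - pos 2
    bound (pos 0)             _ q≢0 _   = contradiction refl q≢0
    bound (pos 1)             _ _   q≢1 = contradiction refl q≢1
    bound (pos (suc (suc m))) _ _   _   = +≤+ z≤n

  ∑-ones : ∑ {N} (λ _ → 1ℤ) ≡ 1ℤ + pos 2 * ν
  ∑-ones = trans (∑-one N) (cong (1ℤ +_) (trans (pos-* n 2) (*-comm ν (pos 2))))

  -- If all degrees were at least 3, the sum of degree - 3 would be nonnegative, yet it is 6n - 3
  -- (2n + 1) = -3.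
  ∃degree≡2 : ∃[ u ] Q u u ≡ pos 2
  ∃degree≡2 with any? (λ u → Q u u ℤ.≟ pos 2)
  ... | yes found = found
  ... | no none   = ⊥-elim (0≰negative 2 (∑-nonneg λ i → bound (Q i i) (2≤degree i) (λ eq → none (i , eq))) total)
    where
    bound : ∀ q → 0ℤ ≤ q - pos 2 → q ≢ pos 2 → 0ℤ ≤ -[1+ 2 ] * 1ℤ + q
    bound (pos 2)                   _  q≢2 = contradiction refl q≢2
    bound (pos (suc (suc (suc m)))) _  _   = +≤+ z≤n
    alg : ∀ v → -[1+ 2 ] * (1ℤ + pos 2 * v) + pos 6 * v ≡ -[1+ 2 ]
    alg = solve-∀
    total : (∑ λ i → -[1+ 2 ] * 1ℤ + Q i i) ≡ -[1+ 2 ]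
    total = begin
      (∑ λ i → -[1+ 2 ] * 1ℤ + Q i i)          ≡⟨ ∑-linear -[1+ 2 ] (λ _ → 1ℤ) (λ i → Q i i) ⟩
      -[1+ 2 ] * ∑ {N} (λ _ → 1ℤ) + tr Q       ≡⟨ cong₂ (λ a b → -[1+ 2 ] * a + b) ∑-ones edges ⟩
      -[1+ 2 ] * (1ℤ + pos 2 * ν) + pos 6 * ν  ≡⟨ alg ν ⟩
      -[1+ 2 ]                                 ∎

  -- For a vertex u of degree 2 with neighbours x and y the matrix C has C u u = 1, so the vanishing
  -- 3×3 minors through (u , u) say that C i j − C i u · C u j has rank at most one.
  module DegreeTwo {u x y : Fin N} (x≢y : x ≢ y) (row : ∀ k → A u k ≡ δ x k + δ y k) where

    ∑-row : ∀ f → (∑ λ k → A u k * f k) ≡ f x + f y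
    ∑-row f = ∑-δ+δ x y f row

    ux : A u x ≡ 1ℤ
    ux = trans (row x) (cong₂ _+_ (δ-refl x) (δ-≢ (x≢y ∘ sym)))

    uy : A u y ≡ 1ℤ
    uy = trans (row y) (cong₂ _+_ (δ-≢ x≢y) (δ-refl y))

    xu : A x u ≡ 1ℤ
    xu = trans (A-sym x u) ux

    yu : A y u ≡ 1ℤ
    yu = trans (A-sym y u) uy

    u≢x : u ≢ x
    u≢x = A≡1⇒≢ ux

    u≢y : u ≢ y
    u≢y = A≡1⇒≢ uy

    other : ∀ {k} → x ≢ k → y ≢ k → A u k ≡ 0ℤ
    other x≢k y≢k = trans (row _) (cong₂ _+_ (δ-≢ x≢k) (δ-≢ y≢k))

    Q-row : ∀ j → Q u j ≡ A x j + A y j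
    Q-row j = ∑-row (λ k → A k j)

    Cuu : C u u ≡ 1ℤ
    Cuu = trans (C-diag u) (cong (_- 1ℤ) (trans (Q-row u) (cong₂ _+_ xu yu)))

    C-row : ∀ {j} → u ≢ j → C u j ≡ A x j + A y j
    C-row {j} u≢j = trans (C-≢ u≢j) (Q-row j)

    -- Commutation of A and C. Forbidden paths control the entries C k u on the left, and this
    -- converts them into values of C at x and y.
    neighbour-sum : ∀ i → (∑ λ k → A i k * C k u) ≡ C i x + C i y
    neighbour-sum i = begin
      (∑ λ k → A i k * C k u)   ≡⟨ AC≡CA i u ⟩
      (∑ λ k → C i k * A k u)   ≡⟨ ∑-cong (λ k → trans (*-comm (C i k) (A k u)) (cong (_* C i k) (A-sym k u))) ⟩
      (∑ λ k → A u k * C i k)   ≡⟨ ∑-row (C i) ⟩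
      C i x + C i y             ∎

    no-path : ∀ {z w} → A x z ≡ 1ℤ → A z w ≡ 1ℤ → A w y ≡ 1ℤ → u ≢ z → u ≢ w → x ≢ w → z ≢ y → ⊥
    no-path xz zw wy u≢z u≢w x≢w z≢y = C₅-free⇒no-5-cycle C₅-free ux xz zw wy yu u≢z u≢w x≢w x≢y z≢y

    minor-u : ∀ i j p q → det₃ 1ℤ (C u p) (C u q) (C i u) (C i p) (C i q) (C j u) (C j p) (C j q) ≡ 0ℤ
    minor-u i j p q = trans (cong (λ c → det₃ c (C u p) (C u q) (C i u) (C i p) (C i q) (C j u) (C j p) (C j q)) (sym Cuu))
      (minors≡0 u i j u p q)

    module NonAdjacent (Axy≡0 : A x y ≡ 0ℤ) where

      Ayx≡0 : A y x ≡ 0ℤ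
      Ayx≡0 = trans (A-sym y x) Axy≡0

      Cux : C u x ≡ 0ℤ
      Cux = trans (C-row u≢x) (cong₂ _+_ (A-diag x) Ayx≡0)

      Cuy : C u y ≡ 0ℤ
      Cuy = trans (C-row u≢y) (cong₂ _+_ Axy≡0 (A-diag y))

      Cyy≢0 : C y y ≢ 0ℤ
      Cyy≢0 Cyy≡0 = degree≢1 y (i-j≡0⇒i≡j (Q y y) 1ℤ (trans (sym (C-diag y)) Cyy≡0))

      -- No neighbour k of j is adjacent to y, as x j k y would be a forbidden path. So C k u is A k
      -- x, and `neighbour-sum` counts the common neighbours of j and x: C j x + C j y = C j x. Then
      -- the minor on rows u, j, y and columns u, x, y collapses to C j x · C y y, whose second
      -- factor is nonzero.
      adjacent-to-x : ∀ {j} → u ≢ j → A x j ≡ 1ℤ → A y j ≡ 0ℤ → C j x + C j y ≡ 0ℤ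
      adjacent-to-x {j} u≢j xj yj≡0 = cong₂ _+_ Cjx≡0 Cjy≡0
        where
        x≢j : x ≢ j
        x≢j = A≡1⇒≢ xj
        y≢j : y ≢ j
        y≢j refl = A≡1⇒≢0 xj Axy≡0
        Aju≡0 : A j u ≡ 0ℤ
        Aju≡0 = trans (A-sym j u) (other x≢j y≢j)

        term : ∀ k → A j k * C k u ≡ A j k * A k x
        term k with A01 j k
        ... | inj₁ jk≡0 = trans (cong (_* C k u) jk≡0) (sym (cong (_* A k x) jk≡0))
        ... | inj₂ jk   = cong (A j k *_) (begin
          C k u           ≡⟨ C-sym k u ⟩
          C u k           ≡⟨ C-row u≢k ⟩
          A x k + A y k   ≡⟨ cong₂ _+_ (A-sym x k) (A≢1⇒≡0 λ yk → no-path xj jk (trans (A-sym k y) yk) u≢j u≢k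
                               (λ { refl → A≡1⇒≢0 yk Ayx≡0 }) (y≢j ∘ sym)) ⟩
          A k x + 0ℤ      ≡⟨ +-identityʳ (A k x) ⟩
          A k x           ∎)
          where
          u≢k : u ≢ k
          u≢k refl = A≡1⇒≢0 jk Aju≡0

        Cjy≡0 : C j y ≡ 0ℤ
        Cjy≡0 = cancel (C j x) (C j y) (trans (sym (neighbour-sum j)) (trans (∑-cong term) (sym (C-≢ (x≢j ∘ sym)))))
          where
          cancel : ∀ a b → a + b ≡ a → b ≡ 0ℤ
          cancel a b eq = trans (alg a b) (trans (cong (_- a) eq) (ℤ.+-inverseʳ a))
            where
            alg : ∀ a b → b ≡ (a + b) - a
            alg = solve-∀

        Cjx≡0 : C j x ≡ 0ℤ
        Cjx≡0 = [ id , (λ Cyy≡0 → contradiction Cyy≡0 Cyy≢0) ]′ (i*j≡0⇒i≡0∨j≡0 (C j x) (begin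
          C j x * C y y
            ≡⟨ alg (C j u) (C j x) (C y u) (C y x) (C y y) ⟩
          1ℤ * (C j x * C y y - 0ℤ * C y x) - 0ℤ * (C j u * C y y - 0ℤ * C y u) + 0ℤ * (C j u * C y x - C j x * C y u)
            ≡⟨ cong₂ (λ a b → det₃ 1ℤ a b (C j u) (C j x) 0ℤ (C y u) (C y x) (C y y)) Cux Cuy ⟨
          det₃ 1ℤ (C u x) (C u y) (C j u) (C j x) 0ℤ (C y u) (C y x) (C y y)
            ≡⟨ cong (λ c → det₃ 1ℤ (C u x) (C u y) (C j u) (C j x) c (C y u) (C y x) (C y y)) Cjy≡0 ⟨
          det₃ 1ℤ (C u x) (C u y) (C j u) (C j x) (C j y) (C y u) (C y x) (C y y)
            ≡⟨ minor-u j y x y ⟩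
          0ℤ ∎))
          where
          alg : ∀ a b c d e → b * e ≡ 1ℤ * (b * e - 0ℤ * d) - 0ℤ * (a * e - 0ℤ * c) + 0ℤ * (a * d - b * c)
          alg = solve-∀

      -- A neighbour k of j adjacent to x or to y would give the path x k j y or x j k y, so every
      -- term of `neighbour-sum` is zero.
      adjacent-to-both : ∀ {j} → u ≢ j → A x j ≡ 1ℤ → A y j ≡ 1ℤ → C j x + C j y ≡ 0ℤ
      adjacent-to-both {j} u≢j xj yj = trans (sym (neighbour-sum j)) (∑-zero term)
        where
        Aju≡0 : A j u ≡ 0ℤ
        Aju≡0 = trans (A-sym j u) (other (A≡1⇒≢ xj) (A≡1⇒≢ yj))

        term : ∀ k → A j k * C k u ≡ 0ℤ
        term k with A01 j k
        ... | inj₁ jk≡0 = cong (_* C k u) jk≡0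
        ... | inj₂ jk   = trans (cong (A j k *_) (trans (C-sym k u) (trans (C-row u≢k) (cong₂ _+_
            (A≢1⇒≡0 λ xk → no-path xk (trans (A-sym k j) jk) (trans (A-sym j y) yj) u≢k u≢j (A≡1⇒≢ xj)
              (λ { refl → A≡1⇒≢0 xk Axy≡0 }))
            (A≢1⇒≡0 λ yk → no-path xj jk (trans (A-sym k y) yk) u≢j u≢k (λ { refl → A≡1⇒≢0 yk Ayx≡0 })
              (A≡1⇒≢ yj ∘ sym))))))
            (*-zeroʳ (A j k))
          where
          u≢k : u ≢ k
          u≢k refl = A≡1⇒≢0 jk Aju≡0

  -- If the neighbours x, y of u were not adjacent, then (C²)_ux + (C²)_uy, which is positive,
  -- would vanish term by term.
  module _ {u x y : Fin N} (x≢y : x ≢ y) (row : ∀ k → A u k ≡ δ x k + δ y k) where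

    open DegreeTwo x≢y row

    neighbours-adjacent : A x y ≡ 1ℤ
    neighbours-adjacent with A01 x y
    ... | inj₂ xy    = xy
    ... | inj₁ Axy≡0 = ⊥-elim (0≰negative 1 nonneg vanishes)
      where
      open NonAdjacent Axy≡0

      row′ : ∀ k → A u k ≡ δ y k + δ x k
      row′ k = trans (row k) (ℤ.+-comm (δ x k) (δ y k))

      term : ∀ j → C u j * (C j x + C j y) ≡ 0ℤ
      term j with u ≟ j
      ... | yes refl = trans (cong (C u u *_) (cong₂ _+_ Cux Cuy)) (*-zeroʳ (C u u))
      ... | no u≢j with A01 x j | A01 y j
      ...   | inj₁ xj | inj₁ yj = cong (_* (C j x + C j y)) (trans (C-row u≢j) (cong₂ _+_ xj yj))
      ...   | inj₂ xj | inj₁ yj = trans (cong (C u j *_) (adjacent-to-x u≢j xj yj)) (*-zeroʳ (C u j))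
      ...   | inj₁ xj | inj₂ yj = trans (cong (C u j *_) (trans (ℤ.+-comm (C j x) (C j y))
                (DegreeTwo.NonAdjacent.adjacent-to-x (x≢y ∘ sym) row′ Ayx≡0 u≢j yj xj))) (*-zeroʳ (C u j))
      ...   | inj₂ xj | inj₂ yj = trans (cong (C u j *_) (adjacent-to-both u≢j xj yj)) (*-zeroʳ (C u j))

      C²-row : ∀ {z} → C u z ≡ 0ℤ → (∑ λ j → C u j * C j z) ≡ C x z + C y z
      C²-row {z} Cuz≡0 = begin
        (∑ λ j → C u j * C j z)                              ≡⟨ C²≡CA+ u z ⟩
        (∑ λ j → C u j * A j z) + (pos 2 * ν - 1ℤ) * C u z
          ≡⟨ cong₂ _+_ (trans (sym (AC≡CA u z)) (∑-row (λ k → C k z)))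
                       (trans (cong ((pos 2 * ν - 1ℤ) *_) Cuz≡0) (*-zeroʳ (pos 2 * ν - 1ℤ))) ⟩
        C x z + C y z + 0ℤ                                   ≡⟨ +-identityʳ (C x z + C y z) ⟩
        C x z + C y z                                        ∎

      total : (C x x + C y x) + (C x y + C y y) ≡ 0ℤ
      total = begin
        (C x x + C y x) + (C x y + C y y)                         ≡⟨ cong₂ _+_ (C²-row Cux) (C²-row Cuy) ⟨
        (∑ λ j → C u j * C j x) + (∑ λ j → C u j * C j y)         ≡⟨ ∑-+ (λ j → C u j * C j x) (λ j → C u j * C j y) ⟨
        (∑ λ j → C u j * C j x + C u j * C j y)                   ≡⟨ ∑-cong (λ j → ℤ.*-distribˡ-+ (C u j) (C j x) (C j y)) ⟨
        (∑ λ j → C u j * (C j x + C j y))                         ≡⟨ ∑-zero term ⟩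
        0ℤ                                                        ∎

      -- Replacing degree - 1 by degree - 2 in both diagonal terms shifts the zero total to -2,
      -- while minimum degree 2 still makes every term nonnegative.
      vanishes : ((Q x x - pos 2) + Q y x) + (Q x y + (Q y y - pos 2)) ≡ -[1+ 1 ]
      vanishes = begin
        ((Q x x - pos 2) + Q y x) + (Q x y + (Q y y - pos 2))
          ≡⟨ alg (Q x x) (Q y x) (Q x y) (Q y y) ⟩
        ((Q x x - 1ℤ) + Q y x) + (Q x y + (Q y y - 1ℤ)) - pos 2
          ≡⟨ cong (_- pos 2) (cong₂ _+_ (cong₂ _+_ (C-diag x) (C-≢ (x≢y ∘ sym))) (cong₂ _+_ (C-≢ x≢y) (C-diag y))) ⟨
        (C x x + C y x) + (C x y + C y y) - pos 2
          ≡⟨ cong (_- pos 2) total ⟩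
        -[1+ 1 ] ∎
        where
        alg : ∀ a b c d → ((a - pos 2) + b) + (c + (d - pos 2)) ≡ ((a - 1ℤ) + b) + (c + (d - 1ℤ)) - pos 2
        alg = solve-∀

      nonneg : 0ℤ ≤ ((Q x x - pos 2) + Q y x) + (Q x y + (Q y y - pos 2))
      nonneg = +-mono-≤ (+-mono-≤ (2≤degree x) (Q-nonneg y x)) (+-mono-≤ (Q-nonneg x y) (2≤degree y))

    Cux≡1 : C u x ≡ 1ℤ
    Cux≡1 = trans (C-row u≢x) (cong₂ _+_ (A-diag x) (trans (A-sym y x) neighbours-adjacent))

    Cuy≡1 : C u y ≡ 1ℤ
    Cuy≡1 = trans (C-row u≢y) (cong₂ _+_ neighbours-adjacent (A-diag y))

    -- Two evaluations of C² at (u, u): the squared row sums to Q x x + Q y y + 2 Q x y - 3, and the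
    -- relation for C² gives 1 + 1 + (2n - 1).
    degree-sum : Q x x + Q y y + pos 2 * Q x y ≡ pos 2 * ν + pos 4
    degree-sum = begin
      Q x x + Q y y + pos 2 * Q x y
        ≡⟨ alg (Q x x) (Q y y) (Q x y) ⟩
      1ℤ * Q x x + (1ℤ * Q y y + (pos 2 * Q x y + (1ℤ - pos 2 * (1ℤ + 1ℤ)))) + pos 3
        ≡⟨ cong (_+ pos 3) expand ⟨
      (∑ λ j → C u j * C j u) + pos 3
        ≡⟨ cong (_+ pos 3) (C²≡CA+ u u) ⟩
      (∑ λ j → C u j * A j u) + (pos 2 * ν - 1ℤ) * C u u + pos 3
        ≡⟨ cong₂ (λ a b → a + (pos 2 * ν - 1ℤ) * b + pos 3) (trans (sym (AC≡CA u u)) (trans (∑-row (λ k → C k u))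
             (cong₂ _+_ (trans (C-sym x u) Cux≡1) (trans (C-sym y u) Cuy≡1)))) Cuu ⟩
      1ℤ + 1ℤ + (pos 2 * ν - 1ℤ) * 1ℤ + pos 3
        ≡⟨ alg′ ν ⟩
      pos 2 * ν + pos 4 ∎
      where
      alg : ∀ a b c → a + b + pos 2 * c ≡ 1ℤ * a + (1ℤ * b + (pos 2 * c + (1ℤ - pos 2 * (1ℤ + 1ℤ)))) + pos 3
      alg = solve-∀
      alg′ : ∀ v → 1ℤ + 1ℤ + (pos 2 * v - 1ℤ) * 1ℤ + pos 3 ≡ pos 2 * v + pos 4
      alg′ = solve-∀
      square : ∀ a b d → (a + b + -1ℤ * d) * (a + b + -1ℤ * d) ≡
        1ℤ * (a * a) + (1ℤ * (b * b) + (pos 2 * (a * b) + d * (d - pos 2 * (a + b))))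
      square = solve-∀
      C-row′ : ∀ j → C u j ≡ A x j + A y j + -1ℤ * δ u j
      C-row′ j = cong (_+ -1ℤ * δ u j) (Q-row j)
      pointwise : ∀ j → C u j * C j u ≡
        1ℤ * (A x j * A j x) + (1ℤ * (A y j * A j y) + (pos 2 * (A x j * A j y) + δ u j * (δ u j - pos 2 * (A x j + A y j))))
      pointwise j = begin
        C u j * C j u
          ≡⟨ cong₂ _*_ (C-row′ j) (trans (C-sym j u) (C-row′ j)) ⟩
        (A x j + A y j + -1ℤ * δ u j) * (A x j + A y j + -1ℤ * δ u j)
          ≡⟨ square (A x j) (A y j) (δ u j) ⟩
        1ℤ * (A x j * A x j) + (1ℤ * (A y j * A y j) + (pos 2 * (A x j * A y j) + δ u j * (δ u j - pos 2 * (A x j + A y j))))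
          ≡⟨ cong₂ (λ a b → 1ℤ * (A x j * a) + (1ℤ * (A y j * b) + (pos 2 * (A x j * b) + δ u j * (δ u j - pos 2 * (A x j + A y j)))))
               (A-sym x j) (A-sym y j) ⟩
        _ ∎
      expand : (∑ λ j → C u j * C j u) ≡ 1ℤ * Q x x + (1ℤ * Q y y + (pos 2 * Q x y + (1ℤ - pos 2 * (1ℤ + 1ℤ))))
      expand = trans (∑-cong pointwise)
        (trans (∑-linear 1ℤ (λ j → A x j * A j x) _) (cong (1ℤ * Q x x +_)
        (trans (∑-linear 1ℤ (λ j → A y j * A j y) _) (cong (1ℤ * Q y y +_)
        (trans (∑-linear (pos 2) (λ j → A x j * A j y) _) (cong (pos 2 * Q x y +_)
        (trans (δ-*ˡ u (λ j → δ u j - pos 2 * (A x j + A y j)))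
               (cong₂ (λ d e → d - pos 2 * e) (δ-refl u) (cong₂ _+_ xu yu)))))))))

    module SecondCommonNeighbour {w : Fin N} (u≢w : u ≢ w) (xw : A x w ≡ 1ℤ) (yw : A y w ≡ 1ℤ) where

      wx : A w x ≡ 1ℤ
      wx = trans (A-sym w x) xw

      wy : A w y ≡ 1ℤ
      wy = trans (A-sym w y) yw

      Awu≡0 : A w u ≡ 0ℤ
      Awu≡0 = trans (A-sym w u) (other (A≡1⇒≢ xw) (A≡1⇒≢ yw))

      term : ∀ k → A w k * C k u ≡ δ x k + δ y k
      term k with x ≟ k | y ≟ k
      ... | yes refl | yes refl = contradiction refl x≢y
      ... | yes refl | no _     = trans (cong₂ _*_ wx (trans (C-sym x u) Cux≡1)) (sym (cong₂ _+_ (δ-refl x) (δ-≢ (x≢y ∘ sym))))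
      ... | no _     | yes refl = trans (cong₂ _*_ wy (trans (C-sym y u) Cuy≡1)) (sym (cong₂ _+_ (δ-≢ x≢y) (δ-refl y)))
      ... | no x≢k   | no y≢k   = trans zero-term (sym (cong₂ _+_ (δ-≢ x≢k) (δ-≢ y≢k)))
        where
        zero-term : A w k * C k u ≡ 0ℤ
        zero-term with A01 w k
        ... | inj₁ wk≡0 = cong (_* C k u) wk≡0
        ... | inj₂ wk   = trans (cong (A w k *_) (trans (C-sym k u) (trans (C-row u≢k) (cong₂ _+_
            (A≢1⇒≡0 λ xk → no-path xk (trans (A-sym k w) wk) wy u≢k u≢w (A≡1⇒≢ xw) (y≢k ∘ sym))
            (A≢1⇒≡0 λ yk → no-path xw wk (trans (A-sym k y) yk) u≢w u≢k x≢k (A≡1⇒≢ yw ∘ sym))))))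
            (*-zeroʳ (A w k))
          where
          u≢k : u ≢ k
          u≢k refl = A≡1⇒≢0 wk Awu≡0

      -- A neighbour k of w other than x and y is adjacent to neither, since x k w y or x w k y
      -- would be a forbidden path; x and y contribute 1 each. Both summands on the left are at
      -- least 1, because w, x, y form a triangle, so both will be 1.
      codegrees : C w x + C w y ≡ pos 2
      codegrees = begin
        C w x + C w y                  ≡⟨ neighbour-sum w ⟨
        (∑ λ k → A w k * C k u)        ≡⟨ ∑-cong (λ k → trans (term k) (sym (*-identityʳ (δ x k + δ y k)))) ⟩
        (∑ λ k → (δ x k + δ y k) * 1ℤ) ≡⟨ ∑-δ+δ x y (λ _ → 1ℤ) (λ _ → refl) ⟩
        pos 2                          ∎

      1≤Cwx : 0ℤ ≤ C w x - 1ℤ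
      1≤Cwx = subst (λ c → 0ℤ ≤ c - 1ℤ) (sym (C-≢ (A≡1⇒≢ wx))) (1≤Q wy (trans (A-sym y x) neighbours-adjacent))

      1≤Cwy : 0ℤ ≤ C w y - 1ℤ
      1≤Cwy = subst (λ c → 0ℤ ≤ c - 1ℤ) (sym (C-≢ (A≡1⇒≢ wy))) (1≤Q wx neighbours-adjacent)

      Cwx≡1 : C w x ≡ 1ℤ
      Cwx≡1 = i-j≡0⇒i≡j (C w x) 1ℤ (+-nonneg-zeroˡ 1≤Cwx 1≤Cwy
        (trans (alg (C w x) (C w y)) (cong (_- pos 2) codegrees)))
        where
        alg : ∀ a b → (a - 1ℤ) + (b - 1ℤ) ≡ (a + b) - pos 2
        alg = solve-∀

      Cwy≡1 : C w y ≡ 1ℤ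
      Cwy≡1 = trans (alg (C w x) (C w y)) (cong₂ _-_ codegrees Cwx≡1)
        where
        alg : ∀ a b → b ≡ (a + b) - a
        alg = solve-∀

      Cuw≡2 : C u w ≡ pos 2
      Cuw≡2 = trans (C-row u≢w) (cong₂ _+_ xw yw)

      -- The vanishing minor on rows u, w, i and columns u, w, p has rows (1, 2, 1), (2, C w w, 1),
      -- (1, 1, C i p) and equals this product minus 1. For i = p = x the second factor is the
      -- degree of x minus 2, a nonnegative divisor of 1, which fixes all the values below.
      minor-w : ∀ i p → C u i ≡ 1ℤ → C u p ≡ 1ℤ → C w i ≡ 1ℤ → C w p ≡ 1ℤ → (C w w - pos 4) * (C i p - 1ℤ) ≡ 1ℤ
      minor-w i p ui up wi wp = begin
        (C w w - pos 4) * (C i p - 1ℤ)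
          ≡⟨ alg (C w w) (C i p) ⟩
        (1ℤ * (C w w * C i p - 1ℤ * 1ℤ) - pos 2 * (pos 2 * C i p - 1ℤ * 1ℤ) + 1ℤ * (pos 2 * 1ℤ - C w w * 1ℤ)) + 1ℤ
          ≡⟨ cong (_+ 1ℤ) (trans (sym substitute) (minor-u w i w p)) ⟩
        1ℤ ∎
        where
        alg : ∀ a b → (a - pos 4) * (b - 1ℤ) ≡
          (1ℤ * (a * b - 1ℤ * 1ℤ) - pos 2 * (pos 2 * b - 1ℤ * 1ℤ) + 1ℤ * (pos 2 * 1ℤ - a * 1ℤ)) + 1ℤ
        alg = solve-∀
        substitute : det₃ 1ℤ (C u w) (C u p) (C w u) (C w w) (C w p) (C i u) (C i w) (C i p) ≡
          det₃ 1ℤ (pos 2) 1ℤ (pos 2) (C w w) 1ℤ 1ℤ 1ℤ (C i p)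
        substitute rewrite C-sym w u | C-sym i u | C-sym i w | Cuw≡2 | ui | up | wi | wp = refl

      excess : Q x x - pos 2 ≡ 1ℤ
      excess = unit (C w w - pos 4) (Q x x - pos 2) (2≤degree x) (trans
        (cong ((C w w - pos 4) *_) (trans (alg (Q x x)) (cong (_- 1ℤ) (sym (C-diag x)))))
        (minor-w x x Cux≡1 Cux≡1 Cwx≡1 Cwx≡1))
        where
        alg : ∀ a → a - pos 2 ≡ a - 1ℤ - 1ℤ
        alg = solve-∀
        unit : ∀ a b → 0ℤ ≤ b → a * b ≡ 1ℤ → b ≡ 1ℤ
        unit a (pos b) _ ab≡1 = cong pos (ℕ.m*n≡1⇒n≡1 ∣ a ∣ b (trans (sym (abs-* a (pos b))) (cong ∣_∣ ab≡1)))

      Qxx≡3 : Q x x ≡ pos 3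
      Qxx≡3 = trans (alg (Q x x)) (cong (_+ pos 2) excess)
        where
        alg : ∀ a → a ≡ (a - pos 2) + pos 2
        alg = solve-∀

      Cww≡5 : C w w ≡ pos 5
      Cww≡5 = begin
        C w w                                  ≡⟨ alg (C w w) ⟩
        (C w w - pos 4) * (pos 2 - 1ℤ) + pos 4
          ≡⟨ cong (λ c → (C w w - pos 4) * (c - 1ℤ) + pos 4) (trans (C-diag x) (cong (_- 1ℤ) Qxx≡3)) ⟨
        (C w w - pos 4) * (C x x - 1ℤ) + pos 4 ≡⟨ cong (_+ pos 4) (minor-w x x Cux≡1 Cux≡1 Cwx≡1 Cwx≡1) ⟩
        pos 5                                  ∎
        where
        alg : ∀ a → a ≡ (a - pos 4) * (pos 2 - 1ℤ) + pos 4
        alg = solve-∀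

      Cip≡2 : ∀ i p → C u i ≡ 1ℤ → C u p ≡ 1ℤ → C w i ≡ 1ℤ → C w p ≡ 1ℤ → C i p ≡ pos 2
      Cip≡2 i p ui up wi wp = begin
        C i p                                  ≡⟨ alg (C i p) ⟩
        (pos 5 - pos 4) * (C i p - 1ℤ) + 1ℤ    ≡⟨ cong (λ c → (c - pos 4) * (C i p - 1ℤ) + 1ℤ) Cww≡5 ⟨
        (C w w - pos 4) * (C i p - 1ℤ) + 1ℤ    ≡⟨ cong (_+ 1ℤ) (minor-w i p ui up wi wp) ⟩
        pos 2                                  ∎
        where
        alg : ∀ a → a ≡ (pos 5 - pos 4) * (a - 1ℤ) + 1ℤ
        alg = solve-∀

      Qyy≡3 : Q y y ≡ pos 3
      Qyy≡3 = i-j≡0⇒i≡j (Q y y) (pos 3) (trans (alg (Q y y))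
        (cong (_- pos 2) (trans (sym (C-diag y)) (Cip≡2 y y Cuy≡1 Cuy≡1 Cwy≡1 Cwy≡1))))
        where
        alg : ∀ a → a - pos 3 ≡ (a - 1ℤ) - pos 2
        alg = solve-∀

      Qxy≡2 : Q x y ≡ pos 2
      Qxy≡2 = trans (sym (C-≢ x≢y)) (Cip≡2 x y Cux≡1 Cuy≡1 Cwx≡1 Cwy≡1)

      -- The 6 neighbours of w, w itself and u would be 8 distinct vertices, but 2n + 1 = 7.
      impossible : ⊥
      impossible = 0≰negative 0 (∑-nonneg nonneg) total
        where
        nonneg : ∀ k → 0ℤ ≤ (1ℤ - A w k) - δ w k - δ u k
        nonneg k with w ≟ k | u ≟ k
        ... | yes refl | yes refl = contradiction refl u≢w
        ... | yes refl | no _     = ≤-reflexive (sym (cong₂ _-_ (cong₂ _-_ (cong (λ a → 1ℤ - a) (A-diag w)) (δ-refl w)) (δ-≢ u≢w)))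
        ... | no _     | yes refl = ≤-reflexive (sym (cong₂ _-_ (cong₂ _-_ (cong (λ a → 1ℤ - a) Awu≡0) (δ-≢ (u≢w ∘ sym))) (δ-refl u)))
        ... | no w≢k   | no u≢k   = ≤-trans (nonneg′ (A01 w k)) (≤-reflexive (sym (trans (cong₂ (λ a b → (1ℤ - A w k) - a - b) (δ-≢ w≢k) (δ-≢ u≢k))
              (alg (A w k)))))
          where
          nonneg′ : ∀ {a} → a ≡ 0ℤ ⊎ a ≡ 1ℤ → 0ℤ ≤ 1ℤ - a
          nonneg′ (inj₁ refl) = +≤+ z≤n
          nonneg′ (inj₂ refl) = +≤+ z≤n
          alg : ∀ a → (1ℤ - a) - 0ℤ - 0ℤ ≡ 1ℤ - a
          alg = solve-∀

        ν-value : pos 2 * ν ≡ pos 6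
        ν-value = begin
          pos 2 * ν                                       ≡⟨ alg (pos 2 * ν) ⟩
          (pos 2 * ν + pos 4) - pos 4                     ≡⟨ cong (_- pos 4) degree-sum ⟨
          Q x x + Q y y + pos 2 * Q x y - pos 4           ≡⟨ cong₂ (λ a b → a + pos 2 * b - pos 4) (cong₂ _+_ Qxx≡3 Qyy≡3) Qxy≡2 ⟩
          pos 6                                           ∎
          where
          alg : ∀ a → a ≡ (a + pos 4) - pos 4
          alg = solve-∀

        w-degree : ∑ (A w) ≡ pos 6
        w-degree = trans (degree w) (trans (alg (Q w w)) (cong (_+ 1ℤ) (trans (sym (C-diag w)) Cww≡5)))
          where
          alg : ∀ a → a ≡ (a - 1ℤ) + 1ℤ
          alg = solve-∀

        total : (∑ λ k → (1ℤ - A w k) - δ w k - δ u k) ≡ -[1+ 0 ]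
        total = begin
          (∑ λ k → (1ℤ - A w k) - δ w k - δ u k)         ≡⟨ ∑-remove-δ (λ k → (1ℤ - A w k) - δ w k) u ⟩
          (∑ λ k → (1ℤ - A w k) - δ w k) - 1ℤ            ≡⟨ cong (_- 1ℤ) (∑-remove-δ (λ k → 1ℤ - A w k) w) ⟩
          (∑ λ k → 1ℤ - A w k) - 1ℤ - 1ℤ                 ≡⟨ cong (λ s → s - 1ℤ - 1ℤ) (∑-cong λ k → alg (A w k)) ⟩
          (∑ λ k → -1ℤ * A w k + 1ℤ) - 1ℤ - 1ℤ           ≡⟨ cong (λ s → s - 1ℤ - 1ℤ) (∑-linear -1ℤ (A w) (λ _ → 1ℤ)) ⟩
          -1ℤ * ∑ (A w) + ∑ {N} (λ _ → 1ℤ) - 1ℤ - 1ℤ     ≡⟨ cong₂ (λ a b → -1ℤ * a + b - 1ℤ - 1ℤ) w-degree (trans ∑-ones (cong (1ℤ +_) ν-value)) ⟩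
          -[1+ 0 ]                                       ∎
          where
          alg : ∀ a → 1ℤ - a ≡ -1ℤ * a + 1ℤ
          alg = solve-∀

    Qxy≡1 : Q x y ≡ 1ℤ
    Qxy≡1 = trans (∑-cong λ k → trans (only-u k) (sym (*-identityʳ (δ u k)))) (δ-*ˡ u (λ _ → 1ℤ))
      where
      only-u : ∀ k → A x k * A k y ≡ δ u k
      only-u k with u ≟ k
      ... | yes refl = trans (cong₂ _*_ xu uy) (sym (δ-refl u))
      ... | no u≢k with A01 x k | A01 k y
      ...   | inj₁ xk | _       = trans (cong (_* A k y) xk) (sym (δ-≢ u≢k))
      ...   | inj₂ _  | inj₁ ky = trans (cong (A x k *_) ky) (trans (*-zeroʳ (A x k)) (sym (δ-≢ u≢k)))
      ...   | inj₂ xk | inj₂ ky = ⊥-elim (SecondCommonNeighbour.impossible u≢k xk (trans (A-sym y k) ky))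

    -- On u, x, y all entries of C are 1 except possibly C x x and C y y, so the vanishing minor is
    -- this product.
    product≡0 : (C x x - 1ℤ) * (C y y - 1ℤ) ≡ 0ℤ
    product≡0 = trans (alg (C x x) (C y y)) (trans (sym substitute) (minor-u x y x y))
      where
      alg : ∀ a b → (a - 1ℤ) * (b - 1ℤ) ≡ 1ℤ * (a * b - 1ℤ * 1ℤ) - 1ℤ * (1ℤ * b - 1ℤ * 1ℤ) + 1ℤ * (1ℤ * 1ℤ - a * 1ℤ)
      alg = solve-∀
      Cxy≡1 : C x y ≡ 1ℤ
      Cxy≡1 = trans (C-≢ x≢y) Qxy≡1
      substitute : det₃ 1ℤ (C u x) (C u y) (C x u) (C x x) (C x y) (C y u) (C y x) (C y y) ≡
        det₃ 1ℤ 1ℤ 1ℤ 1ℤ (C x x) 1ℤ 1ℤ 1ℤ (C y y)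
      substitute rewrite C-sym x u | C-sym y u | C-sym y x | Cux≡1 | Cuy≡1 | Cxy≡1 = refl

    -- By `product≡0` one of x, y has degree 2, and `degree-sum` then reads 2 + d + 2 = 2n + 4 for
    -- the degree d of the other.
    hub : ∃[ c ] Q c c ≡ pos 2 * ν
    hub = [ (λ x≡1 → y , trans (alg (Q x x) (Q y y)) (complement x≡1))
          , (λ y≡1 → x , trans (alg′ (Q x x) (Q y y)) (complement y≡1)) ]′
          (i*j≡0⇒i≡0∨j≡0 (C x x - 1ℤ) product≡0)
      where
      alg : ∀ a b → b ≡ (a + b + pos 2 * 1ℤ) - (a - 1ℤ - 1ℤ) - pos 4
      alg = solve-∀
      alg′ : ∀ a b → a ≡ (a + b + pos 2 * 1ℤ) - (b - 1ℤ - 1ℤ) - pos 4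
      alg′ = solve-∀
      alg″ : ∀ a → (a + pos 4) - 0ℤ - pos 4 ≡ a
      alg″ = solve-∀
      complement : ∀ {z} → C z z - 1ℤ ≡ 0ℤ → (Q x x + Q y y + pos 2 * 1ℤ) - (Q z z - 1ℤ - 1ℤ) - pos 4 ≡ pos 2 * ν
      complement {z} z≡1 = begin
        (Q x x + Q y y + pos 2 * 1ℤ) - (Q z z - 1ℤ - 1ℤ) - pos 4
          ≡⟨ cong₂ (λ q d → (Q x x + Q y y + pos 2 * q) - d - pos 4) (sym Qxy≡1) (trans (cong (_- 1ℤ) (sym (C-diag z))) z≡1) ⟩
        (Q x x + Q y y + pos 2 * Q x y) - 0ℤ - pos 4
          ≡⟨ cong (λ s → s - 0ℤ - pos 4) degree-sum ⟩
        (pos 2 * ν + pos 4) - 0ℤ - pos 4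
          ≡⟨ alg″ (pos 2 * ν) ⟩
        pos 2 * ν ∎

  ∃hub : ∃[ c ] Q c c ≡ pos 2 * ν
  ∃hub =
    let u , Quu≡2 = ∃degree≡2
        x , y , x≢y , row = ∑≡2⇒δ+δ {g = A u} (A01 u) (trans (degree u) Quu≡2)
    in hub x≢y row

  -- The hub and the rim

  module Hub {c : Fin N} (c-degree : Q c c ≡ pos 2 * ν) where

    -- The terms 1 - A c k - δ c k are nonnegative and sum to (2n + 1) - 2n - 1 = 0, so each is
    -- zero.
    hub-adjacent : ∀ {k} → k ≢ c → c ~ k
    hub-adjacent {k} k≢c with A01 c k
    ... | inj₂ ck   = A≡1⇒~ ck
    ... | inj₁ ck≡0 = contradiction (trans (sym (cong₂ (λ a d → 1ℤ - a - d) ck≡0 (δ-≢ (k≢c ∘ sym)))) (∑≡0⇒≡0 nonneg total k)) 1≢0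
      where
      nonneg : ∀ k → 0ℤ ≤ 1ℤ - A c k - δ c k
      nonneg k with c ≟ k
      ... | yes refl = ≤-reflexive (sym (cong₂ (λ a d → 1ℤ - a - d) (A-diag c) (δ-refl c)))
      ... | no c≢k with A01 c k
      ...   | inj₁ ck = ≤-trans (+≤+ (z≤n {1})) (≤-reflexive (sym (cong₂ (λ a d → 1ℤ - a - d) ck (δ-≢ c≢k))))
      ...   | inj₂ ck = ≤-reflexive (sym (cong₂ (λ a d → 1ℤ - a - d) ck (δ-≢ c≢k)))
      total : (∑ λ k → 1ℤ - A c k - δ c k) ≡ 0ℤ
      total = begin
        (∑ λ k → 1ℤ - A c k - δ c k)              ≡⟨ ∑-remove-δ (λ k → 1ℤ - A c k) c ⟩
        (∑ λ k → 1ℤ - A c k) - 1ℤ                 ≡⟨ cong (_- 1ℤ) (∑-cong λ k → alg (A c k)) ⟩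
        (∑ λ k → -1ℤ * A c k + 1ℤ) - 1ℤ           ≡⟨ cong (_- 1ℤ) (∑-linear -1ℤ (A c) (λ _ → 1ℤ)) ⟩
        -1ℤ * ∑ (A c) + ∑ {N} (λ _ → 1ℤ) - 1ℤ     ≡⟨ cong₂ (λ a b → -1ℤ * a + b - 1ℤ) (trans (degree c) c-degree) ∑-ones ⟩
        -1ℤ * (pos 2 * ν) + (1ℤ + pos 2 * ν) - 1ℤ ≡⟨ alg′ ν ⟩
        0ℤ                                        ∎
        where
        alg : ∀ a → 1ℤ - a ≡ -1ℤ * a + 1ℤ
        alg = solve-∀
        alg′ : ∀ v → -1ℤ * (pos 2 * v) + (1ℤ + pos 2 * v) - 1ℤ ≡ 0ℤ
        alg′ = solve-∀

    -- Taking 2 from every degree and the excess 2n - 2 from the hub leaves nonnegative terms with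
    -- sum 6n - 2 (2n + 1) - (2n - 2) = 0.
    rim-degree : ∀ {k} → k ≢ c → Q k k ≡ pos 2
    rim-degree {k} k≢c = trans (alg (Q k k) s) (cong (_+ pos 2) (trans
      (cong (λ d → Q k k - pos 2 - s * d) (sym (δ-≢ (k≢c ∘ sym)))) (∑≡0⇒≡0 nonneg total k)))
      where
      s : ℤ
      s = pos 2 * ν - pos 2
      alg : ∀ q s → q ≡ (q - pos 2 - s * 0ℤ) + pos 2
      alg = solve-∀
      nonneg : ∀ k → 0ℤ ≤ Q k k - pos 2 - s * δ c k
      nonneg k with c ≟ k
      ... | yes refl = ≤-reflexive (sym (trans (cong₂ (λ q d → q - pos 2 - s * d) c-degree (δ-refl c)) (alg′ ν)))
        where
        alg′ : ∀ v → pos 2 * v - pos 2 - (pos 2 * v - pos 2) * 1ℤ ≡ 0ℤ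
        alg′ = solve-∀
      ... | no c≢k   = ≤-trans (2≤degree k) (≤-reflexive (sym (trans (cong (λ d → Q k k - pos 2 - s * d) (δ-≢ c≢k)) (alg′ (Q k k) s))))
        where
        alg′ : ∀ q s → q - pos 2 - s * 0ℤ ≡ q - pos 2
        alg′ = solve-∀
      total : (∑ λ k → Q k k - pos 2 - s * δ c k) ≡ 0ℤ
      total = begin
        (∑ λ k → Q k k - pos 2 - s * δ c k)                   ≡⟨ ∑-cong (λ k → alg′ (Q k k) s (δ c k)) ⟩
        (∑ λ k → - s * (δ c k * 1ℤ) + (- pos 2 * 1ℤ + Q k k)) ≡⟨ ∑-linear (- s) (λ k → δ c k * 1ℤ) (λ k → - pos 2 * 1ℤ + Q k k) ⟩
        - s * (∑ λ k → δ c k * 1ℤ) + (∑ λ k → - pos 2 * 1ℤ + Q k k)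
          ≡⟨ cong₂ (λ a b → - s * a + b) (δ-*ˡ c (λ _ → 1ℤ)) (∑-linear (- pos 2) (λ _ → 1ℤ) (λ k → Q k k)) ⟩
        - s * 1ℤ + (- pos 2 * ∑ {N} (λ _ → 1ℤ) + tr Q)        ≡⟨ cong₂ (λ a b → - s * 1ℤ + (- pos 2 * a + b)) ∑-ones edges ⟩
        - s * 1ℤ + (- pos 2 * (1ℤ + pos 2 * ν) + pos 6 * ν)   ≡⟨ alg″ ν ⟩
        0ℤ                                                    ∎
        where
        alg′ : ∀ q s d → q - pos 2 - s * d ≡ - s * (d * 1ℤ) + (- pos 2 * 1ℤ + q)
        alg′ = solve-∀
        alg″ : ∀ v → - (pos 2 * v - pos 2) * 1ℤ + (- pos 2 * (1ℤ + pos 2 * v) + pos 6 * v) ≡ 0ℤ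
        alg″ = solve-∀

    two-neighbours⇒mate : ∀ {k p q} → k ≢ c → p ≢ q → (∀ j → A k j ≡ δ p j + δ q j) →
      ∃[ μ ] (μ ≢ c × k ~ μ × (∀ j → k ~ j → j ≡ c ⊎ j ≡ μ))
    two-neighbours⇒mate {k} {p} {q} k≢c p≢q row = cases (p ≟ c) (q ≟ c)
      where
      kc : A k c ≡ 1ℤ
      kc = trans (A-sym k c) (~⇒A≡1 (hub-adjacent k≢c))

      among : ∀ {j} → k ~ j → j ≡ p ⊎ j ≡ q
      among {j} k~j with p ≟ j | q ≟ j
      ... | yes p≡j | _       = inj₁ (sym p≡j)
      ... | no _    | yes q≡j = inj₂ (sym q≡j)
      ... | no p≢j  | no q≢j  = contradiction (trans (row j) (cong₂ _+_ (δ-≢ p≢j) (δ-≢ q≢j))) (A≡1⇒≢0 (~⇒A≡1 k~j))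

      k~p : k ~ p
      k~p = A≡1⇒~ (trans (row p) (cong₂ _+_ (δ-refl p) (δ-≢ (p≢q ∘ sym))))

      k~q : k ~ q
      k~q = A≡1⇒~ (trans (row q) (cong₂ _+_ (δ-≢ p≢q) (δ-refl q)))

      cases : Dec (p ≡ c) → Dec (q ≡ c) → ∃[ μ ] (μ ≢ c × k ~ μ × (∀ j → k ~ j → j ≡ c ⊎ j ≡ μ))
      cases (yes p≡c) (yes q≡c) = contradiction (trans p≡c (sym q≡c)) p≢q
      cases (yes p≡c) (no q≢c)  = q , q≢c , k~q , λ j k~j → [ (λ j≡p → inj₁ (trans j≡p p≡c)) , inj₂ ]′ (among k~j)
      cases (no p≢c)  (yes q≡c) = p , p≢c , k~p , λ j k~j → [ inj₂ , (λ j≡q → inj₁ (trans j≡q q≡c)) ]′ (among k~j)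
      cases (no p≢c)  (no q≢c)  = [ (λ c≡p → contradiction (sym c≡p) p≢c) , (λ c≡q → contradiction (sym c≡q) q≢c) ]′
        (among (A≡1⇒~ kc))

    rim-neighbour : ∀ {k} → k ≢ c → ∃[ μ ] (μ ≢ c × k ~ μ × (∀ j → k ~ j → j ≡ c ⊎ j ≡ μ))
    rim-neighbour {k} k≢c =
      let _ , _ , p≢q , row = ∑≡2⇒δ+δ {g = A k} (A01 k) (trans (degree k) (rim-degree k≢c))
      in two-neighbours⇒mate k≢c p≢q row

-- The isomorphism

-- A missed value could be punched out, giving an injection into a smaller set.
injective⇒covers : ∀ (g : Fin n → Fin n) → Injective _≡_ _≡_ g → ∀ v → ∃[ i ] g i ≡ v
injective⇒covers {zero}  g g-inj ()
injective⇒covers {suc n} g g-inj v with any? (λ i → g i ≟ v)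
... | yes covered = covered
... | no missed   = contradiction
  (injective⇒≤ {f = λ i → punchOut {i = v} {j = g i} (λ v≡gi → missed (i , sym v≡gi))} (g-inj ∘ punchOut-injective {i = v} _ _))
  (ℕ.<⇒≱ (ℕ.n<1+n n))

misses : ∀ {m n} (g : Fin m → Fin n) → m ℕ.< n → ∃[ v ] (∀ i → g i ≢ v)
misses {m} {n} g m<n with all? (λ v → any? (λ i → g i ≟ v))
... | no notall  = let v , missed = ¬∀⟶∃¬ n _ (λ v → any? (λ i → g i ≟ v)) notall
                   in v , λ i gi≡v → missed (i , gi≡v)
... | yes covers = contradiction
  (injective⇒≤ {f = λ v → proj₁ (covers v)} λ {v} {w} eq →
    trans (sym (proj₂ (covers v))) (trans (cong g eq) (proj₂ (covers w))))
  (ℕ.<⇒≱ m<n)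

module Windmill (n : ℕ) (G : Graph (suc (n ℕ.* 2))) (c : Fin (suc (n ℕ.* 2)))
  (hub-adjacent : ∀ {k} → k ≢ c → Graph._~_ G c k)
  (rim-neighbour : ∀ {k} → k ≢ c → ∃[ μ ] (μ ≢ c × Graph._~_ G k μ × (∀ j → Graph._~_ G k j → j ≡ c ⊎ j ≡ μ)))
  where

  open Graph G using (_~_; ~-sym; ~-irrefl)
  module F = Graph (friendship n)

  N : ℕ
  N = suc (n ℕ.* 2)

  rim-unique : ∀ {i j k} → i ≢ c → j ≢ c → k ≢ c → i ~ j → i ~ k → j ≡ k
  rim-unique i≢c j≢c k≢c i~j i~k with rim-neighbour i≢c
  ... | μ , _ , _ , only with only _ i~j | only _ i~k
  ...   | inj₁ j≡c | _        = contradiction j≡c j≢c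
  ...   | inj₂ _   | inj₁ k≡c = contradiction k≡c k≢c
  ...   | inj₂ j≡μ | inj₂ k≡μ = trans j≡μ (sym k≡μ)

  -- A partial isomorphism: `m` triangles at the hub, indexed as in `friendship`. Edges between
  -- different blades are excluded afterwards by `rim-unique`.
  record Blades (m : ℕ) : Set where
    field
      vertex    : Fin (m ℕ.* 2) → Fin N
      injective : Injective _≡_ _≡_ vertex
      rim       : ∀ i → vertex i ≢ c
      paired    : ∀ i j → i ≢ j → quotient {m} 2 i ≡ quotient {m} 2 j → vertex i ~ vertex j

    with-hub : Fin (suc (m ℕ.* 2)) → Fin N
    with-hub zero    = c
    with-hub (suc i) = vertex i

    with-hub-injective : Injective _≡_ _≡_ with-hub
    with-hub-injective {zero}  {zero}  _  = refl
    with-hub-injective {zero}  {suc j} eq = contradiction (sym eq) (rim j)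
    with-hub-injective {suc i} {zero}  eq = contradiction eq (rim i)
    with-hub-injective {suc i} {suc j} eq = cong suc (injective eq)

    partner : ∀ i → vertex i ~ vertex (Mate.mate m i)
    partner i = paired i (Mate.mate m i) (Mate.mate-≢ m i) (sym (Mate.quotient-mate m i))

  extend : ∀ {m} → m ℕ.< n → Blades m → Blades (suc m)
  extend {m} m<n B = record { vertex = vertex′ ; injective = λ {i} {j} → injective′ i j ; rim = rim′ ; paired = paired′ }
    where
    open Blades B
    new : ∃[ v ] (∀ i → with-hub i ≢ v)
    -- The hub and `m` blades occupy 2m + 1 < 2n + 1 vertices.
    new = misses with-hub (ℕ.s≤s (ℕ.*-monoˡ-< 2 m<n))
    v = proj₁ new

    v≢c : v ≢ c
    v≢c v≡c = proj₂ new zero (sym v≡c)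

    fresh : ∀ i → vertex i ≢ v
    fresh i = proj₂ new (suc i)

    neighbour : ∃[ μ ] (μ ≢ c × v ~ μ × (∀ j → v ~ j → j ≡ c ⊎ j ≡ μ))
    neighbour = rim-neighbour v≢c
    μ = proj₁ neighbour

    μ≢c : μ ≢ c
    μ≢c = proj₁ (proj₂ neighbour)

    v~μ : v ~ μ
    v~μ = proj₁ (proj₂ (proj₂ neighbour))

    -- If μ lay on an old blade, its partner there and v would both be rim neighbours of μ, hence
    -- equal, although v is fresh.
    fresh′ : ∀ i → vertex i ≢ μ
    fresh′ i i≡μ = fresh (Mate.mate m i)
      (rim-unique (rim i) (rim _) v≢c (partner i) (subst (_~ v) (sym i≡μ) (~-sym v~μ)))

    v≢μ : v ≢ μ
    v≢μ v≡μ = ~-irrefl (subst (v ~_) (sym v≡μ) v~μ)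

    vertex′ : Fin (suc m ℕ.* 2) → Fin N
    vertex′ zero          = v
    vertex′ (suc zero)    = μ
    vertex′ (suc (suc i)) = vertex i

    injective′ : ∀ i j → vertex′ i ≡ vertex′ j → i ≡ j
    injective′ zero          zero          _  = refl
    injective′ zero          (suc zero)    eq = contradiction eq v≢μ
    injective′ zero          (suc (suc j)) eq = contradiction (sym eq) (fresh j)
    injective′ (suc zero)    zero          eq = contradiction (sym eq) v≢μ
    injective′ (suc zero)    (suc zero)    _  = refl
    injective′ (suc zero)    (suc (suc j)) eq = contradiction (sym eq) (fresh′ j)
    injective′ (suc (suc i)) zero          eq = contradiction eq (fresh i)
    injective′ (suc (suc i)) (suc zero)    eq = contradiction eq (fresh′ i)
    injective′ (suc (suc i)) (suc (suc j)) eq = cong (λ k → suc (suc k)) (injective eq)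

    rim′ : ∀ i → vertex′ i ≢ c
    rim′ zero          = v≢c
    rim′ (suc zero)    = μ≢c
    rim′ (suc (suc i)) = rim i

    paired′ : ∀ i j → i ≢ j → quotient {suc m} 2 i ≡ quotient {suc m} 2 j → vertex′ i ~ vertex′ j
    paired′ zero          zero          i≢j _  = contradiction refl i≢j
    paired′ zero          (suc zero)    _   _  = v~μ
    paired′ (suc zero)    zero          _   _  = ~-sym v~μ
    paired′ (suc zero)    (suc zero)    i≢j _  = contradiction refl i≢j
    paired′ (suc (suc i)) (suc (suc j)) i≢j q≡ = paired i j (i≢j ∘ cong (λ k → suc (suc k))) (suc-injective q≡)

  blades : ∀ m → m ℕ.≤ n → Blades m
  blades zero    _   = record { vertex = λ () ; injective = λ { {()} } ; rim = λ () ; paired = λ () }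
  blades (suc m) m<n = extend m<n (blades m (ℕ.<⇒≤ m<n))

  open Blades (blades n ℕ.≤-refl) hiding (injective)
  open Blades (blades n ℕ.≤-refl) using (injective)

  adjacent : ∀ i j → with-hub i ~ with-hub j ⇔ i F.~ j
  adjacent zero    zero    = mk⇔ (λ c~c → contradiction c~c ~-irrefl) (λ ())
  adjacent zero    (suc j) = mk⇔ (λ _ → tt) (λ _ → hub-adjacent (rim j))
  adjacent (suc i) zero    = mk⇔ (λ _ → tt) (λ _ → ~-sym (hub-adjacent (rim i)))
  adjacent (suc i) (suc j) = mk⇔ to (λ (i≢j , q≡) → paired i j i≢j q≡)
    where
    to : vertex i ~ vertex j → i ≢ j × quotient {n} 2 i ≡ quotient {n} 2 j
    -- The partner of vertex i and vertex j are both rim neighbours of vertex i, hence equal, so j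
    -- is the mate of i.
    to i~j = (λ { refl → ~-irrefl i~j }) ,
      trans (sym (Mate.quotient-mate n i)) (cong (quotient {n} 2) (injective (rim-unique (rim i) (rim _) (rim j) (partner i) i~j)))

  isomorphism : G ≅ friendship n
  isomorphism = mk↔ₛ′ index with-hub
      (λ i → with-hub-injective (with-hub-index (with-hub i)))
      with-hub-index ,
    λ i j → subst₂ (λ a b → a ~ b ⇔ index i F.~ index j) (with-hub-index i) (with-hub-index j) (adjacent (index i) (index j))
    where
    index : Fin N → Fin N
    index v = proj₁ (injective⇒covers with-hub with-hub-injective v)
    with-hub-index : ∀ v → with-hub (index v) ≡ v
    with-hub-index v = proj₂ (injective⇒covers with-hub with-hub-injective v)

theorem3p7 : ∀ {c ℓ₁ ℓ₂} (K : HeytingField c ℓ₁ ℓ₂) → CharacteristicZero K →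
    ∀ (n : ℕ) → 1 ℕ.≤ n →
    ∀ {N : ℕ} (G : Graph N) → Connected G → Cospectral K G (friendship n) →
    ¬ (C₅ ⊑ G) → G ≅ friendship n
theorem3p7 K char0 n 1≤n G connected cospectral C₅-free
  -- A spectrum lists one eigenvalue per vertex, so G has 2n + 1 vertices and both adjacency
  -- matrices get the same type.
  with refl ← OverField.cospectral⇒size K char0 G (friendship n) cospectral
  = Windmill.isomorphism n G (proj₁ ∃hub) hub-adjacent rim-neighbour
  where
  open LocalStructure n 1≤n G connected C₅-free
    (OverField.cospectral⇒pencils K char0 G (friendship n) cospectral)
  open Hub (proj₂ ∃hub)
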